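{- For every $n\ge1$, $\widehat{\mathrm{P}}^{\mathrm{UVAL}_n}=\widehat{\mathrm{P}}^{\mathrm{USAT}_n}$.
   Context: $\Sigma=\{0,1\}$, $\Sigma^*$ the finite nonempty binary strings; for $x\in\Sigma^m$, $\pi_1(x)=x_1$. $\mathbb{P}_+\Sigma=\{\{0\},\{1\},\Sigma\}$. A promise problem is $\phi:\Sigma^*\to\mathbb{P}_+\Sigma$. A $\phi$-oracle Turing machine may, given $x$, obtain in unit time some $y\in\phi(x)$; when $\phi(x)=\Sigma$ the returned value is nondeterministic (adversarial), independently on each call. $\phi_1\propto_T\phi_2$ means there is a $\phi_2$-oracle Turing machine $M$ and a polynomial $p$ such that on every input $x$ every possible computation path halts within $p(|x|)$ steps and outputs an element of $\phi_1(x)$. $\widehat{\mathrm{P}}^{\phi}=\{\phi_1:\phi_1\propto_T\phi\}$. Level-$n$ problems: the input encodes (e.g. as a Boolean formula) $f:\Sigma^{m_1}\times\dots\times\Sigma^{m_n}\to\Sigma$, written $f(x,\dots)$ with $x\in\Sigma^{m_1}$; $f_x$ is $f$ with $x$ fixed. For a constant $c$, $\mathrm{SAT}_0(c)=\overline{\mathrm{SAT}}_0(c)=c$; for $n\ge1$, $\mathrm{SAT}_n(f)=1\iff\exists x:\overline{\mathrm{SAT}}_{n-1}(f_x)=1$, $\overline{\mathrm{SAT}}_n(f)=1\iff\forall x,\ \mathrm{SAT}_{n-1}(f_x)=1$; $\mathrm{USAT}_n(f)=\{\mathrm{SAT}_n(f)\}$ if $|\{x:\overline{\mathrm{SAT}}_{n-1}(f_x)=1\}|\le1$,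 else $\Sigma$; $\mathrm{UVAL}_n(f)=\{\pi_1x:\overline{\mathrm{SAT}}_{n-1}(f_x)=1\}$ if there is exactly one $x$ with $\overline{\mathrm{SAT}}_{n-1}(f_x)=1$, else $\Sigma$. -}

module Defs where

open import Data.Bool.Base using (Bool; true; false; not; _∧_; _∨_; if_then_else_)
open import Data.Bool.ListAction using (any; all)
open import Data.Fin.Base using (Fin; toℕ; fromℕ<)
open import Data.Fin.Properties using (toℕ<n; fromℕ<-toℕ)
open import Data.List.Base using (List; []; _∷_; _++_; filterᵇ; length; map; concatMap; replicate)
open import Data.List.NonEmpty as List⁺ using (List⁺; _∷_)
open import Data.List.Properties using (++-assoc; ++-identityʳ)
open import Data.Maybe.Base as Maybe using (Maybe; just; nothing; _>>=_)
open import Data.Nat.Base using (ℕ; zero; suc; _+_; _*_; _≤ᵇ_; NonZero)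
open import Data.Nat.Properties using (_<?_; +-suc; +-identityʳ)
open import Data.Product.Base using (Σ-syntax; ∃; ∃-syntax; _×_; _,_)
open import Data.Unit.Base using (⊤)
open import Data.Vec.Base as Vec using (Vec; []; _∷_; head; lookup; zipWith)
open import Data.Vec.Relation.Unary.All using (All; []; _∷_)
open import Data.Vec.Relation.Unary.All.Properties using (lookup⁺)
open import Function.Bundles using (_↔_)
open import Relation.Binary.PropositionalEquality using (_≡_; refl; sym; trans; cong)
open import Relation.Nullary using (yes; no; contradiction)
open import Relation.Unary using (Pred)

------------------------------------------------------------------------
-- Promise problems

data ℙ₊Bool : Set where
  only : Bool → ℙ₊Bool
  both : ℙ₊Bool

infix 4 _∈₊_

_∈₊_ : Bool → ℙ₊Bool → Set
y ∈₊ only b = y ≡ b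
y ∈₊ both   = ⊤

PromiseProblem : Set
PromiseProblem = List⁺ Bool → ℙ₊Bool

------------------------------------------------------------------------
-- Oracle Turing machines (multi-tape, two-way infinite tapes)

Finite : Set → Set
Finite A = ∃[ k ] (A ↔ Fin k)

data Symbol (Γ : Set) : Set where
  blank : Symbol Γ
  bit   : Bool → Symbol Γ
  extra : Γ → Symbol Γ

data Move : Set where
  left stay right : Move

-- `left` lists the cells to the left of the head, nearest first; all cells
-- outside the two lists are blank.
record Tape (Γ : Set) : Set where
  constructor tape
  field
    leftward  : List (Symbol Γ)
    scanned   : Symbol Γ
    rightward : List (Symbol Γ)

open Tape public

module _ {Γ : Set} where

  empty : Tape Γ
  empty = tape [] blank []

  inscribe : List⁺ Bool → Tape Γ
  inscribe (b ∷ bs) = tape [] (bit b) (map bit bs)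

  shift : Move → Tape Γ → Tape Γ
  shift stay  t                   = t
  shift left  (tape []       s r) = tape [] blank (s ∷ r)
  shift left  (tape (s′ ∷ l) s r) = tape l s′ (s ∷ r)
  shift right (tape l s [])       = tape (s ∷ l) blank []
  shift right (tape l s (s′ ∷ r)) = tape (s ∷ l) s′ r

  writeMove : Symbol Γ × Move → Tape Γ → Tape Γ
  writeMove (s , d) (tape l _ r) = shift d (tape l s r)

  bitPrefix : List (Symbol Γ) → List Bool
  bitPrefix (bit b ∷ ss) = b ∷ bitPrefix ss
  bitPrefix _            = []

  -- The word asked to the oracle starts at the scanned cell and extends up to
  -- the first cell that does not hold a bit.
  queryWord : Tape Γ → List Bool
  queryWord (tape _ s r) = bitPrefix (s ∷ r)

data Instruction (Q Γ : Set) (k : ℕ) : Set where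
  halt : Bool → Instruction Q Γ k
  ask  : (Bool → Q) → Instruction Q Γ k
  step : (Vec (Symbol Γ) k → Q × Vec (Symbol Γ × Move) k) → Instruction Q Γ k

record OracleTM : Set₁ where
  field
    State          : Set
    State-finite   : Finite State
    Extra          : Set
    Extra-finite   : Finite Extra
    tapes          : ℕ
    inputTape      : Fin tapes
    queryTape      : Fin tapes
    start          : State
    program        : State → Instruction State Extra tapes

  Config : Set
  Config = State × Vec (Tape Extra) tapes

  initial : List⁺ Bool → Config
  initial x = start , Vec.replicate tapes empty Vec.[ inputTape ]≔ inscribe x

-- Promise problems are defined on nonempty words only; asking the empty word
-- yields an arbitrary answer.
answers : PromiseProblem → List Bool → ℙ₊Bool
answers φ []       = both
answers φ (b ∷ bs) = φ (b ∷ bs)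

module Computation (M : OracleTM) (φ : PromiseProblem) where
  open OracleTM M

  infix 4 _⟶_

  data _⟶_ : Config → Config → Set where
    step : ∀ {q ts δ} → program q ≡ step δ →
           let (q′ , acts) = δ (Vec.map scanned ts) in
           (q , ts) ⟶ (q′ , zipWith writeMove acts ts)
    ask  : ∀ {q ts next y} → program q ≡ ask next →
           y ∈₊ answers φ (queryWord (lookup ts queryTape)) →
           (q , ts) ⟶ (next y , ts)

  -- Every computation path from the given configuration halts within the
  -- given number of steps and outputs an element of Y.
  data AllPaths (Y : ℙ₊Bool) : ℕ → Config → Set where
    halted  : ∀ {t q ts y} → program q ≡ halt y → y ∈₊ Y → AllPaths Y t (q , ts)
    running : ∀ {t c} → ∃ (c ⟶_) → (∀ {c′} → c ⟶ c′ → AllPaths Y t c′) →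
              AllPaths Y (suc t) c

------------------------------------------------------------------------
-- Polynomial-time Turing reducibility

-- Coefficients, constant term first.
Polynomial : Set
Polynomial = List ℕ

eval : Polynomial → ℕ → ℕ
eval []      n = 0
eval (a ∷ p) n = a + n * eval p n

infix 4 _∝ᵀ_

_∝ᵀ_ : PromiseProblem → PromiseProblem → Set₁
φ₁ ∝ᵀ φ₂ = Σ[ M ∈ OracleTM ] Σ[ p ∈ Polynomial ] (∀ (x : List⁺ Bool) →
  Computation.AllPaths M φ₂ (φ₁ x) (eval p (List⁺.length x)) (OracleTM.initial M x))

P̂ : PromiseProblem → Pred PromiseProblem _
P̂ φ φ₁ = φ₁ ∝ᵀ φ

------------------------------------------------------------------------
-- Quantified Boolean functions

-- A block entry m stands for block length suc m, as all words are nonempty.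
Word : ℕ → Set
Word m = Vec Bool (suc m)

π₁ : ∀ {m} → Word m → Bool
π₁ = head

bitVectors : ∀ m → List (Vec Bool m)
bitVectors zero    = [] ∷ []
bitVectors (suc m) = map (false ∷_) (bitVectors m) ++ map (true ∷_) (bitVectors m)

words : ∀ m → List (Word m)
words m = bitVectors (suc m)

-- Functions Σ^m₁ × ⋯ × Σ^mₙ → Σ.
Fun : ∀ {n} → Vec ℕ n → Set
Fun ms = All Word ms → Bool

infixl 8 _at_

_at_ : ∀ {n m} {ms : Vec ℕ n} → Fun (m ∷ ms) → Word m → Fun ms
(f at x) xs = f (x ∷ xs)

mutual
  sat : ∀ {n} {ms : Vec ℕ n} → Fun ms → Bool
  sat {ms = []}     f = f []
  sat {ms = m ∷ ms} f = any (λ x → co-sat (f at x)) (words m)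

  co-sat : ∀ {n} {ms : Vec ℕ n} → Fun ms → Bool
  co-sat {ms = []}     f = f []
  co-sat {ms = m ∷ ms} f = all (λ x → sat (f at x)) (words m)

solutions : ∀ {n m} {ms : Vec ℕ n} → Fun (m ∷ ms) → List (Word m)
solutions {m = m} f = filterᵇ (λ x → co-sat (f at x)) (words m)

usat : ∀ {n} {ms : Vec ℕ (suc n)} → Fun ms → ℙ₊Bool
usat {ms = _ ∷ _} f = if length (solutions f) ≤ᵇ 1 then only (sat f) else both

uval : ∀ {n} {ms : Vec ℕ (suc n)} → Fun ms → ℙ₊Bool
uval {ms = _ ∷ _} f with solutions f
... | x ∷ [] = only (π₁ x)
... | _      = both

------------------------------------------------------------------------
-- Boolean formulas representing such functions

module _ {n : ℕ} where

  data Formula (ms : Vec ℕ n) : Set where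
    var     : (i : Fin n) → Fin (suc (lookup ms i)) → Formula ms
    const   : Bool → Formula ms
    neg     : Formula ms → Formula ms
    and or  : Formula ms → Formula ms → Formula ms

  ⟦_⟧ : ∀ {ms} → Formula ms → Fun ms
  ⟦ var i j ⟧ xs = lookup (lookup⁺ xs i) j
  ⟦ const b ⟧ xs = b
  ⟦ neg F   ⟧ xs = not (⟦ F ⟧ xs)
  ⟦ and F G ⟧ xs = ⟦ F ⟧ xs ∧ ⟦ G ⟧ xs
  ⟦ or F G  ⟧ xs = ⟦ F ⟧ xs ∨ ⟦ G ⟧ xs

Instance : ℕ → Set
Instance n = Σ[ ms ∈ Vec ℕ n ] Formula ms

------------------------------------------------------------------------
-- Instances as binary words
--
-- An instance is written as its n block lengths in unary, each followed by a
-- comma, and then the formula in reverse Polish notation.  The variable with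
-- block index i and position j (both counted from 0) is i strokes, a comma,
-- j strokes and the symbol `#`.  Each of the eight tokens takes three bits.

data Token : Set where
  stroke comma # ⊥ₜ ⊤ₜ ¬ₜ ∧ₜ ∨ₜ : Token

bits : Token → List Bool
bits stroke = false ∷ false ∷ false ∷ []
bits comma  = false ∷ false ∷ true  ∷ []
bits #      = false ∷ true  ∷ false ∷ []
bits ⊥ₜ     = false ∷ true  ∷ true  ∷ []
bits ⊤ₜ     = true  ∷ false ∷ false ∷ []
bits ¬ₜ     = true  ∷ false ∷ true  ∷ []
bits ∧ₜ     = true  ∷ true  ∷ false ∷ []
bits ∨ₜ     = true  ∷ true  ∷ true  ∷ []

blockTokens : ∀ {n} → Vec ℕ n → List Token
blockTokens []       = []
blockTokens (m ∷ ms) = replicate (suc m) stroke ++ comma ∷ blockTokens ms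

formulaTokens : ∀ {n} {ms : Vec ℕ n} → Formula ms → List Token
formulaTokens (var i j)     = replicate (toℕ i) stroke ++ comma ∷ replicate (toℕ j) stroke ++ # ∷ []
formulaTokens (const false) = ⊥ₜ ∷ []
formulaTokens (const true)  = ⊤ₜ ∷ []
formulaTokens (neg F)       = formulaTokens F ++ ¬ₜ ∷ []
formulaTokens (and F G)     = formulaTokens F ++ formulaTokens G ++ ∧ₜ ∷ []
formulaTokens (or F G)      = formulaTokens F ++ formulaTokens G ++ ∨ₜ ∷ []

encode : ∀ {n} → Instance n → List Bool
encode (ms , F) = concatMap bits (blockTokens ms ++ formulaTokens F)

token : Bool → Bool → Bool → Token
token false false false = stroke
token false false true  = comma
token false true  false = #
token false true  true  = ⊥ₜ
token true  false false = ⊤ₜ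
token true  false true  = ¬ₜ
token true  true  false = ∧ₜ
token true  true  true  = ∨ₜ

tokens : List Bool → Maybe (List Token)
tokens []               = just []
tokens (a ∷ b ∷ c ∷ bs) = Maybe.map (token a b c ∷_) (tokens bs)
tokens _                = nothing

-- The second argument is the number of strokes read since the last comma.
parseBlocks : ∀ n → ℕ → List Token → Maybe (Vec ℕ n × List Token)
parseBlocks zero    _       ts            = just ([] , ts)
parseBlocks (suc n) k       (stroke ∷ ts) = parseBlocks (suc n) (suc k) ts
parseBlocks (suc n) (suc m) (comma ∷ ts)  =
  Maybe.map (λ (ms , ts′) → m ∷ ms , ts′) (parseBlocks n 0 ts)
parseBlocks (suc n) _       _             = nothing

module _ {n : ℕ} (ms : Vec ℕ n) where

  -- The variable being read: strokes of its block index so far, or its block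
  -- index and strokes of its position so far.  `block 0` is also the state
  -- between subformulas.
  data Partial : Set where
    block    : ℕ → Partial
    position : Fin n → ℕ → Partial

  parseFormula : List (Formula ms) → Partial → List Token → Maybe (Formula ms)
  parseFormula Fs           (block k)      (stroke ∷ ts) = parseFormula Fs (block (suc k)) ts
  parseFormula Fs           (block k)      (comma ∷ ts)  with k <? n
  ... | yes k<n = parseFormula Fs (position (fromℕ< k<n) 0) ts
  ... | no  _   = nothing
  parseFormula Fs           (position i k) (stroke ∷ ts) = parseFormula Fs (position i (suc k)) ts
  parseFormula Fs           (position i k) (# ∷ ts)      with k <? suc (lookup ms i)
  ... | yes k<m = parseFormula (var i (fromℕ< k<m) ∷ Fs) (block 0) ts
  ... | no  _   = nothing
  parseFormula Fs           (block 0)      (⊥ₜ ∷ ts)     = parseFormula (const false ∷ Fs) (block 0) ts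
  parseFormula Fs           (block 0)      (⊤ₜ ∷ ts)     = parseFormula (const true ∷ Fs) (block 0) ts
  parseFormula (F ∷ Fs)     (block 0)      (¬ₜ ∷ ts)     = parseFormula (neg F ∷ Fs) (block 0) ts
  parseFormula (G ∷ F ∷ Fs) (block 0)      (∧ₜ ∷ ts)     = parseFormula (and F G ∷ Fs) (block 0) ts
  parseFormula (G ∷ F ∷ Fs) (block 0)      (∨ₜ ∷ ts)     = parseFormula (or F G ∷ Fs) (block 0) ts
  parseFormula (F ∷ [])     (block 0)      []            = just F
  parseFormula _            _              _             = nothing

decode : ∀ n → List Bool → Maybe (Instance n)
decode n w = do
  ts        ← tokens w
  (ms , us) ← parseBlocks n 0 ts
  F         ← parseFormula ms [] (block 0) us
  just (ms , F)

-- `decode` inverts `encode`.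

private
  tokens-bits : ∀ t bs → tokens (bits t ++ bs) ≡ Maybe.map (t ∷_) (tokens bs)
  tokens-bits stroke bs = refl
  tokens-bits comma  bs = refl
  tokens-bits #      bs = refl
  tokens-bits ⊥ₜ     bs = refl
  tokens-bits ⊤ₜ     bs = refl
  tokens-bits ¬ₜ     bs = refl
  tokens-bits ∧ₜ     bs = refl
  tokens-bits ∨ₜ     bs = refl

tokens-concatMap : ∀ ts → tokens (concatMap bits ts) ≡ just ts
tokens-concatMap []       = refl
tokens-concatMap (t ∷ ts) =
  trans (tokens-bits t (concatMap bits ts)) (cong (Maybe.map (t ∷_)) (tokens-concatMap ts))

private
  parseBlocks-strokes : ∀ {n} k l ts →
    parseBlocks (suc n) k (replicate l stroke ++ ts) ≡ parseBlocks (suc n) (l + k) ts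
  parseBlocks-strokes k zero    ts = refl
  parseBlocks-strokes {n} k (suc l) ts =
    trans (parseBlocks-strokes (suc k) l ts) (cong (λ i → parseBlocks (suc n) i ts) (+-suc l k))

parseBlocks-blockTokens : ∀ {n} (ms : Vec ℕ n) ts →
  parseBlocks n 0 (blockTokens ms ++ ts) ≡ just (ms , ts)
parseBlocks-blockTokens []       ts = refl
parseBlocks-blockTokens {suc n} (m ∷ ms) ts
  rewrite ++-assoc (replicate m stroke) (comma ∷ blockTokens ms) ts
        | parseBlocks-strokes {n} 1 m (comma ∷ blockTokens ms ++ ts)
        | +-suc m 0 | +-identityʳ m
        | parseBlocks-blockTokens ms ts = refl

module _ {n : ℕ} (ms : Vec ℕ n) where

  private
    block-strokes : ∀ Fs k l ts →
      parseFormula ms Fs (block k) (replicate l stroke ++ ts) ≡ parseFormula ms Fs (block (l + k)) ts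
    block-strokes Fs k zero    ts = refl
    block-strokes Fs k (suc l) ts =
      trans (block-strokes Fs (suc k) l ts) (cong (λ i → parseFormula ms Fs (block i) ts) (+-suc l k))

    position-strokes : ∀ Fs i k l ts →
      parseFormula ms Fs (position i k) (replicate l stroke ++ ts) ≡ parseFormula ms Fs (position i (l + k)) ts
    position-strokes Fs i k zero    ts = refl
    position-strokes Fs i k (suc l) ts =
      trans (position-strokes Fs i (suc k) l ts) (cong (λ j → parseFormula ms Fs (position i j) ts) (+-suc l k))

    comma-step : ∀ Fs (i : Fin n) ts →
      parseFormula ms Fs (block (toℕ i)) (comma ∷ ts) ≡ parseFormula ms Fs (position i 0) ts
    comma-step Fs i ts with toℕ i <? n
    ... | yes i<n = cong (λ i′ → parseFormula ms Fs (position i′ 0) ts) (fromℕ<-toℕ i i<n)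
    ... | no  i≮n = contradiction (toℕ<n i) i≮n

    #-step : ∀ Fs i (j : Fin (suc (lookup ms i))) ts →
      parseFormula ms Fs (position i (toℕ j)) (# ∷ ts) ≡ parseFormula ms (var i j ∷ Fs) (block 0) ts
    #-step Fs i j ts with toℕ j <? suc (lookup ms i)
    ... | yes j<m = cong (λ j′ → parseFormula ms (var i j′ ∷ Fs) (block 0) ts) (fromℕ<-toℕ j j<m)
    ... | no  j≮m = contradiction (toℕ<n j) j≮m

  parseFormula-formulaTokens : ∀ F Fs ts →
    parseFormula ms Fs (block 0) (formulaTokens F ++ ts) ≡ parseFormula ms (F ∷ Fs) (block 0) ts
  parseFormula-formulaTokens (var i j) Fs ts
    rewrite ++-assoc (replicate (toℕ i) stroke) (comma ∷ replicate (toℕ j) stroke ++ # ∷ []) ts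
          | ++-assoc (replicate (toℕ j) stroke) (# ∷ []) ts
          | block-strokes Fs 0 (toℕ i) (comma ∷ replicate (toℕ j) stroke ++ # ∷ ts)
          | +-identityʳ (toℕ i)
          | comma-step Fs i (replicate (toℕ j) stroke ++ # ∷ ts)
          | position-strokes Fs i 0 (toℕ j) (# ∷ ts)
          | +-identityʳ (toℕ j) = #-step Fs i j ts
  parseFormula-formulaTokens (const false) Fs ts = refl
  parseFormula-formulaTokens (const true)  Fs ts = refl
  parseFormula-formulaTokens (neg F) Fs ts
    rewrite ++-assoc (formulaTokens F) (¬ₜ ∷ []) ts = parseFormula-formulaTokens F Fs (¬ₜ ∷ ts)
  parseFormula-formulaTokens (and F G) Fs ts
    rewrite ++-assoc (formulaTokens F) (formulaTokens G ++ ∧ₜ ∷ []) ts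
          | ++-assoc (formulaTokens G) (∧ₜ ∷ []) ts
          | parseFormula-formulaTokens F Fs (formulaTokens G ++ ∧ₜ ∷ ts) =
      parseFormula-formulaTokens G (F ∷ Fs) (∧ₜ ∷ ts)
  parseFormula-formulaTokens (or F G) Fs ts
    rewrite ++-assoc (formulaTokens F) (formulaTokens G ++ ∨ₜ ∷ []) ts
          | ++-assoc (formulaTokens G) (∨ₜ ∷ []) ts
          | parseFormula-formulaTokens F Fs (formulaTokens G ++ ∨ₜ ∷ ts) =
      parseFormula-formulaTokens G (F ∷ Fs) (∨ₜ ∷ ts)

decode-encode : ∀ {n} (I : Instance n) → decode n (encode I) ≡ just I
decode-encode (ms , F)
  rewrite tokens-concatMap (blockTokens ms ++ formulaTokens F)
        | parseBlocks-blockTokens ms (formulaTokens F)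
        | sym (++-identityʳ (formulaTokens F))
        | parseFormula-formulaTokens ms F [] [] = refl

------------------------------------------------------------------------
-- The problems USATₙ and UVALₙ, n ≥ 1.  Words that encode no instance lie
-- outside the promise.

onInstances : ∀ n → (Instance n → ℙ₊Bool) → PromiseProblem
onInstances n φ w = Maybe.maybe′ φ both (decode n (List⁺.toList w))

USAT : ∀ n → .{{NonZero n}} → PromiseProblem
USAT (suc n) = onInstances (suc n) λ (_ , F) → usat ⟦ F ⟧

UVAL : ∀ n → .{{NonZero n}} → PromiseProblem
UVAL (suc n) = onInstances (suc n) λ (_ , F) → uval ⟦ F ⟧

{-# OPTIONS --safe #-}
module Submission where

-- UVALₙ is answered by one query to USATₙ: if F has a unique solution x, then
-- F ∧ x₀ has at most one solution, and it has one iff the first bit of x is 1.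
--
-- Conversely let F have at most one solution.  With a new first variable b, the
-- formulas F ∧ (b ↔ x_j) let UVALₙ spell out a word c that is the solution of F
-- if there is one, so USATₙ(F) asks whether ∀y SATₙ₋₂(F_{c,y}).  In one last query
-- the first block holds b, x and z, and the formula says x = c and
--   either b = 1, z is the least word of all, and ∀y SATₙ₋₂(F_{x,y}),
--   or     b = 0, and z is the least y such that ¬SATₙ₋₂(F_{x,y}).
-- It always has exactly one solution, whose bit b is the answer (for n = 1 there is
-- neither y nor z, and b is the value of F_c).  The formula stays at
-- level n since ¬SATₙ₋₂(F_{x,z}) starts with ∀ and is played on a second track of
-- the blocks, one block earlier than the rest; "least" is expressed by comparing
-- z with the universally quantified y.
--
-- All blocks of the last query are long enough to hold N bits per track, where N
-- is the length of the word encoding F, so that a machine can write the query by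
-- sweeping over its tapes.

open import Defs
open import Data.Bool.Base using (Bool; true; false; not; _∧_; _∨_; if_then_else_)
open import Data.Bool.ListAction using (any; all)
open import Data.Bool.Properties using (∧-identityʳ; ∧-zeroʳ; T-≡; T?)
open import Data.Fin.Base using (Fin; zero; suc; toℕ; fromℕ<; inject₁; inject≤; _↑ʳ_)
open import Data.Fin.Properties using (1↔⊤; 2↔Bool; +↔⊎; *↔×; toℕ<n; toℕ-fromℕ<; toℕ-inject₁; inject≤-refl)
open import Data.List.Base using (List; []; _∷_; _++_; _ʳ++_; _∷ʳ_; concat; concatMap; filterᵇ; foldl; length; map; replicate; reverse)
open import Data.List.Membership.Propositional using (_∈_)
open import Data.List.Membership.Propositional.Properties using (∈-map⁺; ∈-++⁺ˡ; ∈-++⁺ʳ; ∈-map⁻; ∈-filter⁺; ∈-filter⁻)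
open import Data.List.NonEmpty as List⁺ using (_∷_)
open import Data.List.Properties using (++-assoc; ++-identityʳ; ++-ʳ++; concatMap-++; foldl-∷ʳ; length-++; length-map; length-replicate; length-reverse; map-++; map-ʳ++; reverse-involutive; ʳ++-defn)
open import Data.List.Relation.Unary.AllPairs using ([]; _∷_)
open import Data.List.Relation.Unary.All using ([]; _∷_)
open import Data.List.Relation.Unary.Any using (here; there)
open import Data.List.Relation.Unary.Unique.Propositional using (Unique)
open import Data.List.Relation.Unary.Unique.Propositional.Properties using (map⁺; ++⁺; filter⁺)
open import Data.Maybe.Base using (Maybe; just; nothing)
open import Data.Nat.Base
open import Data.Nat.Properties
open import Data.Nat.Tactic.RingSolver using (solve-∀)
open import Data.Product.Base using (Σ; Σ-syntax; ∃; ∃-syntax; _×_; _,_; proj₁; proj₂)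
open import Data.Product.Function.Dependent.Propositional using (Σ-↔)
open import Data.Product.Function.NonDependent.Propositional using (_×-↔_)
open import Data.Sum.Base using (_⊎_; inj₁; inj₂; [_,_])
open import Data.Sum.Function.Propositional using (_⊎-↔_)
open import Data.Unit.Base using (⊤; tt)
open import Data.Vec.Base as Vec using (Vec; []; _∷_; head; lookup; tabulate; updateAt; zipWith; _[_]≔_)
open import Data.Vec.Properties using (∷-injectiveʳ; []≔-commutes; []≔-lookup; lookup-map; lookup-replicate; lookup-zipWith; lookup∘updateAt; lookup∘updateAt′; updateAt-updateAt)
open import Data.Vec.Relation.Binary.Pointwise.Inductive as Pointwise using (Pointwise; []; _∷_)
open import Data.Vec.Relation.Unary.All as AllV using ([]; _∷_)
open import Data.Vec.Relation.Unary.All.Properties using (lookup⁺)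
open import Function.Base using (_∘_)
open import Function.Bundles using (_↔_; Equivalence; Inverse; mk↔ₛ′)
open import Function.Construct.Composition using (_↔-∘_)
open import Function.Construct.Identity using (↔-id)
open import Function.Construct.Symmetry using (↔-sym)
open import Relation.Binary.PropositionalEquality using (_≡_; _≢_; refl; sym; trans; cong; cong₂; subst)
open import Relation.Nullary using (¬_; yes; no; contradiction)
open import Relation.Unary using (_≐_)

-- Finite sets

-- `UVAL` says nothing unless there is exactly one solution, so the last query must come with a
-- unique witness for either verdict. A y that refutes c witnesses verdict 0 but need not be unique,
-- hence the least one; verdict 1 would leave z free, hence the least word. If F has no solution,
-- the probes are answered adversarially and c is arbitrary. This is harmless: nothing satisfies F,
-- so the verdict on c is 0 anyway.
--
-- Two games can share the blocks on disjoint tracks because, with the same order of quantifiers,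
-- their conjunction is won iff both are. Negation swaps the quantifiers; choosing z already in
-- block 0 lets the negated game start one block earlier, which aligns it again.
--
-- As for machines, each problem is answered by a program fragment with a polynomial time bound,
-- spliced into an arbitrary oracle machine in place of its queries. Any reply of the fragment is
-- one that the oracle might have given, so runs of the new machine follow runs of the old one. No
-- machine parses its input or computes a block length: queries are made by editing tokens, and N
-- replies are collected whatever the length of the first block.

record IsFinite (A : Set) : Set where
  constructor finite
  field isFinite : Finite A

open IsFinite public

via : ∀ {A B} → A ↔ B → IsFinite B → IsFinite A
via A↔B (finite (k , B↔k)) = finite (k , B↔k ↔-∘ A↔B)

Σ-Fin-suc : ∀ {k} {B : Fin (suc k) → Set} → Σ (Fin (suc k)) B ↔ (B zero ⊎ Σ (Fin k) (B ∘ suc))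
Σ-Fin-suc = mk↔ₛ′
  (λ { (zero , b) → inj₁ b ; (suc i , b) → inj₂ (i , b) })
  (λ { (inj₁ b) → zero , b ; (inj₂ (i , b)) → suc i , b })
  (λ { (inj₁ b) → refl ; (inj₂ (i , b)) → refl })
  (λ { (zero , b) → refl ; (suc i , b) → refl })

instance
  ⊤-finite : IsFinite ⊤
  ⊤-finite = finite (1 , ↔-sym 1↔⊤)

  Bool-finite : IsFinite Bool
  Bool-finite = finite (2 , ↔-sym 2↔Bool)

  ⊎-finite : ∀ {A B} → {{IsFinite A}} → {{IsFinite B}} → IsFinite (A ⊎ B)
  ⊎-finite {{finite (_ , A↔)}} {{finite (_ , B↔)}} = finite (_ , ↔-sym +↔⊎ ↔-∘ (A↔ ⊎-↔ B↔))

  ×-finite : ∀ {A B} → {{IsFinite A}} → {{IsFinite B}} → IsFinite (A × B)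
  ×-finite {{finite (_ , A↔)}} {{finite (_ , B↔)}} = finite (_ , ↔-sym *↔× ↔-∘ (A↔ ×-↔ B↔))

  Maybe-finite : ∀ {A} → {{IsFinite A}} → IsFinite (Maybe A)
  Maybe-finite {A} = via Maybe↔⊤⊎ ⊎-finite
    where
    Maybe↔⊤⊎ : Maybe A ↔ (⊤ ⊎ A)
    Maybe↔⊤⊎ = mk↔ₛ′ (λ { nothing → inj₁ tt ; (just a) → inj₂ a })
                      (λ { (inj₁ tt) → nothing ; (inj₂ a) → just a })
                      (λ { (inj₁ tt) → refl ; (inj₂ a) → refl })
                      (λ { nothing → refl ; (just a) → refl })

Σ-Fin-finite : ∀ {k} {B : Fin k → Set} → (∀ i → IsFinite (B i)) → IsFinite (Σ (Fin k) B)
Σ-Fin-finite {zero}  _   = finite (0 , mk↔ₛ′ proj₁ (λ ()) (λ ()) (λ ()))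
Σ-Fin-finite {suc k} fin = via Σ-Fin-suc (⊎-finite {{fin zero}} {{Σ-Fin-finite (fin ∘ suc)}})

Σ-finite : ∀ {A} {B : A → Set} → IsFinite A → (∀ a → IsFinite (B a)) → IsFinite (Σ A B)
Σ-finite {B = B} (finite (k , A↔k)) fin =
  via (↔-sym (Σ-↔ {B = B} (↔-sym A↔k) (↔-id _))) (Σ-Fin-finite (fin ∘ Inverse.from A↔k))

-- Polynomial bounds

eval-mono : ∀ p {m n} → m ≤ n → eval p m ≤ eval p n
eval-mono []      m≤n = z≤n
eval-mono (a ∷ p) m≤n = +-monoʳ-≤ a (*-mono-≤ m≤n (eval-mono p m≤n))

-- Running times are written as plain functions. A certificate assembled along the same expression,
-- by the combinators below, turns such a function into the coefficient list that `_∝ᵀ_` asks for.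
PolyBounded : (ℕ → ℕ) → Set
PolyBounded f = Σ[ p ∈ Polynomial ] (∀ n → f n ≤ eval p n)

private
  _⊞_ : Polynomial → Polynomial → Polynomial
  []      ⊞ q       = q
  (a ∷ p) ⊞ []      = a ∷ p
  (a ∷ p) ⊞ (b ∷ q) = a + b ∷ p ⊞ q

  scale : ℕ → Polynomial → Polynomial
  scale a []      = []
  scale a (b ∷ q) = a * b ∷ scale a q

  _⊠_ : Polynomial → Polynomial → Polynomial
  []      ⊠ q = []
  (a ∷ p) ⊠ q = scale a q ⊞ (0 ∷ p ⊠ q)

  _⊚_ : Polynomial → Polynomial → Polynomial
  []      ⊚ q = []
  (a ∷ p) ⊚ q = (a ∷ []) ⊞ (q ⊠ (p ⊚ q))

  eval-⊞ : ∀ p q n → eval (p ⊞ q) n ≡ eval p n + eval q n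
  eval-⊞ []      q       n = refl
  eval-⊞ (a ∷ p) []      n = sym (+-identityʳ _)
  eval-⊞ (a ∷ p) (b ∷ q) n rewrite eval-⊞ p q n = lemma a b n (eval p n) (eval q n)
    where
    lemma : ∀ a b n x y → a + b + n * (x + y) ≡ a + n * x + (b + n * y)
    lemma = solve-∀

  eval-scale : ∀ a q n → eval (scale a q) n ≡ a * eval q n
  eval-scale a []      n = sym (*-zeroʳ a)
  eval-scale a (b ∷ q) n rewrite eval-scale a q n = lemma a b n (eval q n)
    where
    lemma : ∀ a b n y → a * b + n * (a * y) ≡ a * (b + n * y)
    lemma = solve-∀

  eval-⊠ : ∀ p q n → eval (p ⊠ q) n ≡ eval p n * eval q n
  eval-⊠ []      q n = refl
  eval-⊠ (a ∷ p) q n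
    rewrite eval-⊞ (scale a q) (0 ∷ p ⊠ q) n | eval-scale a q n | eval-⊠ p q n =
      lemma a n (eval p n) (eval q n)
    where
    lemma : ∀ a n x y → a * y + n * (x * y) ≡ (a + n * x) * y
    lemma = solve-∀

  eval-⊚ : ∀ p q n → eval (p ⊚ q) n ≡ eval p (eval q n)
  eval-⊚ []      q n = refl
  eval-⊚ (a ∷ p) q n
    rewrite eval-⊞ (a ∷ []) (q ⊠ (p ⊚ q)) n | eval-⊠ q (p ⊚ q) n | eval-⊚ p q n | *-zeroʳ n | +-identityʳ a = refl

constᴾ : ∀ a → PolyBounded (λ _ → a)
constᴾ a = a ∷ [] , λ n → m≤m+n a _

idᴾ : PolyBounded (λ n → n)
idᴾ = 0 ∷ 1 ∷ [] , λ n → ≤-reflexive (lemma n)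
  where
  lemma : ∀ n → n ≡ n * (1 + n * 0)
  lemma = solve-∀

evalᴾ : ∀ p → PolyBounded (eval p)
evalᴾ p = p , λ n → ≤-refl

infixl 6 _+ᴾ_
infixl 7 _*ᴾ_

_+ᴾ_ : ∀ {f g} → PolyBounded f → PolyBounded g → PolyBounded (λ n → f n + g n)
(p , f≤p) +ᴾ (q , g≤q) = p ⊞ q , λ n →
  subst (_ ≤_) (sym (eval-⊞ p q n)) (+-mono-≤ (f≤p n) (g≤q n))

_*ᴾ_ : ∀ {f g} → PolyBounded f → PolyBounded g → PolyBounded (λ n → f n * g n)
(p , f≤p) *ᴾ (q , g≤q) = p ⊠ q , λ n →
  subst (_ ≤_) (sym (eval-⊠ p q n)) (*-mono-≤ (f≤p n) (g≤q n))

_∘ᴾ_ : ∀ {f g} → PolyBounded f → PolyBounded g → PolyBounded (λ n → f (g n))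
_∘ᴾ_ {g = g} (p , f≤p) (q , g≤q) = p ⊚ q , λ n →
  subst (_ ≤_) (sym (eval-⊚ p q n)) (≤-trans (f≤p (g n)) (eval-mono p (g≤q n)))

-- Tapes seen from the head

data Side : Set where
  leftwards rightwards : Side

towards : Side → Move
towards leftwards  = left
towards rightwards = right

module _ {Γ : Set} where

  -- `far` lists the scanned cell and the ones ahead, `near` those already passed.
  view : Side → (near far : List (Symbol Γ)) → Tape Γ
  view leftwards  near []        = tape [] blank near
  view leftwards  near (s ∷ far) = tape far s near
  view rightwards near []        = tape near blank []
  view rightwards near (s ∷ far) = tape near s far

  shift-view : ∀ d near s far → shift (towards d) (view d near (s ∷ far)) ≡ view d (s ∷ near) far
  shift-view leftwards  near s []        = refl
  shift-view leftwards  near s (_ ∷ far) = refl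
  shift-view rightwards near s []        = refl
  shift-view rightwards near s (_ ∷ far) = refl

  toBit : Symbol Γ → Maybe Bool
  toBit (bit b) = just b
  toBit _       = nothing

  scanned-end : ∀ d near far → bitPrefix far ≡ [] → toBit (scanned (view d near far)) ≡ nothing
  scanned-end leftwards  near []            _ = refl
  scanned-end leftwards  near (blank ∷ _)   _ = refl
  scanned-end leftwards  near (extra _ ∷ _) _ = refl
  scanned-end rightwards near []            _ = refl
  scanned-end rightwards near (blank ∷ _)   _ = refl
  scanned-end rightwards near (extra _ ∷ _) _ = refl

  scanned-bit : ∀ d near b far → toBit (scanned (view d near (bit b ∷ far))) ≡ just b
  scanned-bit leftwards  near b far = refl
  scanned-bit rightwards near b far = refl

-- Program fragments with a finite control

record Cmd (Γ : Set) (k : ℕ) (X : Set) : Set₁ where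
  no-eta-equality
  field
    Loc        : Set
    Loc-finite : IsFinite Loc
    entry      : Loc
    -- Polymorphic in the states `Q` of the surrounding machine, so that one fragment can be placed
    -- anywhere and more than once.
    code       : {Q : Set} → (Loc → Q) → (X → Q) → Loc → Instruction Q Γ k

open Cmd public

module _ {Γ : Set} {k : ℕ} where

  stays : Vec (Symbol Γ) k → Vec (Symbol Γ × Move) k
  stays = Vec.map (_, stay)

  done : ∀ {X} → X → Cmd Γ k X
  done x .Loc            = ⊤
  done x .Loc-finite     = ⊤-finite
  done x .entry          = tt
  done x .code loc exit _ = step λ ss → exit x , stays ss

  op : Fin k → (Symbol Γ → Symbol Γ × Move) → Cmd Γ k ⊤
  op i f .Loc            = ⊤
  op i f .Loc-finite     = ⊤-finite
  op i f .entry          = tt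
  op i f .code loc exit _ = step λ ss → exit tt , updateAt (stays ss) i (f ∘ proj₁)

  read : Fin k → Cmd Γ k (Maybe Bool)
  read i .Loc            = ⊤
  read i .Loc-finite     = ⊤-finite
  read i .entry          = tt
  read i .code loc exit _ = step λ ss → exit (toBit (lookup ss i)) , stays ss

  query : Cmd Γ k Bool
  query .Loc            = ⊤
  query .Loc-finite     = ⊤-finite
  query .entry          = tt
  query .code loc exit _ = ask exit

  infixl 1 _>>=_ _>>_

  _>>=_ : ∀ {X Y} → {{IsFinite X}} → Cmd Γ k X → (X → Cmd Γ k Y) → Cmd Γ k Y
  (c >>= f) .Loc                             = Loc c ⊎ Σ[ x ∈ _ ] Loc (f x)
  (_>>=_ {{fin}} c f) .Loc-finite            = ⊎-finite {{Loc-finite c}} {{Σ-finite fin (Loc-finite ∘ f)}}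
  (c >>= f) .entry                           = inj₁ (entry c)
  (c >>= f) .code loc exit (inj₁ l)       = code c (loc ∘ inj₁) (λ x → loc (inj₂ (x , entry (f x)))) l
  (c >>= f) .code loc exit (inj₂ (x , l)) = code (f x) (λ l → loc (inj₂ (x , l))) exit l

  _>>_ : ∀ {X Y} → {{IsFinite X}} → Cmd Γ k X → Cmd Γ k Y → Cmd Γ k Y
  c >> d = c >>= λ _ → d

  -- The loop variable lives in the finite control, and jumping back costs no step of its own.
  iter : ∀ {A B} → {{IsFinite A}} → (A → Cmd Γ k (A ⊎ B)) → A → Cmd Γ k B
  iter f a .Loc                 = Σ[ a ∈ _ ] Loc (f a)
  iter {{fin}} f a .Loc-finite  = Σ-finite fin (Loc-finite ∘ f)
  iter f a .entry               = a , entry (f a)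
  iter f _ .code loc exit (a , l) =
    code (f a) (λ l → loc (a , l)) [ (λ a′ → loc (a′ , entry (f a′))) , exit ] l

  move : Side → Fin k → Cmd Γ k ⊤
  move d i = op i (_, towards d)

  push : Fin k → Bool → Cmd Γ k ⊤
  push i b = op i λ _ → bit b , right

  module _ {S : Set} {{_ : IsFinite S}} (d : Side) (i : Fin k) (body : S → Bool → Cmd Γ k S) where

    sweepRead : S → Maybe Bool → Cmd Γ k (S ⊎ S)
    sweepRead s nothing  = done (inj₂ s)
    sweepRead s (just b) = body s b >>= λ s′ → move d i >> done (inj₁ s′)

    sweep : S → Cmd Γ k S
    sweep = iter λ s → read i >>= sweepRead s

-- Running fragments inside a machine: postconditions with a time bound

zipWith-stays : ∀ {Γ k} (ts : Vec (Tape Γ) k) → zipWith writeMove (stays (Vec.map scanned ts)) ts ≡ ts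
zipWith-stays []       = refl
zipWith-stays (t ∷ ts) = cong (t ∷_) (zipWith-stays ts)

zipWith-op : ∀ {Γ k} (i : Fin k) (f : Symbol Γ → Symbol Γ × Move) (ts : Vec (Tape Γ) k) →
  zipWith writeMove (updateAt (stays (Vec.map scanned ts)) i (f ∘ proj₁)) ts
    ≡ updateAt ts i (λ t → writeMove (f (scanned t)) t)
zipWith-op zero    f (t ∷ ts) = cong (_ ∷_) (zipWith-stays ts)
zipWith-op (suc i) f (t ∷ ts) = cong (t ∷_) (zipWith-op i f ts)

-- Answer sets are nonempty, so asking is never a dead end; `running` demands a successor.
some : ∀ Y → ∃[ y ] y ∈₊ Y
some (only b) = b , refl
some both     = true , tt

-- Each bit costs a read, the body, a move and the `done` that requests another round; the end of
-- the word costs a read and the final `done`.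
sweepTime : ℕ → ℕ → ℕ
sweepTime n τ = n * (3 + τ) + 2

module Exec (M : OracleTM) (φ : PromiseProblem) where
  open OracleTM M
  open Computation M φ

  Tapes : Set
  Tapes = Vec (Tape Extra) tapes

  Command : Set → Set₁
  Command = Cmd Extra tapes

  AllPaths-mono : ∀ {Y t t′ c} → t ≤ t′ → AllPaths Y t c → AllPaths Y t′ c
  AllPaths-mono t≤t′       (halted p y∈)     = halted p y∈
  AllPaths-mono (s≤s t≤t′) (running c⟶ next) = running c⟶ (AllPaths-mono t≤t′ ∘ next)

  Placed : ∀ {X} (c : Command X) → (Loc c → State) → (X → State) → Set
  Placed c loc exit = ∀ l → program (loc l) ≡ code c loc exit l

  -- Wherever c is placed in M, all its runs from ts reach an exit satisfying
  -- Post within t steps.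
  record Exec {X} (c : Command X) (ts : Tapes) (t : ℕ) (Post : X → Tapes → Set) : Set where
    no-eta-equality
    field
      paths : ∀ {loc exit} → Placed c loc exit → ∀ {Y u} →
        (∀ {x ts′} → Post x ts′ → AllPaths Y u (exit x , ts′)) →
        AllPaths Y (t + u) (loc (entry c) , ts)

  open Exec public

  Returns : ∀ {X} → X → Tapes → X → Tapes → Set
  Returns x ts x′ ts′ = x′ ≡ x × ts′ ≡ ts

  exec-weaken : ∀ {X} {c : Command X} {ts t t′ Post} → t ≤ t′ → Exec c ts t Post → Exec c ts t′ Post
  exec-weaken t≤t′ h .paths pl k = AllPaths-mono (+-monoˡ-≤ _ t≤t′) (h .paths pl k)

  exec-post : ∀ {X} {c : Command X} {ts t P R} → (∀ {x ts′} → P x ts′ → R x ts′) →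
              Exec c ts t P → Exec c ts t R
  exec-post P⇒R h .paths pl k = h .paths pl (k ∘ P⇒R)

  step-paths : ∀ {Y u q ts δ q′ ts′} → program q ≡ step δ →
    q′ ≡ proj₁ (δ (Vec.map scanned ts)) → zipWith writeMove (proj₂ (δ (Vec.map scanned ts))) ts ≡ ts′ →
    AllPaths Y u (q′ , ts′) → AllPaths Y (suc u) (q , ts)
  step-paths {Y} {u} {q} {ts} {δ} eq refl refl rest = running (_ , step eq) unique
    where
    unique : ∀ {c′} → (q , ts) ⟶ c′ → AllPaths Y u c′
    unique (step eq′) with trans (sym eq) eq′
    ... | refl = rest
    unique (ask eq′ _) with trans (sym eq) eq′
    ... | ()

  goto-paths : ∀ {Y u q q′ ts} → program q ≡ step (λ ss → q′ , stays ss) →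
               AllPaths Y u (q′ , ts) → AllPaths Y (suc u) (q , ts)
  goto-paths {ts = ts} eq = step-paths eq refl (zipWith-stays ts)

  done-exec : ∀ {X} {x : X} {ts} → Exec (done x) ts 1 (Returns x ts)
  done-exec {ts = ts} .paths pl k = step-paths (pl tt) refl (zipWith-stays ts) (k (refl , refl))

  op-exec′ : ∀ {i f ts} → Exec (op i f) ts 1 (Returns tt (updateAt ts i (λ t → writeMove (f (scanned t)) t)))
  op-exec′ {i} {f} {ts} .paths pl k = step-paths (pl tt) refl (zipWith-op i f ts) (k (refl , refl))

  op-exec : ∀ {i f} ts {t} → Exec (op i f) (ts [ i ]≔ t) 1 (Returns tt (ts [ i ]≔ writeMove (f (scanned t)) t))
  op-exec {i} {f} ts {t} =
    exec-post (λ (eq , eq′) → eq , trans eq′ (updateAt-updateAt i ts)) op-exec′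

  read-exec : ∀ {i} ts {t} → Exec (read i) (ts [ i ]≔ t) 1 (Returns (toBit (scanned t)) (ts [ i ]≔ t))
  read-exec {i} ts {t} .paths pl k =
    step-paths (pl tt) refl (zipWith-stays (ts [ i ]≔ t)) (k (cong toBit scanned≡ , refl))
    where
    scanned≡ : lookup (Vec.map scanned (ts [ i ]≔ t)) i ≡ scanned t
    scanned≡ = trans (lookup-map i scanned (ts [ i ]≔ t)) (cong scanned (lookup∘updateAt i ts))

  query-exec : ∀ {ts} → Exec query ts 1 (λ y ts′ → y ∈₊ answers φ (queryWord (lookup ts queryTape)) × ts′ ≡ ts)
  query-exec {ts} .paths {loc} {exit} pl {Y} {u} k = running (_ , ask (pl tt) (proj₂ (some _))) each
    where
    each : ∀ {c′} → (loc tt , ts) ⟶ c′ → AllPaths Y u c′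
    each (step eq) with trans (sym (pl tt)) eq
    ... | ()
    each (ask eq y∈) with trans (sym (pl tt)) eq
    ... | refl = k (y∈ , refl)

  bind-exec : ∀ {X Z} {{_ : IsFinite X}} {c : Command X} {f : X → Command Z} {ts t t′ P R} →
    Exec c ts t P → (∀ {x ts′} → P x ts′ → Exec (f x) ts′ t′ R) → Exec (c >>= f) ts (t + t′) R
  bind-exec {t = t} {t′} h g .paths pl {u = u} k rewrite +-assoc t t′ u =
    h .paths (pl ∘ inj₁) (λ p → g p .paths (λ l → pl (inj₂ (_ , l))) k)

  then-exec : ∀ {X Z} {{_ : IsFinite X}} {c : Command X} {f : X → Command Z} {ts t t′ x ts′ R} →
    Exec c ts t (Returns x ts′) → Exec (f x) ts′ t′ R → Exec (c >>= f) ts (t + t′) R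
  then-exec {c = c} {f} {t′ = t′} {R = R} h g = bind-exec {c = c} {f} h λ { (refl , refl) → g }

  -- Treats one round only. Loops carry no termination argument; the bound `t′` for the remaining
  -- rounds comes from an induction of the caller, for sweeps over the bits ahead of the head.
  iter-exec : ∀ {A B} {{_ : IsFinite A}} {f : A → Command (A ⊎ B)} {a ts t t′ P R} →
    Exec (f a) ts t P →
    (∀ {a′ ts′} → P (inj₁ a′) ts′ → Exec (iter f a′) ts′ t′ R) →
    (∀ {b ts′} → P (inj₂ b) ts′ → R b ts′) →
    Exec (iter f a) ts (t + t′) R
  iter-exec {f = f} {t = t} {t′} {P} h loop exit⇒ .paths {loc} {exit} pl {Y} {u} k rewrite +-assoc t t′ u =
    h .paths (λ l → pl (_ , l)) continue
    where
    continue : ∀ {r ts′} → P r ts′ → AllPaths Y (t′ + u)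
      ([ (λ a′ → loc (a′ , entry (f a′))) , exit ] r , ts′)
    continue {inj₁ a′} p = loop p .paths pl k
    continue {inj₂ b}  p = AllPaths-mono (m≤n+m u t′) (k (exit⇒ p))

  -- The invariant I v s ts speaks of the bits v passed so far; the contents of
  -- tape i itself in ts are irrelevant.
  sweep-exec : ∀ {S} {{_ : IsFinite S}} {d i} {body : S → Bool → Command S} {τ}
    (I : List Bool → S → Tapes → Set) whole →
    (∀ {v s ts} b w t → v ++ b ∷ w ≡ whole → I v s ts →
      Exec (body s b) (ts [ i ]≔ t) τ (λ s′ ts′ → ∃[ ts″ ] I (v ∷ʳ b) s′ ts″ × ts′ ≡ ts″ [ i ]≔ t)) →
    ∀ {v s ts} w {near far} → v ++ w ≡ whole → bitPrefix far ≡ [] → I v s ts →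
    Exec (sweep d i body s) (ts [ i ]≔ view d near (map bit w ++ far)) (sweepTime (length w) τ)
      (λ s′ ts′ → ∃[ ts″ ] I whole s′ ts″ × ts′ ≡ ts″ [ i ]≔ view d (map bit w ʳ++ near) far)
  sweep-exec {d = d} {i} {body} {τ} I whole body-exec {v} {s} {ts} [] {near} {far} v≡ end Iv =
    iter-exec {t = 2} {t′ = 0} {P = P} (bind-exec (read-exec ts) at-end)
      (λ { (() , _) })
      (λ { (refl , refl) → ts , subst (λ z → I z s ts) (trans (sym (++-identityʳ v)) v≡) Iv , refl })
    where
    t₀ : Tape Extra
    t₀ = view d near far
    P : _ → Tapes → Set
    P r ts′ = r ≡ inj₂ s × ts′ ≡ ts [ i ]≔ t₀
    at-end : ∀ {x ts′} → Returns (toBit (scanned t₀)) (ts [ i ]≔ t₀) x ts′ → Exec (sweepRead d i body s x) ts′ 1 P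
    at-end (x≡ , refl) with refl ← trans x≡ (scanned-end d near far end) = done-exec
  sweep-exec {d = d} {i} {body} {τ} I whole body-exec {v} {s} {ts} (b ∷ w) {near} {far} v≡ end Iv =
    exec-weaken (≤-reflexive (sym (+-assoc (3 + τ) (length w * (3 + τ)) 2)))
      (iter-exec {t = 3 + τ} {t′ = sweepTime (length w) τ} {P = P}
        (bind-exec (read-exec ts) at-bit)
        (λ { (s′ , ts″ , refl , Iv′ , refl) →
               sweep-exec I whole body-exec w (trans (++-assoc v (b ∷ []) w) v≡) end Iv′ })
        (λ { (_ , _ , () , _) }))
    where
    t₀ : Tape Extra
    t₀ = view d near (bit b ∷ map bit w ++ far)
    P : _ → Tapes → Set
    P r ts′ = ∃[ s′ ] ∃[ ts″ ] r ≡ inj₁ s′ × I (v ∷ʳ b) s′ ts″ ×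
                ts′ ≡ ts″ [ i ]≔ view d (bit b ∷ near) (map bit w ++ far)
    shift≡ : ∀ far → let t = view d near (bit b ∷ far) in
             writeMove (scanned t , towards d) t ≡ view d (bit b ∷ near) far
    shift≡ far = shift-view d near (bit b) far
    at-bit : ∀ {x ts′} → Returns (toBit (scanned t₀)) (ts [ i ]≔ t₀) x ts′ → Exec (sweepRead d i body s x) ts′ (2 + τ) P
    at-bit (x≡ , refl) with refl ← trans x≡ (scanned-bit d near b (map bit w ++ far)) =
      exec-weaken (≤-reflexive (+-comm τ 2))
        (bind-exec (body-exec b w t₀ v≡ Iv) λ { {s′} (ts″ , Iv′ , refl) →
          then-exec (op-exec ts″) (exec-post
            (λ { (refl , refl) → s′ , ts″ , refl , Iv′ , cong (ts″ [ i ]≔_) (shift≡ (map bit w ++ far)) })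
            done-exec) })

-- Writing words: loops over a tape and token transducers

bits-reverse : ∀ {Γ} w (ss : List (Symbol Γ)) → map bit w ʳ++ ss ≡ map bit (reverse w) ++ ss
bits-reverse w ss = trans (ʳ++-defn (map bit w)) (cong (_++ ss) (sym (map-ʳ++ {A = Bool} bit w)))

reverse-bits : ∀ {Γ} w (ss : List (Symbol Γ)) → map bit (reverse w) ʳ++ ss ≡ map bit w ++ ss
reverse-bits w ss = trans (bits-reverse (reverse w) ss) (cong (λ v → map bit v ++ ss) (reverse-involutive w))

-- Everything left of the word is garbage hidden behind a blank.
written : ∀ {Γ} → List (Symbol Γ) → List Bool → Tape Γ
written L w = tape (map bit w ʳ++ blank ∷ L) blank []

atStart : ∀ {Γ} → List (Symbol Γ) → List Bool → Tape Γ
atStart L w = view rightwards (blank ∷ L) (map bit w ++ blank ∷ [])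

-- Output of a fixed shape up to unary runs: `rep κ` stands for as many strokes as the counter tape
-- of `κ` holds.
data Piece (K : Set) : Set where
  tok : Token → Piece K
  rep : K → Piece K

expand : ∀ {K} → (K → ℕ) → List (Piece K) → List Token
expand ν []           = []
expand ν (tok t ∷ ps) = t ∷ expand ν ps
expand ν (rep κ ∷ ps) = replicate (ν κ) stroke ++ expand ν ps

-- The bits read so far of the current token, at most two: a token is complete, and handled, at its
-- third bit.
Buffer : Set
Buffer = Maybe (Bool × Maybe Bool)

outputs : ∀ {A : Set} → (A → Bool → A) → (A → Bool → List Bool) → A → List Bool → List Bool
outputs next out a []      = []
outputs next out a (b ∷ w) = out a b ++ outputs next out (next a b) w

outputs-∷ʳ : ∀ {A : Set} next out (a : A) v b →
  outputs next out a (v ∷ʳ b) ≡ outputs next out a v ++ out (foldl next a v) b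
outputs-∷ʳ next out a []      b = ++-identityʳ _
outputs-∷ʳ next out a (c ∷ v) b =
  trans (cong (out a c ++_) (outputs-∷ʳ next out (next a c) v b)) (sym (++-assoc (out a c) _ _))

length-outputs : ∀ {A : Set} {next : A → Bool → A} {out : A → Bool → List Bool} {τ} → (∀ a b → length (out a b) ≤ τ) →
  ∀ a w → length (outputs next out a w) ≤ length w * τ
length-outputs out≤ a []      = z≤n
length-outputs {next = next} {out} out≤ a (b ∷ w)
  rewrite length-++ (out a b) {outputs next out (next a b) w} = +-mono-≤ (out≤ a b) (length-outputs out≤ (next a b) w)

record Transducer (Q K : Set) : Set where
  field
    next   : Q → Token → Q
    output : Q → Token → List (Piece K)

  feed : Q × Buffer → Bool → Q × Buffer
  feed (q , nothing)           a = q , just (a , nothing)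
  feed (q , just (a , nothing)) b = q , just (a , just b)
  feed (q , just (a , just b)) c = next q (token a b c) , nothing

  written? : (K → ℕ) → Q × Buffer → Bool → List Token
  written? ν (q , just (a , just b)) c = expand ν (output q (token a b c))
  written? ν _                       _ = []

  transduction : (K → ℕ) → Q → List Bool → List Bool
  transduction ν q = outputs feed (λ s b → concatMap bits (written? ν s b)) (q , nothing)

module _ {Γ : Set} {k : ℕ} where

  -- The command `c` runs once per bit, which lets `load` walk back on a second tape in step with
  -- this one.
  rewindWith : Cmd Γ k ⊤ → Fin k → Cmd Γ k ⊤
  rewindWith c i = move leftwards i >>= λ _ → sweep leftwards i (λ _ _ → c) tt >>= λ _ → move rightwards i

  rewind : Fin k → Cmd Γ k ⊤
  rewind = rewindWith (done tt)

  forEach : ∀ {S} → {{IsFinite S}} → Fin k → (S → Bool → Cmd Γ k S) → S → Cmd Γ k S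
  forEach i body s = rewind i >>= λ _ → sweep rightwards i body s

  pushes : Fin k → List Bool → Cmd Γ k ⊤
  pushes i []      = done tt
  pushes i (b ∷ w) = push i b >>= λ _ → pushes i w

  copy : Fin k → Fin k → Cmd Γ k ⊤
  copy i j = forEach j (λ _ b → push i b) tt

  module _ {K : Set} (counter : K → Fin k) (i : Fin k) where

    emitPiece : Piece K → Cmd Γ k ⊤
    emitPiece (tok t) = pushes i (bits t)
    emitPiece (rep κ) = forEach (counter κ) (λ _ _ → pushes i (bits stroke)) tt

    emitPieces : List (Piece K) → Cmd Γ k ⊤
    emitPieces []       = done tt
    emitPieces (p ∷ ps) = emitPiece p >>= λ _ → emitPieces ps

    module _ {Q : Set} {{_ : IsFinite Q}} (T : Transducer Q K) where
      open Transducer T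

      transduceBit : Q × Buffer → Bool → Cmd Γ k (Q × Buffer)
      transduceBit (q , just (a , just b)) c =
        emitPieces (output q (token a b c)) >>= λ _ → done (feed (q , just (a , just b)) c)
      transduceBit s c = done (feed s c)

      transduce : Fin k → Q → Cmd Γ k (Q × Buffer)
      transduce j q = forEach j transduceBit (q , nothing)

rewindTime : ℕ → ℕ
rewindTime n = 2 + sweepTime n 1

forEachTime : ℕ → ℕ → ℕ
forEachTime n τ = rewindTime n + sweepTime n τ

sweepTime-monoˡ : ∀ {m n} τ → m ≤ n → sweepTime m τ ≤ sweepTime n τ
sweepTime-monoˡ τ m≤n = +-monoˡ-≤ 2 (*-monoˡ-≤ (3 + τ) m≤n)

forEachTime-monoˡ : ∀ {m n} τ → m ≤ n → forEachTime m τ ≤ forEachTime n τ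
forEachTime-monoˡ τ m≤n = +-mono-≤ (+-monoʳ-≤ 2 (sweepTime-monoˡ 1 m≤n)) (sweepTime-monoˡ τ m≤n)

n*τ≤forEachTime : ∀ n τ → n * τ ≤ forEachTime n τ
n*τ≤forEachTime n τ = ≤-trans (*-monoʳ-≤ n (m≤n+m τ 3)) (≤-trans (m≤m+n _ 2) (m≤n+m _ (rewindTime n)))

-- Three pushes and a closing step for a token; for a unary run, at most N rounds that write a
-- stroke in four steps each.
pieceTime : ℕ → ℕ
pieceTime N = 4 + forEachTime N 4

piecesTime : ℕ → ℕ → ℕ
piecesTime N ℓ = ℓ * pieceTime N + 1

transduceTime : ℕ → ℕ → ℕ
transduceTime N ℓ = forEachTime N (piecesTime N ℓ + 1)

-- Correctness and cost of writing

module Emission (M : OracleTM) (φ : PromiseProblem) where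
  open OracleTM M
  open Exec M φ public

  exec-from : ∀ {X} {c : Command X} {ts ts′ t Post} → ts ≡ ts′ → Exec c ts t Post → Exec c ts′ t Post
  exec-from refl h = h

  rewindWith-exec : ∀ {i c τ} (I : List Bool → Tapes → Set) w →
    (∀ {v ts} b t → I v ts → Exec c (ts [ i ]≔ t) τ (λ _ ts′ → ∃[ ts″ ] I (v ∷ʳ b) ts″ × ts′ ≡ ts″ [ i ]≔ t)) →
    ∀ {ts L} → I [] ts →
    Exec (rewindWith c i) (ts [ i ]≔ written L w) (2 + sweepTime (length w) τ)
      (λ _ ts′ → ∃[ ts″ ] I (reverse w) ts″ × ts′ ≡ ts″ [ i ]≔ atStart L w)
  rewindWith-exec {i} {c} {τ} I w c-exec {ts} {L} I₀ = exec-weaken (≤-reflexive time≡)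
    (then-exec (op-exec ts)
      (exec-from (cong (ts [ i ]≔_) (sym back))
        (bind-exec sweeping λ { (ts″ , Iw , refl) →
          exec-post (λ { (refl , refl) → ts″ , Iw , cong (ts″ [ i ]≔_) forth }) (op-exec ts″) })))
    where
    time≡ : suc (sweepTime (length (reverse w)) τ + 1) ≡ 2 + sweepTime (length w) τ
    time≡ rewrite length-reverse w = cong suc (+-comm (sweepTime (length w) τ) 1)
    back : shift left (written L w) ≡ view leftwards (blank ∷ []) (map bit (reverse w) ++ blank ∷ L)
    back = trans (shift-view leftwards [] blank (map bit w ʳ++ blank ∷ L))
                 (cong (view leftwards (blank ∷ [])) (bits-reverse w (blank ∷ L)))
    sweeping = sweep-exec {d = leftwards} {i} {λ _ _ → c} {τ} (λ v _ → I v) (reverse w)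
      (λ b _ t _ Iv → c-exec b t Iv) {v = []} {ts = ts} (reverse w) {blank ∷ []} {blank ∷ L} refl refl I₀
    forth : shift right (tape L blank (map bit (reverse w) ʳ++ blank ∷ [])) ≡ atStart L w
    forth = trans (shift-view rightwards L blank (map bit (reverse w) ʳ++ blank ∷ []))
                  (cong (view rightwards (blank ∷ L)) (reverse-bits w (blank ∷ [])))

  rewind-exec : ∀ {i} ts {L} w →
    Exec (rewind i) (ts [ i ]≔ written L w) (rewindTime (length w)) (Returns tt (ts [ i ]≔ atStart L w))
  rewind-exec ts w = exec-post (λ { (_ , refl , refl) → refl , refl })
    (rewindWith-exec (λ _ ts′ → ts′ ≡ ts) w
      (λ { _ _ refl → exec-post (λ { (refl , refl) → ts , refl , refl }) done-exec }) refl)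

  forEach-exec : ∀ {S} {{_ : IsFinite S}} {i} {body : S → Bool → Command S} {τ}
    (I : List Bool → S → Tapes → Set) w →
    (∀ {v s ts} b w′ t → v ++ b ∷ w′ ≡ w → I v s ts →
      Exec (body s b) (ts [ i ]≔ t) τ (λ s′ ts′ → ∃[ ts″ ] I (v ∷ʳ b) s′ ts″ × ts′ ≡ ts″ [ i ]≔ t)) →
    ∀ {s ts L} → I [] s ts →
    Exec (forEach i body s) (ts [ i ]≔ written L w) (forEachTime (length w) τ)
      (λ s′ ts′ → ∃[ ts″ ] I w s′ ts″ × ts′ ≡ ts″ [ i ]≔ written L w)
  forEach-exec I w body-exec {ts = ts} I₀ =
    then-exec (rewind-exec ts w) (sweep-exec I w body-exec w refl refl I₀)

  -- The size of a written word is bounded by the time spent on it, which in turn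
  -- bounds the time of later passes over the word.
  record Emits {X} (i : Fin tapes) (c : Command X) (ts : Tapes) (x : X) (out : List Bool) (t : ℕ) : Set where
    no-eta-equality
    field
      size : length out ≤ t
      runs : ∀ o → Exec c (ts [ i ]≔ tape o blank []) t (Returns x (ts [ i ]≔ tape (map bit out ʳ++ o) blank []))

  open Emits public

  emits-weaken : ∀ {X i} {c : Command X} {ts x out t t′} → t ≤ t′ → Emits i c ts x out t → Emits i c ts x out t′
  emits-weaken t≤t′ e .size   = ≤-trans (e .size) t≤t′
  emits-weaken t≤t′ e .runs o = exec-weaken t≤t′ (e .runs o)

  emits-out : ∀ {X i} {c : Command X} {ts x out out′ t} → out ≡ out′ → Emits i c ts x out t → Emits i c ts x out′ t
  emits-out refl e = e

  emits-done : ∀ {X i ts} {x : X} → Emits i (done x) ts x [] 1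
  emits-done .size   = z≤n
  emits-done .runs o = done-exec

  emits-push : ∀ {i ts} b → Emits i (push i b) ts tt (b ∷ []) 1
  emits-push b .size        = ≤-refl
  emits-push {ts = ts} b .runs o = op-exec ts

  infixr 1 _then_

  _then_ : ∀ {X Y i} {{_ : IsFinite X}} {c : Command X} {f : X → Command Y} {ts x y out out′ t t′} →
    Emits i c ts x out t → Emits i (f x) ts y out′ t′ → Emits i (c >>= f) ts y (out ++ out′) (t + t′)
  _then_ {out = out} {out′} e e′ .size rewrite length-++ out {out′} = +-mono-≤ (e .size) (e′ .size)
  _then_ {i = i} {ts = ts} {out = out} {out′} e e′ .runs o =
    then-exec (e .runs o) (exec-post (λ { (refl , refl) → refl , cong (λ l → ts [ i ]≔ tape l blank []) (lemma out) })
                                     (e′ .runs (map bit out ʳ++ o)))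
    where
    lemma : ∀ out → map bit out′ ʳ++ map bit out ʳ++ o ≡ map bit (out ++ out′) ʳ++ o
    lemma out = sym (trans (cong (_ʳ++ o) (map-++ bit out out′)) (++-ʳ++ (map bit out)))

  emits-pushes : ∀ {i ts} w → Emits i (pushes i w) ts tt w (length w + 1)
  emits-pushes []      = emits-done
  emits-pushes (b ∷ w) = emits-push b then emits-pushes w

  -- The loop moves the head of tape `j`, so the body must do its work for any contents of `j`. At
  -- the end `j` is again the tape it was, and only tape `i` has changed.
  emits-forEach : ∀ {S} {{_ : IsFinite S}} {i j} {body : S → Bool → Command S} {next out ts τ L} w →
    i ≢ j → lookup ts j ≡ written L w →
    (∀ s b t → Emits i (body s b) (ts [ j ]≔ t) (next s b) (out s b) τ) →
    ∀ s → Emits i (forEach j body s) ts (foldl next s w) (outputs next out s w) (forEachTime (length w) τ)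
  emits-forEach {i = i} {j} {next = next} {out} {ts} {τ} w i≢j look emits s .size =
    ≤-trans (length-outputs (λ a b → emits a b blank-tape .size) s w) (n*τ≤forEachTime (length w) τ)
    where
    blank-tape : Tape Extra
    blank-tape = tape [] blank []
  emits-forEach {S} {i = i} {j} {body} {next} {out} {ts} {τ} {L} w i≢j look emits s .runs o =
    exec-from (restore o)
      (exec-post (λ { (ts″ , (refl , refl) , refl) → refl , restore _ })
        (forEach-exec I w body-exec (refl , refl)))
    where
    target : List (Symbol Extra) → Tapes
    target l = ts [ i ]≔ tape l blank []
    restore : ∀ l → target l [ j ]≔ written L w ≡ target l
    restore l = trans
      (cong (target l [ j ]≔_) (sym (trans (lookup∘updateAt′ j i (i≢j ∘ sym) ts) look)))
      ([]≔-lookup (target l) j)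
    I : List Bool → S → Tapes → Set
    I v s′ ts′ = s′ ≡ foldl next s v × ts′ ≡ target (map bit (outputs next out s v) ʳ++ o)
    swap : ∀ l t → target l [ j ]≔ t ≡ (ts [ j ]≔ t) [ i ]≔ tape l blank []
    swap l t = []≔-commutes ts i j i≢j
    body-exec : ∀ {v s′ ts′} b w′ t → v ++ b ∷ w′ ≡ w → I v s′ ts′ →
      Exec (body s′ b) (ts′ [ j ]≔ t) τ (λ s″ ts″ → ∃[ ts‴ ] I (v ∷ʳ b) s″ ts‴ × ts″ ≡ ts‴ [ j ]≔ t)
    body-exec {v} b w′ t _ (refl , refl) =
      exec-from (sym (swap _ t))
        (exec-post (λ { (refl , refl) → _ , (sym (foldl-∷ʳ next s b v) , refl) ,
                        trans (sym (swap _ t)) (cong (λ l → target l [ j ]≔ t) grow) })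
          (emits (foldl next s v) b t .runs _))
      where
      o′ = outputs next out s v
      b′ = out (foldl next s v) b
      grow : map bit b′ ʳ++ map bit o′ ʳ++ o ≡ map bit (outputs next out s (v ∷ʳ b)) ʳ++ o
      grow rewrite outputs-∷ʳ next out s v b | map-++ {A = Bool} {B = Symbol Extra} bit o′ b′ =
        sym (++-ʳ++ (map bit o′))

  emits-copy : ∀ {i j ts L} w → i ≢ j → lookup ts j ≡ written L w →
               Emits i (copy i j) ts tt w (forEachTime (length w) 1)
  emits-copy {i} {j} {ts} w i≢j look = emits-out (outputs-id w)
    (emits-forEach {next = λ _ _ → tt} {out = λ _ b → b ∷ []} w i≢j look (λ _ b _ → emits-push b) tt)
    where
    outputs-id : ∀ w → outputs (λ _ _ → tt) (λ _ b → b ∷ []) tt w ≡ w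
    outputs-id []      = refl
    outputs-id (b ∷ w) = cong (b ∷_) (outputs-id w)

  module _ {K : Set} (counter : K → Fin tapes) (ν : K → ℕ) (N : ℕ) (i : Fin tapes) where

    record Counters (ts : Tapes) : Set where
      field
        apart   : ∀ κ → i ≢ counter κ
        garbage : K → List (Symbol Extra)
        holds   : ∀ κ → lookup ts (counter κ) ≡ written (garbage κ) (replicate (ν κ) true)
        bounded : ∀ κ → ν κ ≤ N

    open Counters

    emits-piece : ∀ {ts} → Counters ts → ∀ p →
      Emits i (emitPiece counter i p) ts tt (concatMap bits (expand ν (p ∷ []))) (pieceTime N)
    emits-piece {ts} C (tok t) = emits-weaken (three t)
      (emits-out (sym (++-identityʳ (bits t))) (emits-pushes (bits t)))
      where
      three : ∀ t → length (bits t) + 1 ≤ pieceTime N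
      three stroke = m≤m+n 4 _
      three comma  = m≤m+n 4 _
      three #      = m≤m+n 4 _
      three ⊥ₜ     = m≤m+n 4 _
      three ⊤ₜ     = m≤m+n 4 _
      three ¬ₜ     = m≤m+n 4 _
      three ∧ₜ     = m≤m+n 4 _
      three ∨ₜ     = m≤m+n 4 _
    emits-piece {ts} C (rep κ) = emits-weaken
      (≤-trans (≤-reflexive (cong (λ n → forEachTime n 4) (length-replicate (ν κ))))
               (≤-trans (forEachTime-monoˡ 4 (C .bounded κ)) (m≤n+m _ 4)))
      (emits-out (strokes (ν κ))
        (emits-forEach {next = λ _ _ → tt} {out = λ _ _ → bits stroke} (replicate (ν κ) true)
          (C .apart κ) (C .holds κ) (λ _ _ _ → emits-pushes (bits stroke)) tt))
      where
      strokes : ∀ n → outputs (λ _ _ → tt) (λ _ _ → bits stroke) tt (replicate n true)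
                        ≡ concatMap bits (replicate n stroke ++ [])
      strokes zero    = refl
      strokes (suc n) = cong (bits stroke ++_) (strokes n)

    emits-pieces : ∀ {ts} → Counters ts → ∀ ps →
      Emits i (emitPieces counter i ps) ts tt (concatMap bits (expand ν ps)) (piecesTime N (length ps))
    emits-pieces C []       = emits-done
    emits-pieces C (p ∷ ps) = emits-out (split p)
      (emits-weaken (≤-reflexive (sym (+-assoc (pieceTime N) (length ps * pieceTime N) 1)))
        (emits-piece C p then emits-pieces C ps))
      where
      split : ∀ p → concatMap bits (expand ν (p ∷ [])) ++ concatMap bits (expand ν ps) ≡ concatMap bits (expand ν (p ∷ ps))
      split (tok t) = cong (_++ concatMap bits (expand ν ps)) (++-identityʳ (bits t))
      split (rep κ) = trans (sym (concatMap-++ bits (replicate (ν κ) stroke ++ []) (expand ν ps)))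
        (cong (λ ts → concatMap bits (ts ++ expand ν ps)) (++-identityʳ (replicate (ν κ) stroke)))

    module _ {Q : Set} {{_ : IsFinite Q}} (T : Transducer Q K) where
      open Transducer T

      emits-transduce : ∀ {ts j ℓ L} w → (∀ q t → length (output q t) ≤ ℓ) →
        i ≢ j → lookup ts j ≡ written L w → (∀ t → Counters (ts [ j ]≔ t)) → ∀ q →
        Emits i (transduce counter i T j q) ts (foldl feed (q , nothing) w) (transduction ν q w)
          (forEachTime (length w) (piecesTime N ℓ + 1))
      emits-transduce {ts} {j} {ℓ} w output≤ i≢j look C q =
        emits-forEach w i≢j look body (q , nothing)
        where
        body : ∀ s b t → Emits i (transduceBit counter i T s b) (ts [ j ]≔ t) (feed s b)
          (concatMap bits (written? ν s b)) (piecesTime N ℓ + 1)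
        body (q , nothing)            b t = emits-weaken (m≤n+m 1 _) emits-done
        body (q , just (a , nothing)) b t = emits-weaken (m≤n+m 1 _) emits-done
        body (q , just (a , just b))  c t =
          emits-weaken (+-monoˡ-≤ 1 (+-monoˡ-≤ 1 (*-monoˡ-≤ (pieceTime N) (output≤ q (token a b c)))))
          (emits-out (++-identityʳ _) (emits-pieces (C t) (output q (token a b c)) then emits-done))

-- Tapes that differ in trailing blanks

infix 4 _≲_

data _≲_ {Γ : Set} : Tape Γ → Tape Γ → Set where
  padded : ∀ {l s r r′} n → r′ ≡ r ++ replicate n blank → tape l s r ≲ tape l s r′

module _ {Γ : Set} where

  ≲-refl : {t : Tape Γ} → t ≲ t
  ≲-refl = padded 0 (sym (++-identityʳ _))

  ≲-trans : {t t′ t″ : Tape Γ} → t ≲ t′ → t′ ≲ t″ → t ≲ t″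
  ≲-trans {tape l s r} (padded m refl) (padded n refl) =
    padded (m + n) (trans (++-assoc r (replicate m blank) (replicate n blank)) (cong (r ++_) (sym (++-replicate m n))))
    where
    ++-replicate : ∀ m n → replicate (m + n) blank ≡ replicate m blank ++ replicate n blank
    ++-replicate zero    n = refl
    ++-replicate (suc m) n = cong (blank ∷_) (++-replicate m n)

  ≲-scanned : {t t′ : Tape Γ} → t ≲ t′ → scanned t ≡ scanned t′
  ≲-scanned (padded _ _) = refl

  ≲-queryWord : {t t′ : Tape Γ} → t ≲ t′ → queryWord t ≡ queryWord t′
  ≲-queryWord (padded {s = s} {r} n refl) = prefix (s ∷ r)
    where
    blanks : ∀ n → [] ≡ bitPrefix {Γ} (replicate n blank)
    blanks zero    = refl
    blanks (suc _) = refl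
    prefix : ∀ ss → bitPrefix ss ≡ bitPrefix (ss ++ replicate n blank)
    prefix []             = blanks n
    prefix (blank ∷ _)    = refl
    prefix (bit b ∷ ss)   = cong (b ∷_) (prefix ss)
    prefix (extra _ ∷ _)  = refl

  ≲-shift : ∀ d {t t′ : Tape Γ} → t ≲ t′ → shift d t ≲ shift d t′
  ≲-shift stay  t≲t′ = t≲t′
  ≲-shift left  (padded {l = []}    n refl) = padded n refl
  ≲-shift left  (padded {l = _ ∷ _} n refl) = padded n refl
  ≲-shift right (padded {r = []}    zero    refl) = padded 0 refl
  ≲-shift right (padded {r = []}    (suc n) refl) = padded n refl
  ≲-shift right (padded {r = _ ∷ _} n refl) = padded n refl

  ≲-writeMove : ∀ a {t t′ : Tape Γ} → t ≲ t′ → writeMove a t ≲ writeMove a t′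
  ≲-writeMove (s , d) (padded n refl) = ≲-shift d (padded n refl)

  lefts : ℕ → Tape Γ → Tape Γ
  lefts zero    t = t
  lefts (suc n) t = shift left (lefts n t)

  -- Walking right over a word and back may turn implicit blanks beyond the end into listed ones.
  -- Nothing else changes, and `_≲_` allows for that.
  ≲-lefts : ∀ near xs far → view rightwards near (xs ++ far) ≲ lefts (length xs) (view rightwards (xs ʳ++ near) far)
  ≲-lefts near []       far = ≲-refl
  ≲-lefts near (x ∷ xs) far = ≲-trans (back (xs ++ far)) (≲-shift left (≲-lefts (x ∷ near) xs far))
    where
    back : ∀ ys → view rightwards near (x ∷ ys) ≲ shift left (view rightwards (x ∷ near) ys)
    back []      = padded 1 refl
    back (_ ∷ _) = ≲-refl

  -- Bounds the length of the word asked from this tape. It grows by at most one per step, whence a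
  -- bound on all queries of a run.
  cells : Tape Γ → ℕ
  cells t = suc (length (rightward t))

  cells-writeMove : ∀ a (t : Tape Γ) → cells (writeMove a t) ≤ suc (cells t)
  cells-writeMove (s , stay)  t                   = n≤1+n _
  cells-writeMove (s , left)  (tape [] _ _)       = ≤-refl
  cells-writeMove (s , left)  (tape (_ ∷ _) _ _)  = ≤-refl
  cells-writeMove (s , right) (tape _ _ [])       = n≤1+n _
  cells-writeMove (s , right) (tape _ _ (_ ∷ _))  = ≤-trans (n≤1+n _) (n≤1+n _)

  length-bitPrefix : ∀ (ss : List (Symbol Γ)) → length (bitPrefix ss) ≤ length ss
  length-bitPrefix []            = z≤n
  length-bitPrefix (blank ∷ _)   = z≤n
  length-bitPrefix (bit _ ∷ ss)  = s≤s (length-bitPrefix ss)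
  length-bitPrefix (extra _ ∷ _) = z≤n

  bitPrefix-split : ∀ (ss : List (Symbol Γ)) → ∃[ far ] ss ≡ map bit (bitPrefix ss) ++ far × bitPrefix far ≡ []
  bitPrefix-split []            = _ , refl , refl
  bitPrefix-split (blank ∷ _)   = _ , refl , refl
  bitPrefix-split (bit b ∷ ss)  with far , eq , end ← bitPrefix-split ss = far , cong (bit b ∷_) eq , end
  bitPrefix-split (extra _ ∷ _) = _ , refl , refl

-- Machines with room for a subroutine

record Host : Set₁ where
  field
    State        : Set
    State-finite : Finite State
    Extra        : Set
    Extra-finite : Finite Extra
    others       : ℕ
    inputTape    : Fin others
    start        : State
    program      : State → Instruction State Extra (7 + others)

hosted : Host → OracleTM
hosted H = record
  { State = State; State-finite = State-finite; Extra = Extra; Extra-finite = Extra-finite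
  ; tapes = 7 + others; inputTape = 7 ↑ʳ inputTape; queryTape = zero; start = start; program = program }
  where open Host H

-- The word asked to the oracle, the input w, N = |w| in unary, the counter of the
-- main loop, the index j in unary, the formula x = c, and the formula y < z.
pattern O = zero
pattern W = suc zero
pattern C = suc (suc zero)
pattern D = suc (suc (suc zero))
pattern J = suc (suc (suc (suc zero)))
pattern E = suc (suc (suc (suc (suc zero))))
pattern Λ = suc (suc (suc (suc (suc (suc zero)))))

module _ {Γ : Set} {k : ℕ} where

  work : Vec (List (Symbol Γ)) 7 → Vec (Tape Γ) k → Vec (Tape Γ) (7 + k)
  work ls ts = Vec.map (λ l → tape l blank []) ls Vec.++ ts

  -- Reading the query word moves the head of tape `q`, which the simulated machine must find where
  -- it was. Rewinding `W` therefore steps `q` back once per bit; the last sweep only returns `W` to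
  -- its end.
  load : Fin k → Cmd Γ (7 + k) ⊤
  load q =
    move rightwards W >>= λ _ → sweep rightwards (7 ↑ʳ q) (λ _ b → push W b) tt >>= λ _ →
    rewindWith (move leftwards (7 ↑ʳ q)) W >>= λ _ → sweep rightwards W (λ _ _ → done tt) tt

module Loading (H : Host) (φ : PromiseProblem) where
  open Host H
  open Emission (hosted H) φ

  loadTime : ℕ → ℕ
  loadTime n = 1 + (sweepTime n 1 + ((2 + sweepTime n 1) + sweepTime n 1))

  module _ {q : Fin others} {o l c d j e λ′ : List (Symbol Extra)} {ts : Vec (Tape Extra) others} where
    private
      w = queryWord (lookup ts q)
      near = leftward (lookup ts q)

      on : Tape Extra → Vec (Tape Extra) others → Tapes
      on t ts = tape o blank [] ∷ t ∷ tape c blank [] ∷ tape d blank [] ∷ tape j blank [] ∷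
                tape e blank [] ∷ tape λ′ blank [] ∷ ts

    module _ {far} (split : scanned (lookup ts q) ∷ rightward (lookup ts q) ≡ map bit w ++ far)
             (end : bitPrefix far ≡ []) where
      private
        passed : Tape Extra
        passed = view rightwards (map bit w ʳ++ near) far

        at-word : ts ≡ ts [ q ]≔ view rightwards near (map bit w ++ far)
        at-word = sym (trans (cong (λ ss → ts [ q ]≔ view rightwards near ss) (sym split)) ([]≔-lookup ts q))

        copying : Exec (sweep rightwards (7 ↑ʳ q) (λ _ b → push W b) tt)
          (on (tape (blank ∷ l) blank []) (ts [ q ]≔ view rightwards near (map bit w ++ far)))
          (sweepTime (length w) 1) (Returns tt (on (written l w) (ts [ q ]≔ passed)))
        copying = exec-post (λ { (_ , refl , refl) → refl , refl })
          (sweep-exec {d = rightwards} {7 ↑ʳ q} {λ _ b → push W b} {1}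
            (λ v _ ts′ → ts′ ≡ on (written l v) ts) w
            (λ { {v} b _ t _ refl → exec-post (λ { (refl , refl) → _ , refl , cong (λ l → on (tape l blank []) _) (snoc v b) })
                                      (op-exec (on (written l v) (ts [ q ]≔ t))) })
            {v = []} w {near} {far} refl end refl)
          where
          snoc : ∀ v b → bit b ∷ (map bit v ʳ++ blank ∷ l) ≡ map bit (v ∷ʳ b) ʳ++ blank ∷ l
          snoc v b = sym (trans (cong (_ʳ++ blank ∷ l) (map-++ bit v (b ∷ []))) (++-ʳ++ (map bit v)))

        returning : Exec (rewindWith (move leftwards (7 ↑ʳ q)) W) (on (written l w) (ts [ q ]≔ passed))
          (2 + sweepTime (length w) 1)
          (Returns tt (on (atStart l w) (ts [ q ]≔ lefts (length w) passed)))
        returning = exec-post (λ { (_ , refl , refl) → refl , cong (λ n → on (atStart l w) (ts [ q ]≔ lefts n passed)) (length-reverse w) })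
          (rewindWith-exec (λ v ts′ → ts′ ≡ on (written l w) (ts [ q ]≔ lefts (length v) passed)) w
            (λ { {v} b t refl → exec-post (λ { (refl , refl) → _ , refl ,
                     cong (λ n → on t (ts [ q ]≔ lefts n passed)) (sym (trans (length-++ v) (+-comm (length v) 1))) })
                   (op-exec (on t ts)) })
            refl)

        forwarding : ∀ {ts} → Exec (sweep rightwards W (λ _ _ → done tt) tt) (on (atStart l w) ts)
          (sweepTime (length w) 1) (Returns tt (on (written l w) ts))
        forwarding {ts} = exec-post (λ { (_ , refl , refl) → refl , refl })
          (sweep-exec {d = rightwards} {W} (λ _ _ ts′ → ts′ ≡ on (written l w) ts) w
            (λ { _ _ _ _ refl → exec-post (λ { (refl , refl) → _ , refl , refl }) done-exec })
            {v = []} w {blank ∷ l} {blank ∷ []} refl refl refl)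

        restored : lookup ts q ≲ lefts (length w) passed
        restored = subst (_≲ lefts (length w) passed) (cong (view rightwards near) {y = scanned (lookup ts q) ∷ rightward (lookup ts q)} (sym split))
          (subst (λ n → view rightwards near (map bit w ++ far) ≲ lefts n passed) (length-map bit w)
            (≲-lefts near (map bit w) far))

      load-split : Exec (load q) (on (tape l blank []) ts) (loadTime (length w))
        (λ _ ts′ → ∃[ ts″ ] Pointwise _≲_ ts ts″ × ts′ ≡ on (written l w) ts″)
      load-split =
        then-exec (op-exec (on (tape l blank []) ts))
        (then-exec (exec-from (cong (on _) (sym at-word)) copying)
        (then-exec returning
        (exec-post (λ { (refl , refl) → _ , pointwise q restored , refl }) forwarding)))
        where
        pointwise : ∀ {k} {ts : Vec (Tape Extra) k} q {t} → lookup ts q ≲ t → Pointwise _≲_ ts (ts [ q ]≔ t)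
        pointwise {ts = _ ∷ _} zero    t≲ = t≲ ∷ Pointwise.refl ≲-refl
        pointwise {ts = _ ∷ _} (suc q) t≲ = ≲-refl ∷ pointwise q t≲

    load-exec : Exec (load q) (work (o ∷ l ∷ c ∷ d ∷ j ∷ e ∷ λ′ ∷ []) ts) (loadTime (length w))
      (λ _ ts′ → ∃[ ts″ ] Pointwise _≲_ ts ts″ ×
         ts′ ≡ work (o ∷ (map bit w ʳ++ blank ∷ l) ∷ c ∷ d ∷ j ∷ e ∷ λ′ ∷ []) ts″)
    load-exec with far , split , end ← bitPrefix-split (scanned (lookup ts q) ∷ rightward (lookup ts q)) =
      load-split split end

module _ (φ₂ φ₃ : PromiseProblem) (H : Host) where
  open Host H
  open Emission (hosted H) φ₃

  -- Work tapes are never wiped. A call starts behind the garbage of earlier ones and only has to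
  -- leave every head on a blank with nothing listed to its right, which is what `work ls` states.
  -- The tapes `ts` of the simulated machine come back untouched.
  Answers : Cmd Extra (7 + others) Bool → (ℕ → ℕ) → Set
  Answers command time = ∀ w {o l c d j e λ′ ts} →
    Exec command (work (o ∷ (map bit w ʳ++ blank ∷ l) ∷ c ∷ d ∷ j ∷ e ∷ λ′ ∷ []) ts) (time (length w))
      (λ y ts′ → y ∈₊ answers φ₂ w × ∃[ ls ] ts′ ≡ work ls ts)

record Subroutine (φ₂ φ₃ : PromiseProblem) : Set₁ where
  field
    command : ∀ {Γ k} → Cmd Γ (7 + k) Bool
    time    : Polynomial
    correct : ∀ H → Answers φ₂ φ₃ H command (eval time)

-- Replacing oracle calls by a subroutine

module Simulation {φ₂ φ₃ : PromiseProblem} (S : Subroutine φ₂ φ₃) (M : OracleTM) where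
  open Subroutine S
  open OracleTM M

  call : Cmd Extra (7 + tapes) Bool
  call = load queryTape >>= λ _ → command

  -- The asking state is remembered throughout the call. Call locations are paired with all states,
  -- also with those that do not ask; for these, staying put is a junk value.
  reply : Instruction State Extra tapes → State → Bool → State
  reply (ask next) _ b = next b
  reply _          q _ = q

  State₃ : Set
  State₃ = State ⊎ (State × Loc call)

  simulating : State → Instruction State Extra tapes → Instruction State₃ Extra (7 + tapes)
  simulating q (halt y)   = halt y
  simulating q (ask next) = step λ ss → inj₂ (q , entry call) , stays ss
  simulating q (step δ)   = step λ { (o ∷ w ∷ c ∷ d ∷ j ∷ e ∷ l ∷ ss) →
    let (q′ , acts) = δ ss in inj₁ q′ , stays (o ∷ w ∷ c ∷ d ∷ j ∷ e ∷ l ∷ []) Vec.++ acts }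

  host : Host
  host = record
    { State = State₃
    ; State-finite = isFinite (⊎-finite {{finite State-finite}} {{×-finite {{finite State-finite}} {{Loc-finite call}}}})
    ; Extra = Extra; Extra-finite = Extra-finite; others = tapes; inputTape = inputTape; start = inj₁ start
    ; program = λ { (inj₁ q)       → simulating q (program q)
                  ; (inj₂ (q , l)) → code call (λ l → inj₂ (q , l)) (λ b → inj₁ (reply (program q) q b)) l }
    }

  open Emission (hosted host) φ₃
  open Loading host φ₃
  open Computation using (halted; running; step; ask)
  open Computation M φ₂ using () renaming (AllPaths to AllPaths₂; _⟶_ to _⟶₂_)
  open Computation (hosted host) φ₃ using () renaming (AllPaths to AllPaths₃)

  callTime : ℕ → ℕ
  callTime n = loadTime n + eval time n

  callTime-mono : ∀ {m n} → m ≤ n → callTime m ≤ callTime n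
  callTime-mono m≤n =
    +-mono-≤ (+-monoʳ-≤ 1 (+-mono-≤ (sweepTime-monoˡ 1 m≤n) (+-mono-≤ (+-monoʳ-≤ 2 (sweepTime-monoˡ 1 m≤n)) (sweepTime-monoˡ 1 m≤n))))
             (eval-mono time m≤n)

  call-exec : ∀ ls ts {ts′} → Pointwise _≲_ ts ts′ → let w = queryWord (lookup ts queryTape) in
    Exec call (work ls ts′) (callTime (length w))
      (λ y ts″ → y ∈₊ answers φ₂ w × ∃[ ls′ ] ∃[ ts‴ ] Pointwise _≲_ ts ts‴ × ts″ ≡ work ls′ ts‴)
  call-exec (o ∷ l ∷ c ∷ d ∷ j ∷ e ∷ λ′ ∷ []) ts {ts′} ts≲
    rewrite ≲-queryWord (Pointwise.lookup ts≲ queryTape) =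
    bind-exec (load-exec {queryTape} {o} {l} {c} {d} {j} {e} {λ′} {ts′}) λ { (ts″ , ts′≲ , refl) →
      exec-post (λ { (y∈ , ls , refl) → y∈ , ls , ts″ , Pointwise.trans ≲-trans ts≲ ts′≲ , refl })
        (correct host (queryWord (lookup ts′ queryTape))) }

  Pointwise-step : ∀ {k} (acts : Vec (Symbol Extra × Move) k) {ts ts′ : Vec (Tape Extra) k} →
    Pointwise _≲_ ts ts′ → Pointwise _≲_ (zipWith writeMove acts ts) (zipWith writeMove acts ts′)
  Pointwise-step []       []            = []
  Pointwise-step (a ∷ as) (t≲ ∷ ts≲) = ≲-writeMove a t≲ ∷ Pointwise-step as ts≲

  Pointwise-scanned : ∀ {k} {ts ts′ : Vec (Tape Extra) k} → Pointwise _≲_ ts ts′ → Vec.map scanned ts ≡ Vec.map scanned ts′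
  Pointwise-scanned []         = refl
  Pointwise-scanned (t≲ ∷ ts≲) = cong₂ _∷_ (≲-scanned t≲) (Pointwise-scanned ts≲)

  querySize : Vec (Tape Extra) tapes → ℕ
  querySize ts = cells (lookup ts queryTape)

  querySize-step : ∀ acts ts → querySize (zipWith writeMove acts ts) ≤ suc (querySize ts)
  querySize-step acts ts rewrite lookup-zipWith writeMove queryTape acts ts =
    cells-writeMove (lookup acts queryTape) (lookup ts queryTape)

  -- `B` caps the size of all queries of the run: the current size plus the number of remaining
  -- steps never increases, because a step adds at most one cell. Hence every simulated step fits
  -- into `1 + callTime B`.
  simulation : ∀ {Y B} t {q ts ts′} ls → querySize ts + t ≤ B → Pointwise _≲_ ts ts′ →
    AllPaths₂ Y t (q , ts) → AllPaths₃ Y (t * (1 + callTime B)) (inj₁ q , work ls ts′)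
  simulate-running : ∀ {Y B} t {q ts ts′} ls → querySize ts + suc t ≤ B → Pointwise _≲_ ts ts′ →
    ∃ ((q , ts) ⟶₂_) → (∀ {c′} → (q , ts) ⟶₂ c′ → AllPaths₂ Y t c′) →
    ∀ i → program q ≡ i → AllPaths₃ Y (suc t * (1 + callTime B)) (inj₁ q , work ls ts′)
  simulation t ls size≤ ts≲ (halted {q = q} {y = y} eq y∈) = halted (cong (simulating q) eq) y∈
  simulation (suc t) {q} ls size≤ ts≲ (running some next) = simulate-running t ls size≤ ts≲ some next (program q) refl
  simulate-running t ls size≤ ts≲ (_ , step eq′ ) next (halt y) eq with () ← trans (sym eq) eq′
  simulate-running t ls size≤ ts≲ (_ , ask eq′ _) next (halt y) eq with () ← trans (sym eq) eq′
  simulate-running {Y} {B} t {q} {ts} {ts′} ls size≤ ts≲ _ next (ask f) eq =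
    goto-paths (cong (simulating q) eq)
      (weakened (call-exec ls ts ts≲) .paths {loc = λ l → inj₂ (q , l)} (λ _ → refl)
        λ { {y} (y∈ , ls′ , ts‴ , ts≲ , refl) →
            subst (λ i → AllPaths₃ Y (t * (1 + callTime B)) (inj₁ (reply i q y) , work ls′ ts‴)) (sym eq)
              -- Any reply of the subroutine is one that the original oracle may give, so the run
              -- goes on as a path of `M`.
              (simulation t ls′ (≤-trans (+-monoʳ-≤ (querySize ts) (n≤1+n t)) size≤) ts≲ (next (ask eq y∈))) })
    where
    w≤B : length (queryWord (lookup ts queryTape)) ≤ B
    w≤B = ≤-trans (length-bitPrefix (scanned (lookup ts queryTape) ∷ rightward (lookup ts queryTape))) (≤-trans (m≤m+n _ (suc t)) size≤)
    weakened : ∀ {c : Command Bool} {ts₀ P} → Exec c ts₀ (callTime (length (queryWord (lookup ts queryTape)))) P →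
               Exec c ts₀ (callTime B) P
    weakened = exec-weaken (callTime-mono w≤B)
  simulate-running {Y} {B} t {q} {ts} {ts′} ls@(_ ∷ _ ∷ _ ∷ _ ∷ _ ∷ _ ∷ _ ∷ []) size≤ ts≲ _ next (step δ) eq =
    step-paths (cong (simulating q) eq) (cong (inj₁ ∘ proj₁ ∘ δ) same)
      (cong (λ ss → work ls (zipWith writeMove (proj₂ (δ ss)) ts′)) (sym same))
      (AllPaths-mono (m≤n+m (t * (1 + callTime B)) (callTime B))
        (simulation t ls (≤-trans (+-monoˡ-≤ t (querySize-step acts ts)) (≤-trans (≤-reflexive (sym (+-suc (querySize ts) t))) size≤))
          (Pointwise-step acts ts≲) (next (step eq))))
    where
    same : Vec.map scanned ts ≡ Vec.map scanned ts′
    same = Pointwise-scanned ts≲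
    acts = proj₂ (δ (Vec.map scanned ts))

  -- The query tape may be the input tape, so it starts with up to `1 + n` cells; each of the at
  -- most `eval p n` steps adds at most one.
  bound : Polynomial → ℕ → ℕ
  bound p n = eval p n * (1 + callTime (1 + n + eval p n))

  bound-poly : ∀ p → PolyBounded (bound p)
  bound-poly p = evalᴾ p *ᴾ (constᴾ 1 +ᴾ callᴾ ∘ᴾ (constᴾ 1 +ᴾ idᴾ +ᴾ evalᴾ p))
    where
    sweepᴾ : PolyBounded (λ n → sweepTime n 1)
    sweepᴾ = idᴾ *ᴾ constᴾ 4 +ᴾ constᴾ 2
    callᴾ : PolyBounded callTime
    callᴾ = constᴾ 1 +ᴾ (sweepᴾ +ᴾ (constᴾ 2 +ᴾ sweepᴾ +ᴾ sweepᴾ)) +ᴾ evalᴾ time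

  querySize-initial : ∀ x → querySize (proj₂ (initial x)) ≤ 1 + List⁺.length x
  querySize-initial x@(_ ∷ bs) = go inputTape queryTape
    where
    inscribed : cells (inscribe {Extra} x) ≤ 1 + List⁺.length x
    inscribed = s≤s (≤-trans (≤-reflexive (length-map bit bs)) (n≤1+n _))
    blanks : ∀ {k} (j : Fin k) → cells (lookup (Vec.replicate k (empty {Extra})) j) ≤ 1 + List⁺.length x
    blanks j rewrite lookup-replicate j (empty {Extra}) = s≤s z≤n
    go : ∀ {k} (i j : Fin k) → cells (lookup (Vec.replicate k (empty {Extra}) [ i ]≔ inscribe x) j) ≤ 1 + List⁺.length x
    go zero    zero    = inscribed
    go zero    (suc j) = blanks j
    go (suc i) zero    = s≤s z≤n
    go (suc i) (suc j) = go i j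

simulate : ∀ {φ₁ φ₂ φ₃} → Subroutine φ₂ φ₃ → φ₁ ∝ᵀ φ₂ → φ₁ ∝ᵀ φ₃
simulate {φ₁} {φ₂} {φ₃} S (M , p , reduces) = hosted host , proj₁ (bound-poly p) , λ x →
  AllPaths-mono (proj₂ (bound-poly p) (List⁺.length x))
    (simulation (eval p (List⁺.length x)) (Vec.replicate 7 []) (+-monoˡ-≤ _ (querySize-initial x))
      (Pointwise.refl ≲-refl) (reduces x))
  where
  open Simulation S M
  open Emission (hosted host) φ₃ using (AllPaths-mono)

-- Every decodable word is an encoding

bits-token : ∀ a b c → bits (token a b c) ≡ a ∷ b ∷ c ∷ []
bits-token false false false = refl
bits-token false false true  = refl
bits-token false true  false = refl
bits-token false true  true  = refl
bits-token true  false false = refl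
bits-token true  false true  = refl
bits-token true  true  false = refl
bits-token true  true  true  = refl

tokens-inverse : ∀ w {ts} → tokens w ≡ just ts → w ≡ concatMap bits ts
tokens-inverse [] refl = refl
tokens-inverse (a ∷ b ∷ c ∷ w) eq with tokens w in eq′
tokens-inverse (a ∷ b ∷ c ∷ w) refl | just ts =
  trans (cong (λ w → a ∷ b ∷ c ∷ w) (tokens-inverse w eq′)) (cong (_++ concatMap bits ts) (sym (bits-token a b c)))

strokes-suc : ∀ k (ts : List Token) → replicate k stroke ++ stroke ∷ ts ≡ replicate (suc k) stroke ++ ts
strokes-suc zero    ts = refl
strokes-suc (suc k) ts = cong (stroke ∷_) (strokes-suc k ts)

parseBlocks-inverse  : ∀ n ts {ms us} → parseBlocks n 0 ts ≡ just (ms , us) → ts ≡ blockTokens ms ++ us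
parseBlocks-inverse′ : ∀ n k ts {ms us} → parseBlocks (suc n) k ts ≡ just (ms , us) →
                       replicate k stroke ++ ts ≡ blockTokens ms ++ us
parseBlocks-inverse zero    ts refl = refl
parseBlocks-inverse (suc n) ts eq   = parseBlocks-inverse′ n 0 ts eq
parseBlocks-inverse′ n k (stroke ∷ ts) eq = trans (strokes-suc k ts) (parseBlocks-inverse′ n (suc k) ts eq)
parseBlocks-inverse′ n (suc k) (comma ∷ ts) eq with parseBlocks n 0 ts in eq′
parseBlocks-inverse′ n (suc k) (comma ∷ ts) refl | just (ms , us)
  rewrite ++-assoc (replicate k stroke) (comma ∷ blockTokens ms) us =
    cong (λ ts → replicate (suc k) stroke ++ comma ∷ ts) (parseBlocks-inverse n ts eq′)

module _ {n : ℕ} (ms : Vec ℕ n) where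

  stackTokens : List (Formula ms) → List Token
  stackTokens []       = []
  stackTokens (F ∷ Fs) = stackTokens Fs ++ formulaTokens F

  partialTokens : Partial ms → List Token
  partialTokens (block k)      = replicate k stroke
  partialTokens (position i k) = replicate (toℕ i) stroke ++ comma ∷ replicate k stroke

  private
    regroup : ∀ Fs (F : Formula ms) ts → stackTokens Fs ++ formulaTokens F ++ ts ≡ stackTokens (F ∷ Fs) ++ ts
    regroup Fs F ts = sym (++-assoc (stackTokens Fs) (formulaTokens F) ts)

    regroup₁ : ∀ (xs ys : List Token) t ts → (xs ++ ys) ++ t ∷ ts ≡ (xs ++ ys ++ t ∷ []) ++ ts
    regroup₁ xs ys t ts = trans (++-assoc xs ys (t ∷ ts))
      (trans (cong (xs ++_) (sym (++-assoc ys (t ∷ []) ts))) (sym (++-assoc xs (ys ++ t ∷ []) ts)))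

    regroup₂ : ∀ (xs ys zs : List Token) t ts → ((xs ++ ys) ++ zs) ++ t ∷ ts ≡ (xs ++ ys ++ zs ++ t ∷ []) ++ ts
    regroup₂ xs ys zs t ts = trans (cong (_++ t ∷ ts) (++-assoc xs ys zs))
      (trans (regroup₁ xs (ys ++ zs) t ts) (cong (λ us → (xs ++ us) ++ ts) (++-assoc ys zs (t ∷ []))))

    var-tokens : ∀ i j k (xs ts : List Token) →
      xs ++ (replicate i stroke ++ comma ∷ replicate j stroke) ++ k ∷ ts ≡
      (xs ++ replicate i stroke ++ comma ∷ replicate j stroke ++ k ∷ []) ++ ts
    var-tokens i j k xs ts = trans (sym (++-assoc xs _ (k ∷ ts))) (trans (regroup₁ xs _ k ts)
      (cong (λ us → (xs ++ us) ++ ts) (++-assoc (replicate i stroke) (comma ∷ replicate j stroke) (k ∷ []))))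

  -- Each parsing step moves tokens across the borders between stack, partial variable and rest, so
  -- that together they spell the same list throughout, and in the end that of the result.
  parseFormula-inverse : ∀ Fs p ts {F} → parseFormula ms Fs p ts ≡ just F →
    stackTokens Fs ++ partialTokens p ++ ts ≡ formulaTokens F
  parseFormula-inverse Fs (block k) (stroke ∷ ts) eq =
    trans (cong (stackTokens Fs ++_) (strokes-suc k ts)) (parseFormula-inverse Fs (block (suc k)) ts eq)
  parseFormula-inverse Fs (block k) (comma ∷ ts) eq with k <? n
  ... | yes k<n = trans (cong (stackTokens Fs ++_) (trans (cong (λ k → replicate k stroke ++ comma ∷ ts) (sym (toℕ-fromℕ< k<n)))
        (sym (++-assoc (replicate (toℕ (fromℕ< k<n)) stroke) (comma ∷ []) ts))))
        (parseFormula-inverse Fs (position (fromℕ< k<n) 0) ts eq)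
  parseFormula-inverse Fs (position i k) (stroke ∷ ts) eq =
    trans (cong (stackTokens Fs ++_) (trans (++-assoc (replicate (toℕ i) stroke) _ (stroke ∷ ts))
      (trans (cong (λ us → replicate (toℕ i) stroke ++ comma ∷ us) (strokes-suc k ts))
             (sym (++-assoc (replicate (toℕ i) stroke) _ ts)))))
      (parseFormula-inverse Fs (position i (suc k)) ts eq)
  parseFormula-inverse Fs (position i k) (# ∷ ts) eq with k <? suc (lookup ms i)
  ... | yes k<m = trans (var-tokens (toℕ i) k # (stackTokens Fs) ts)
        (trans (cong (λ k → (stackTokens Fs ++ replicate (toℕ i) stroke ++ comma ∷ replicate k stroke ++ # ∷ []) ++ ts)
                 (sym (toℕ-fromℕ< k<m)))
          (parseFormula-inverse (var i (fromℕ< k<m) ∷ Fs) (block 0) ts eq))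
  parseFormula-inverse Fs (block 0) (⊥ₜ ∷ ts) eq =
    trans (regroup Fs (const false) ts) (parseFormula-inverse (const false ∷ Fs) (block 0) ts eq)
  parseFormula-inverse Fs (block 0) (⊤ₜ ∷ ts) eq =
    trans (regroup Fs (const true) ts) (parseFormula-inverse (const true ∷ Fs) (block 0) ts eq)
  parseFormula-inverse (F ∷ Fs) (block 0) (¬ₜ ∷ ts) eq =
    trans (regroup₁ (stackTokens Fs) (formulaTokens F) ¬ₜ ts) (parseFormula-inverse (neg F ∷ Fs) (block 0) ts eq)
  parseFormula-inverse (G ∷ F ∷ Fs) (block 0) (∧ₜ ∷ ts) eq =
    trans (regroup₂ (stackTokens Fs) (formulaTokens F) (formulaTokens G) ∧ₜ ts) (parseFormula-inverse (and F G ∷ Fs) (block 0) ts eq)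
  parseFormula-inverse (G ∷ F ∷ Fs) (block 0) (∨ₜ ∷ ts) eq =
    trans (regroup₂ (stackTokens Fs) (formulaTokens F) (formulaTokens G) ∨ₜ ts) (parseFormula-inverse (or F G ∷ Fs) (block 0) ts eq)
  parseFormula-inverse (F ∷ []) (block 0) [] refl = ++-identityʳ (formulaTokens F)

-- Machines edit their input without parsing it. This turns any decodable word into an `encode`, on
-- which the effect of the edits is known.
decode-inverse : ∀ n w {I} → decode n w ≡ just I → w ≡ encode I
decode-inverse n w eq with tokens w in eq₁
... | just ts with parseBlocks n 0 ts in eq₂
... | just (ms , us) with parseFormula ms [] (block 0) us in eq₃
decode-inverse n w refl | just ts | just (ms , us) | just F =
  trans (tokens-inverse w eq₁) (cong (concatMap bits)
    (trans (parseBlocks-inverse n ts eq₂) (cong (blockTokens ms ++_) (parseFormula-inverse ms [] (block 0) us eq₃))))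

Bool-ext : ∀ {a b} → (a ≡ true → b ≡ true) → (b ≡ true → a ≡ true) → a ≡ b
Bool-ext {true}  {b}     a⇒b b⇒a = sym (a⇒b refl)
Bool-ext {false} {true}  a⇒b b⇒a = b⇒a refl
Bool-ext {false} {false} a⇒b b⇒a = refl

∧-elim : ∀ {a b} → a ∧ b ≡ true → a ≡ true × b ≡ true
∧-elim {true} {true} refl = refl , refl

∧-intro : ∀ {a b} → a ≡ true → b ≡ true → a ∧ b ≡ true
∧-intro refl refl = refl

¬-not-true : ∀ {a} → a ≢ true → a ≡ false
¬-not-true {true}  a≢ = contradiction refl a≢
¬-not-true {false} a≢ = refl

-- Quantification over words

∈-bitVectors : ∀ {m} (x : Vec Bool m) → x ∈ bitVectors m
∈-bitVectors []          = here refl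
∈-bitVectors (false ∷ x) = ∈-++⁺ˡ (∈-map⁺ (false ∷_) (∈-bitVectors x))
∈-bitVectors (true ∷ x)  = ∈-++⁺ʳ (map (false ∷_) (bitVectors _)) (∈-map⁺ (true ∷_) (∈-bitVectors x))

bitVectors-unique : ∀ m → Unique (bitVectors m)
bitVectors-unique zero    = [] ∷ []
bitVectors-unique (suc m) = ++⁺ (map⁺ ∷-injectiveʳ (bitVectors-unique m)) (map⁺ ∷-injectiveʳ (bitVectors-unique m)) disjoint
  where
  disjoint : ∀ {x} → x ∈ map (false ∷_) (bitVectors m) × x ∈ map (true ∷_) (bitVectors m) → _
  disjoint (x∈₀ , x∈₁) with ∈-map⁻ (false ∷_) x∈₀ | ∈-map⁻ (true ∷_) x∈₁
  ... | _ , _ , refl | _ , _ , ()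

module _ {A : Set} (p : A → Bool) where

  any-intro : ∀ {xs x} → x ∈ xs → p x ≡ true → any p xs ≡ true
  any-intro (here refl) px rewrite px = refl
  any-intro {y ∷ xs} (there x∈) px with p y
  ... | true  = refl
  ... | false = any-intro x∈ px

  any-elim : ∀ xs → any p xs ≡ true → ∃[ x ] p x ≡ true
  any-elim (x ∷ xs) eq with p x in px
  ... | true  = x , px
  ... | false = any-elim xs eq

  all-intro : ∀ xs → (∀ x → p x ≡ true) → all p xs ≡ true
  all-intro []       px = refl
  all-intro (x ∷ xs) px = ∧-intro (px x) (all-intro xs px)

  all-elim : ∀ {xs x} → all p xs ≡ true → x ∈ xs → p x ≡ true
  all-elim eq (here refl) = proj₁ (∧-elim eq)
  all-elim eq (there x∈)  = all-elim (proj₂ (∧-elim eq)) x∈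

module _ {A : Set} {p q : A → Bool} (p≗q : ∀ x → p x ≡ q x) where

  any-cong : ∀ xs → any p xs ≡ any q xs
  any-cong []       = refl
  any-cong (x ∷ xs) = cong₂ _∨_ (p≗q x) (any-cong xs)

  all-cong : ∀ xs → all p xs ≡ all q xs
  all-cong []       = refl
  all-cong (x ∷ xs) = cong₂ _∧_ (p≗q x) (all-cong xs)

all-dual : ∀ {A : Set} (p : A → Bool) xs → all (not ∘ p) xs ≡ not (any p xs)
all-dual p []       = refl
all-dual p (x ∷ xs) with p x
... | true  = refl
... | false = all-dual p xs

any-dual : ∀ {A : Set} (p : A → Bool) xs → any (not ∘ p) xs ≡ not (all p xs)
any-dual p []       = refl
any-dual p (x ∷ xs) with p x
... | true  = any-dual p xs
... | false = refl

someW : ∀ {m} → (Vec Bool m → Bool) → Bool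
someW {m} p = any p (bitVectors m)

everyW : ∀ {m} → (Vec Bool m → Bool) → Bool
everyW {m} p = all p (bitVectors m)

module _ {l m} (f : Vec Bool l → Vec Bool m) (onto : ∀ y → ∃[ x ] f x ≡ y) (α : Vec Bool m → Bool) (b : Bool) where

  some-∧-const : someW (λ x → α (f x) ∧ b) ≡ someW α ∧ b
  some-∧-const = Bool-ext
    (λ eq → let x , e = any-elim _ (bitVectors l) eq; e₁ , e₂ = ∧-elim e in
            ∧-intro (any-intro α (∈-bitVectors (f x)) e₁) e₂)
    (λ eq → let e₁ , e₂ = ∧-elim eq; y , e = any-elim α (bitVectors m) e₁; x , fx≡y = onto y in
            any-intro _ (∈-bitVectors x) (∧-intro (trans (cong α fx≡y) e) e₂))

  every-∧-const : everyW (λ x → α (f x) ∧ b) ≡ everyW α ∧ b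
  every-∧-const = Bool-ext
    (λ eq → ∧-intro (all-intro α (bitVectors m) λ y → let x , fx≡y = onto y in
                       trans (cong α (sym fx≡y)) (proj₁ (∧-elim (all-elim _ eq (∈-bitVectors x)))))
                    (proj₂ (∧-elim (all-elim _ eq (∈-bitVectors (Vec.replicate l true))))))
    (λ eq → let e₁ , e₂ = ∧-elim eq in
            all-intro _ (bitVectors l) λ x → ∧-intro (all-elim α e₁ (∈-bitVectors (f x))) e₂)

module _ {l m n} (f : Vec Bool l → Vec Bool m) (g : Vec Bool l → Vec Bool n)
         (onto : ∀ y u → ∃[ x ] f x ≡ y × g x ≡ u) (α : Vec Bool m → Bool) (β : Vec Bool n → Bool) where

  -- The components `f x` and `g x` can be prescribed independently, so a single quantifier over `x`
  -- acts as a pair of quantifiers.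
  some-∧ : someW (λ x → α (f x) ∧ β (g x)) ≡ someW α ∧ someW β
  some-∧ = Bool-ext
    (λ eq → let x , e = any-elim _ (bitVectors l) eq; e₁ , e₂ = ∧-elim e in
            ∧-intro (any-intro α (∈-bitVectors (f x)) e₁) (any-intro β (∈-bitVectors (g x)) e₂))
    (λ eq → let e₁ , e₂ = ∧-elim eq; y , ey = any-elim α (bitVectors m) e₁; u , eu = any-elim β (bitVectors n) e₂
                x , fx≡y , gx≡u = onto y u in
            any-intro _ (∈-bitVectors x) (∧-intro (trans (cong α fx≡y) ey) (trans (cong β gx≡u) eu)))

  every-∧ : everyW (λ x → α (f x) ∧ β (g x)) ≡ everyW α ∧ everyW β
  every-∧ = Bool-ext
    (λ eq → ∧-intro
      (all-intro α (bitVectors m) λ y → let x , fx≡y , _ = onto y (Vec.replicate n true) in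
         trans (cong α (sym fx≡y)) (proj₁ (∧-elim (all-elim _ eq (∈-bitVectors x)))))
      (all-intro β (bitVectors n) λ u → let x , _ , gx≡u = onto (Vec.replicate m true) u in
         trans (cong β (sym gx≡u)) (proj₂ (∧-elim {a = α (f x)} (all-elim _ eq (∈-bitVectors x))))))
    (λ eq → let e₁ , e₂ = ∧-elim eq in
            all-intro _ (bitVectors l) λ x →
              ∧-intro (all-elim α e₁ (∈-bitVectors (f x))) (all-elim β e₂ (∈-bitVectors (g x))))

-- Alternating quantifiers: congruence, constants, duality

mutual
  sat-cong : ∀ {n} {ms : Vec ℕ n} {f g : Fun ms} → (∀ xs → f xs ≡ g xs) → sat f ≡ sat g
  sat-cong {ms = []}     f≗g = f≗g []
  sat-cong {ms = m ∷ ms} f≗g = any-cong (λ x → co-sat-cong (λ xs → f≗g (x ∷ xs))) (words m)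

  co-sat-cong : ∀ {n} {ms : Vec ℕ n} {f g : Fun ms} → (∀ xs → f xs ≡ g xs) → co-sat f ≡ co-sat g
  co-sat-cong {ms = []}     f≗g = f≗g []
  co-sat-cong {ms = m ∷ ms} f≗g = all-cong (λ x → sat-cong (λ xs → f≗g (x ∷ xs))) (words m)

mutual
  sat-const : ∀ {n} (ms : Vec ℕ n) b → sat {ms = ms} (λ _ → b) ≡ b
  sat-const []       b = refl
  sat-const (m ∷ ms) b = Bool-ext
    (λ eq → trans (sym (co-sat-const ms b)) (proj₂ (any-elim _ (words m) eq)))
    (λ b≡ → any-intro _ (∈-bitVectors (Vec.replicate (suc m) true)) (trans (co-sat-const ms b) b≡))

  co-sat-const : ∀ {n} (ms : Vec ℕ n) b → co-sat {ms = ms} (λ _ → b) ≡ b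
  co-sat-const []       b = refl
  co-sat-const (m ∷ ms) b = Bool-ext
    (λ eq → trans (sym (sat-const ms b)) (all-elim _ eq (∈-bitVectors (Vec.replicate (suc m) true))))
    (λ b≡ → all-intro _ (words m) λ _ → trans (sat-const ms b) b≡)

mutual
  -- De Morgan along the whole prefix. Its companion turns a failing `sat` into a game that opens
  -- with a universal block, as the level of the last query requires.
  sat-dual : ∀ {n} {ms : Vec ℕ n} (f : Fun ms) → sat (not ∘ f) ≡ not (co-sat f)
  sat-dual {ms = []}     f = refl
  sat-dual {ms = m ∷ ms} f = trans (any-cong (λ x → co-sat-dual (f at x)) (words m)) (any-dual (λ x → sat (f at x)) (words m))

  co-sat-dual : ∀ {n} {ms : Vec ℕ n} (f : Fun ms) → co-sat (not ∘ f) ≡ not (sat f)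
  co-sat-dual {ms = []}     f = refl
  co-sat-dual {ms = m ∷ ms} f = trans (all-cong (λ x → sat-dual (f at x)) (words m)) (all-dual (λ x → co-sat (f at x)) (words m))

-- Bits by position; positions beyond the end read as false.

infix 9 _‼_

_‼_ : ∀ {m} → Vec Bool m → ℕ → Bool
[]      ‼ _     = false
(b ∷ v) ‼ zero  = b
(b ∷ v) ‼ suc k = v ‼ k

lookup-‼ : ∀ {m} (v : Vec Bool m) j → lookup v j ≡ v ‼ toℕ j
lookup-‼ (b ∷ v) zero    = refl
lookup-‼ (b ∷ v) (suc j) = lookup-‼ v j

‼-ext : ∀ {m} {u v : Vec Bool m} → (∀ {k} → k < m → u ‼ k ≡ v ‼ k) → u ≡ v
‼-ext {u = []}    {[]}    _  = refl
‼-ext {u = b ∷ u} {c ∷ v} eq = cong₂ _∷_ (eq (s≤s z≤n)) (‼-ext (eq ∘ s≤s))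

‼-++ˡ : ∀ {m n} (u : Vec Bool m) (v : Vec Bool n) {k} → k < m → (u Vec.++ v) ‼ k ≡ u ‼ k
‼-++ˡ (b ∷ u) v {zero}  _         = refl
‼-++ˡ (b ∷ u) v {suc k} (s≤s k<m) = ‼-++ˡ u v k<m

‼-++ʳ : ∀ {m n} (u : Vec Bool m) (v : Vec Bool n) k → (u Vec.++ v) ‼ (m + k) ≡ v ‼ k
‼-++ʳ []      v k = refl
‼-++ʳ (b ∷ u) v k = ‼-++ʳ u v k

slice : ∀ {l} → ℕ → (m : ℕ) → Vec Bool l → Vec Bool m
slice s m v = tabulate λ j → v ‼ (s + toℕ j)

tabulate-‼ : ∀ {m} (f : ℕ → Bool) {k} → k < m → tabulate {n = m} (f ∘ toℕ) ‼ k ≡ f k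
tabulate-‼ {suc m} f {zero}  _         = refl
tabulate-‼ {suc m} f {suc k} (s≤s k<m) = tabulate-‼ (f ∘ suc) k<m

slice-‼ : ∀ {l} s {m} (v : Vec Bool l) {k} → k < m → slice s m v ‼ k ≡ v ‼ (s + k)
slice-‼ s v = tabulate-‼ (λ k → v ‼ (s + k))

-- The second track starts one block early and so ends one block before the wide words do; this is
-- the case j < k.
slices : ℕ → ∀ {j k M} → j ≤ k → (ms : Vec ℕ j) → AllV.All Word (Vec.replicate k M) → AllV.All Word ms
slices s z≤n       []       ws       = []
slices s (s≤s j≤k) (m ∷ ms) (w ∷ ws) = slice s (suc m) w ∷ slices s j≤k ms ws

-- A word of 1 + N + N bits holds a spare bit and two numbered tracks.
module Tracks (N : ℕ) where

  join : ∀ {m n} → Bool → Vec Bool m → Vec Bool n → Word (N + N)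
  join b y u = b ∷ slice 0 N y Vec.++ slice 0 N u

  first : ∀ m → Word (N + N) → Vec Bool m
  first m = slice 1 m

  second : ∀ m → Word (N + N) → Vec Bool m
  second m = slice (1 + N) m

  first-join : ∀ {m n} b (y : Vec Bool m) (u : Vec Bool n) → m ≤ N → first m (join b y u) ≡ y
  first-join b y u m≤N = ‼-ext λ {k} k<m →
    trans (slice-‼ 1 (join b y u) k<m)
    (trans (‼-++ˡ (slice 0 N y) (slice 0 N u) (≤-trans k<m m≤N))
           (slice-‼ 0 y (≤-trans k<m m≤N)))

  second-join : ∀ {m n} b (y : Vec Bool m) (u : Vec Bool n) → n ≤ N → second n (join b y u) ≡ u
  second-join b y u n≤N = ‼-ext λ {k} k<n →
    trans (slice-‼ (1 + N) (join b y u) k<n)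
    (trans (‼-++ʳ (slice 0 N y) (slice 0 N u) k) (slice-‼ 0 u (≤-trans k<n n≤N)))

  onto : ∀ {m n} → m ≤ N → n ≤ N → (y : Vec Bool m) (u : Vec Bool n) → ∃[ X ] first m X ≡ y × second n X ≡ u
  onto m≤N n≤N y u = join false y u , first-join false y u m≤N , second-join false y u n≤N

  Fits : ∀ {k} → Vec ℕ k → Set
  Fits = AllV.All (_< N)

  mutual
    sat-∧-const : ∀ {k} (as : Vec ℕ k) → Fits as → (A : Fun as) → ∀ b →
      sat {ms = Vec.replicate k (N + N)} (λ ws → A (slices 1 ≤-refl as ws) ∧ b) ≡ sat A ∧ b
    sat-∧-const []       fa         A b = refl
    sat-∧-const (a ∷ as) (a< ∷ fa) A b = trans
      (any-cong (λ w → co-sat-∧-const as fa (A at first (suc a) w) b) (words (N + N)))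
      (some-∧-const (first (suc a)) (λ y → let X , eq , _ = onto {n = 0} a< z≤n y [] in X , eq) (λ y → co-sat (A at y)) b)

    co-sat-∧-const : ∀ {k} (as : Vec ℕ k) → Fits as → (A : Fun as) → ∀ b →
      co-sat {ms = Vec.replicate k (N + N)} (λ ws → A (slices 1 ≤-refl as ws) ∧ b) ≡ co-sat A ∧ b
    co-sat-∧-const []       fa         A b = refl
    co-sat-∧-const (a ∷ as) (a< ∷ fa) A b = trans
      (all-cong (λ w → sat-∧-const as fa (A at first (suc a) w) b) (words (N + N)))
      (every-∧-const (first (suc a)) (λ y → let X , eq , _ = onto {n = 0} a< z≤n y [] in X , eq) (λ y → sat (A at y)) b)

  mutual
    -- The factors read disjoint tracks of the same blocks, and under either quantifier a word is an
    -- independent choice of both tracks, so the conjunction splits block by block. `B` may run out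
    -- of blocks first; it is then a constant.
    sat-∧ : ∀ {j k} (j≤k : j ≤ k) (as : Vec ℕ k) (bs : Vec ℕ j) → Fits as → Fits bs → (A : Fun as) (B : Fun bs) →
      sat {ms = Vec.replicate k (N + N)} (λ ws → A (slices 1 ≤-refl as ws) ∧ B (slices (1 + N) j≤k bs ws)) ≡ sat A ∧ sat B
    sat-∧ z≤n       as       []       fa        fb        A B = sat-∧-const as fa A (B [])
    sat-∧ (s≤s j≤k) (a ∷ as) (b ∷ bs) (a< ∷ fa) (b< ∷ fb) A B = trans
      (any-cong (λ w → co-sat-∧ j≤k as bs fa fb (A at first (suc a) w) (B at second (suc b) w)) (words (N + N)))
      (some-∧ (first (suc a)) (second (suc b)) (onto a< b<) (λ y → co-sat (A at y)) (λ u → co-sat (B at u)))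

    co-sat-∧ : ∀ {j k} (j≤k : j ≤ k) (as : Vec ℕ k) (bs : Vec ℕ j) → Fits as → Fits bs → (A : Fun as) (B : Fun bs) →
      co-sat {ms = Vec.replicate k (N + N)} (λ ws → A (slices 1 ≤-refl as ws) ∧ B (slices (1 + N) j≤k bs ws)) ≡ co-sat A ∧ co-sat B
    co-sat-∧ z≤n       as       []       fa        fb        A B = co-sat-∧-const as fa A (B [])
    co-sat-∧ (s≤s j≤k) (a ∷ as) (b ∷ bs) (a< ∷ fa) (b< ∷ fb) A B = trans
      (all-cong (λ w → sat-∧ j≤k as bs fa fb (A at first (suc a) w) (B at second (suc b) w)) (words (N + N)))
      (every-∧ (first (suc a)) (second (suc b)) (onto a< b<) (λ y → sat (A at y)) (λ u → sat (B at u)))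

-- Unique solutions

module _ {m : ℕ} (p : Vec Bool m → Bool) where

  private
    selected = filterᵇ p (bitVectors m)

    ∈-selected : ∀ {x} → p x ≡ true → x ∈ selected
    ∈-selected px = ∈-filter⁺ (T? ∘ p) (∈-bitVectors _) (Equivalence.from T-≡ px)

    selected-unique : Unique selected
    selected-unique = filter⁺ (T? ∘ p) (bitVectors-unique m)

    selected-holds : ∀ {x} → x ∈ selected → p x ≡ true
    selected-holds x∈ = Equivalence.to T-≡ (proj₂ (∈-filter⁻ (T? ∘ p) {xs = bitVectors m} x∈))

  -- `uval` looks at the list of solutions. As the enumeration of words has no repetitions, unique
  -- existence determines that list.
  filter-singleton : ∀ {x} → p x ≡ true → (∀ y → p y ≡ true → y ≡ x) → selected ≡ x ∷ []
  filter-singleton {x} px only-x = go selected selected-unique (∈-selected px) (λ y∈ → only-x _ (selected-holds y∈))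
    where
    go : ∀ xs → Unique xs → x ∈ xs → (∀ {y} → y ∈ xs → y ≡ x) → xs ≡ x ∷ []
    go (y ∷ [])     _                   _ all≡ = cong (_∷ []) (all≡ (here refl))
    go (y ∷ z ∷ xs) ((y≢z ∷ _) ∷ _) _ all≡ = contradiction (trans (all≡ (here refl)) (sym (all≡ (there (here refl))))) y≢z

  singleton-filter : ∀ {x} → selected ≡ x ∷ [] → p x ≡ true × (∀ y → p y ≡ true → y ≡ x)
  singleton-filter {x} eq = selected-holds (subst (x ∈_) (sym eq) (here refl)) , λ y py → single (subst (y ∈_) eq (∈-selected py))
    where
    single : ∀ {y} → y ∈ x ∷ [] → y ≡ x
    single (here y≡x) = y≡x

  filter≤1 : (length selected ≤ᵇ 1) ≡ true → ∀ {x y} → p x ≡ true → p y ≡ true → x ≡ y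
  filter≤1 len px py with selected | ∈-selected px | ∈-selected py
  ... | _ ∷ [] | here refl | here refl = refl

  filter≤1⁻ : (∀ {x y} → p x ≡ true → p y ≡ true → x ≡ y) → (length selected ≤ᵇ 1) ≡ true
  filter≤1⁻ same = go selected selected-unique selected-holds
    where
    go : ∀ xs → Unique xs → (∀ {x} → x ∈ xs → p x ≡ true) → (length xs ≤ᵇ 1) ≡ true
    go []           _               _ = refl
    go (x ∷ [])     _               _ = refl
    go (x ∷ y ∷ xs) ((x≢y ∷ _) ∷ _) h = contradiction (same (h (here refl)) (h (there (here refl)))) x≢y

-- Words in lexicographic order, the last position being the most significant

lexLess : (u v : ℕ → Bool) → ℕ → Bool
lexLess u v zero    = false
lexLess u v (suc j) = (lexLess u v j ∧ (not (u j) ∨ v j)) ∨ (not (u j) ∧ v j)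

-- The number with binary digits `u`. Reducing the order on words to that on numbers provides
-- descent and antisymmetry.
value : (ℕ → Bool) → ℕ → ℕ
value u zero    = 0
value u (suc j) = value u j + (if u j then 2 ^ j else 0)

value< : ∀ u j → value u j < 2 ^ j
value< u zero    = s≤s z≤n
value< u (suc j) with u j
... | true  = ≤-trans (+-monoˡ-< (2 ^ j) (value< u j)) (≤-reflexive (cong (2 ^ j +_) (sym (+-identityʳ (2 ^ j)))))
... | false = ≤-trans (≤-reflexive (cong suc (+-identityʳ (value u j)))) (≤-trans (value< u j) (m≤m+n (2 ^ j) _))

lexLess⇒value< : ∀ u v j → lexLess u v j ≡ true → value u j < value v j
lexLess⇒value< u v (suc j) eq with u j | v j
... | true  | true  = +-monoˡ-< (2 ^ j) (lexLess⇒value< u v j (trans (sym (lemma (lexLess u v j))) eq))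
  where
  lemma : ∀ a → (a ∧ true) ∨ false ≡ a
  lemma true  = refl
  lemma false = refl
... | true  | false with lexLess u v j
lexLess⇒value< u v (suc j) () | true | false | true
lexLess⇒value< u v (suc j) () | true | false | false
lexLess⇒value< u v (suc j) eq | false | true rewrite +-identityʳ (value u j) = ≤-trans (value< u j) (m≤n+m (2 ^ j) (value v j))
lexLess⇒value< u v (suc j) eq | false | false rewrite +-identityʳ (value u j) | +-identityʳ (value v j) =
  lexLess⇒value< u v j (trans (sym (lemma (lexLess u v j))) eq)
  where
  lemma : ∀ a → (a ∧ true) ∨ false ≡ a
  lemma true  = refl
  lemma false = refl

value<⇒lexLess : ∀ u v j → value u j < value v j → lexLess u v j ≡ true
value<⇒lexLess u v (suc j) lt with u j | v j
... | true  | true  rewrite value<⇒lexLess u v j (+-cancelʳ-< (2 ^ j) _ _ lt) = refl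
... | true  | false = contradiction (≤-trans (m≤n+m (2 ^ j) (value u j)) (<⇒≤ lt))
                        (<⇒≱ (≤-trans (≤-reflexive (cong suc (+-identityʳ (value v j)))) (value< v j)))
... | false | false rewrite value<⇒lexLess u v j (+-cancelʳ-< 0 _ _ lt) = refl
... | false | true  with lexLess u v j
...   | true  = refl
...   | false = refl

value-injective : ∀ u v j → value u j ≡ value v j → ∀ {k} → k < j → u k ≡ v k
value-injective u v (suc j) eq {k} (s≤s k≤j) with u j in uj | v j in vj
... | true  | false = contradiction (≤-trans (m≤n+m (2 ^ j) (value u j)) (≤-reflexive (trans eq (+-identityʳ _)))) (<⇒≱ (value< v j))
... | false | true  = contradiction (≤-trans (m≤n+m (2 ^ j) (value v j)) (≤-reflexive (trans (sym eq) (+-identityʳ _)))) (<⇒≱ (value< u j))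
... | true  | true  with k ≟ j
...   | yes refl = trans uj (sym vj)
...   | no  k≢j  = value-injective u v j (+-cancelʳ-≡ (2 ^ j) _ _ eq) (≤∧≢⇒< k≤j k≢j)
value-injective u v (suc j) eq {k} (s≤s k≤j) | false | false with k ≟ j
...   | yes refl = trans uj (sym vj)
...   | no  k≢j  = value-injective u v j (+-cancelʳ-≡ 0 _ _ eq) (≤∧≢⇒< k≤j k≢j)

module _ {N : ℕ} where

  lessW : Vec Bool N → Vec Bool N → Bool
  lessW y z = lexLess (y ‼_) (z ‼_) N

  private
    val : Vec Bool N → ℕ
    val y = value (y ‼_) N

  Least : (Vec Bool N → Bool) → Vec Bool N → Set
  Least P z = P z ≡ true × (∀ y → lessW y z ≡ true → P y ≡ false)

  least-exists : ∀ P w → P w ≡ true → ∃[ z ] Least P z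
  -- Every smaller witness has a smaller value, so the value of `w` bounds the descent.
  least-exists P w = search (suc (val w)) w ≤-refl
    where
    search : ∀ n w → val w < n → P w ≡ true → ∃[ z ] Least P z
    search (suc n) w (s≤s w≤n) Pw with someW (λ y → P y ∧ lessW y w) in eq
    ... | true  = let y , e = any-elim _ (bitVectors N) eq; Py , y<w = ∧-elim e in
                  search n y (≤-trans (lexLess⇒value< (y ‼_) (w ‼_) N y<w) w≤n) Py
    ... | false = w , Pw , λ y y<w → ¬-not-true λ Py → contradiction
                    (trans (sym eq) (any-intro _ (∈-bitVectors y) (∧-intro Py y<w))) λ ()

  least-unique : ∀ {P z z′} → Least P z → Least P z′ → z ≡ z′
  least-unique {P} {z} {z′} (Pz , z-least) (Pz′ , z′-least) =
    ‼-ext (value-injective (z ‼_) (z′ ‼_) N (≤-antisym (≮⇒≥ (not-below {z′} {z} z-least Pz′)) (≮⇒≥ (not-below {z} {z′} z′-least Pz))))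
    where
    not-below : ∀ {y z} → (∀ y → lessW y z ≡ true → P y ≡ false) → P y ≡ true → ¬ val y < val z
    not-below {y} {z} least Py lt with () ← trans (sym (least y (value<⇒lexLess (y ‼_) (z ‼_) N lt))) Py

-- Rewriting encoded formulas with a finite control

data Counter : Set where
  total index : Counter

tally : ℕ → ℕ → Counter → ℕ
tally N j total = N
tally N j index = j

Phase : Set
Phase = Maybe Bool

pattern between    = nothing
pattern inBlock    = just false
pattern inPosition = just true

-- The number of blocks is fixed with the problem, so a finite control can count the commas of the
-- header and know where the formula starts; each `beyond` is a comma passed.
data Mode : ℕ → Set where
  phase  : Phase → Mode 0
  header : ∀ {n} → Mode (suc n)
  beyond : ∀ {n} → Mode n → Mode (suc n)

instance
  Mode-finite : ∀ {n} → IsFinite (Mode n)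
  Mode-finite {zero}  = via Mode↔ Maybe-finite
    where
    Mode↔ : Mode 0 ↔ Phase
    Mode↔ = mk↔ₛ′ (λ { (phase p) → p }) phase (λ _ → refl) (λ { (phase p) → refl })
  Mode-finite {suc n} = via Mode↔ (Maybe-finite {{Mode-finite {n}}})
    where
    Mode↔ : Mode (suc n) ↔ Maybe (Mode n)
    Mode↔ = mk↔ₛ′ (λ { header → nothing ; (beyond m) → just m }) (λ { nothing → header ; (just m) → beyond m })
                   (λ { nothing → refl ; (just m) → refl }) (λ { header → refl ; (beyond m) → refl })

startMode : ∀ n → Mode n
startMode zero    = phase between
startMode (suc n) = header

nextPhase : Phase → Token → Phase
nextPhase between    stroke = inBlock
nextPhase between    comma  = inPosition
nextPhase inBlock    comma  = inPosition
nextPhase inPosition #      = between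
nextPhase p          _      = p

nextMode : ∀ {n} → Mode n → Token → Mode n
nextMode (phase p)  t     = phase (nextPhase p t)
nextMode header     comma = beyond (startMode _)
nextMode header     _     = header
nextMode (beyond m) t     = beyond (nextMode m t)

Pieces : Set
Pieces = List (Piece Counter)

module _ (onHeader : Token → Pieces) (onFormula : Phase → Token → Pieces) where

  outputMode : ∀ {n} → Mode n → Token → Pieces
  outputMode (phase p)  t = onFormula p t
  outputMode header     t = onHeader t
  outputMode (beyond m) t = outputMode m t

  rewriting : ∀ n → Transducer (Mode n) Counter
  rewriting n = record { next = nextMode ; output = outputMode }

  module _ (ν : Counter → ℕ) where

    headerRun : List Token → List Token
    headerRun []       = []
    headerRun (t ∷ ts) = expand ν (onHeader t) ++ headerRun ts

    formulaRun : Phase → List Token → List Token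
    formulaRun p []       = []
    formulaRun p (t ∷ ts) = expand ν (onFormula p t) ++ formulaRun (nextPhase p t) ts

    modeRun : ∀ {n} → Mode n → List Token → List Token
    modeRun m []       = []
    modeRun m (t ∷ ts) = expand ν (outputMode m t) ++ modeRun (nextMode m t) ts

    transduction-tokens : ∀ {n} (m : Mode n) ts →
      Transducer.transduction (rewriting n) ν m (concatMap bits ts) ≡ concatMap bits (modeRun m ts)
    transduction-tokens m []       = refl
    transduction-tokens {n} m (t ∷ ts) =
      trans (one t) (trans (cong (concatMap bits (expand ν (outputMode m t)) ++_) (transduction-tokens (nextMode m t) ts))
                           (sym (concatMap-++ bits (expand ν (outputMode m t)) (modeRun (nextMode m t) ts))))
      where
      open Transducer (rewriting n) using (transduction)
      one : ∀ t → transduction ν m (bits t ++ concatMap bits ts)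
                    ≡ concatMap bits (expand ν (outputMode m t)) ++ transduction ν (nextMode m t) (concatMap bits ts)
      one stroke = refl
      one comma  = refl
      one #      = refl
      one ⊥ₜ     = refl
      one ⊤ₜ     = refl
      one ¬ₜ     = refl
      one ∧ₜ     = refl
      one ∨ₜ     = refl

    modeRun-beyond : ∀ {n} (m : Mode n) ts → modeRun (beyond m) ts ≡ modeRun m ts
    modeRun-beyond m []       = refl
    modeRun-beyond m (t ∷ ts) = cong (expand ν (outputMode m t) ++_) (modeRun-beyond (nextMode m t) ts)

    modeRun-phase : ∀ p ts → modeRun (phase p) ts ≡ formulaRun p ts
    modeRun-phase p []       = refl
    modeRun-phase p (t ∷ ts) = cong (expand ν (onFormula p t) ++_) (modeRun-phase (nextPhase p t) ts)

    modeRun-blocks : ∀ {n} (ms : Vec ℕ n) ts →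
      modeRun (startMode n) (blockTokens ms ++ ts) ≡ headerRun (blockTokens ms) ++ formulaRun between ts
    modeRun-blocks []       ts = modeRun-phase between ts
    modeRun-blocks {suc n} (m ∷ ms) ts = strokes (suc m)
      where
      strokes : ∀ k → modeRun (header {n}) ((replicate k stroke ++ comma ∷ blockTokens ms) ++ ts)
                        ≡ headerRun (replicate k stroke ++ comma ∷ blockTokens ms) ++ formulaRun between ts
      strokes zero    = trans (cong (expand ν (onHeader comma) ++_)
        (trans (modeRun-beyond (startMode _) (blockTokens ms ++ ts)) (modeRun-blocks ms ts)))
        (sym (++-assoc (expand ν (onHeader comma)) (headerRun (blockTokens ms)) (formulaRun between ts)))
      strokes (suc k) = trans (cong (expand ν (onHeader stroke) ++_) (strokes k))
        (sym (++-assoc (expand ν (onHeader stroke)) (headerRun (replicate k stroke ++ comma ∷ blockTokens ms)) (formulaRun between ts)))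

-- Substituting variables for variables

-- Junk value: positions beyond the end of a block become the last one.
clamp : ∀ m → ℕ → Fin (suc m)
clamp m       zero    = zero
clamp zero    (suc k) = zero
clamp (suc m) (suc k) = suc (clamp m k)

toℕ-clamp : ∀ {m k} → k ≤ m → toℕ (clamp m k) ≡ k
toℕ-clamp z≤n       = refl
toℕ-clamp (s≤s k≤m) = cong suc (toℕ-clamp k≤m)

Renaming : ℕ → ℕ → Set
Renaming n n′ = Fin n → ℕ → Fin n′ × ℕ

rename : ∀ {n n′} {ms : Vec ℕ n} {ms′ : Vec ℕ n′} → Renaming n n′ → Formula ms → Formula ms′
rename ρ (var i j) = var (proj₁ (ρ i (toℕ j))) (clamp _ (proj₂ (ρ i (toℕ j))))
rename ρ (const b) = const b
rename ρ (neg F)   = neg (rename ρ F)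
rename ρ (and F G) = and (rename ρ F) (rename ρ G)
rename ρ (or F G)  = or (rename ρ F) (rename ρ G)

Within : ∀ {n n′} → Vec ℕ n → Vec ℕ n′ → Renaming n n′ → Set
Within ms ms′ ρ = ∀ i {k} → k ≤ lookup ms i → proj₂ (ρ i k) ≤ lookup ms′ (proj₁ (ρ i k))

varTokens : ℕ → ℕ → List Token
varTokens i k = replicate i stroke ++ comma ∷ replicate k stroke ++ # ∷ []

module _ (onFormula : Phase → Token → Pieces) (ν : Counter → ℕ) where

  private
    run : Phase → List Token → List Token
    run = formulaRun (λ _ → []) onFormula ν

  -- Only the tokens of variables matter to the phase, so a rewriting that copies
  -- the connectives acts on formulas by what it does to variables.
  formulaRun-rename : ∀ {n n′} {ms : Vec ℕ n} {ms′ : Vec ℕ n′} (ρ : Renaming n n′) → Within ms ms′ ρ →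
    (∀ t → nextPhase between t ≡ between → expand ν (onFormula between t) ≡ t ∷ []) →
    (∀ (i : Fin n) k ts → run between (varTokens (toℕ i) k ++ ts)
       ≡ varTokens (toℕ (proj₁ (ρ i k))) (proj₂ (ρ i k)) ++ run between ts) →
    ∀ (F : Formula ms) ts →
    run between (formulaTokens F ++ ts) ≡ formulaTokens (rename {ms′ = ms′} ρ F) ++ run between ts
  formulaRun-rename {ms′ = ms′} ρ within copies vars = go
    where
    end : ∀ t ts → nextPhase between t ≡ between → run between (t ∷ ts) ≡ t ∷ run between ts
    end t ts eq rewrite copies t eq | eq = refl
    go : ∀ F ts → run between (formulaTokens F ++ ts) ≡ formulaTokens (rename {ms′ = ms′} ρ F) ++ run between ts
    go (var i j) ts = trans (vars i (toℕ j) ts)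
      (cong (λ k → varTokens (toℕ (proj₁ (ρ i (toℕ j)))) k ++ run between ts) (sym (toℕ-clamp (within i (s≤s⁻¹ (toℕ<n j))))))
    go (const false) ts = end ⊥ₜ ts refl
    go (const true)  ts = end ⊤ₜ ts refl
    go (neg F) ts
      rewrite ++-assoc (formulaTokens F) (¬ₜ ∷ []) ts | go F (¬ₜ ∷ ts) | end ¬ₜ ts refl =
        sym (++-assoc (formulaTokens (rename ρ F)) (¬ₜ ∷ []) _)
    go (and F G) ts
      rewrite ++-assoc (formulaTokens F) (formulaTokens G ++ ∧ₜ ∷ []) ts | ++-assoc (formulaTokens G) (∧ₜ ∷ []) ts
            | go F (formulaTokens G ++ ∧ₜ ∷ ts) | go G (∧ₜ ∷ ts) | end ∧ₜ ts refl
            | ++-assoc (formulaTokens (rename {ms′ = ms′} ρ F)) (formulaTokens (rename {ms′ = ms′} ρ G) ++ ∧ₜ ∷ []) (run between ts)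
            | ++-assoc (formulaTokens (rename {ms′ = ms′} ρ G)) (∧ₜ ∷ []) (run between ts) = refl
    go (or F G) ts
      rewrite ++-assoc (formulaTokens F) (formulaTokens G ++ ∨ₜ ∷ []) ts | ++-assoc (formulaTokens G) (∨ₜ ∷ []) ts
            | go F (formulaTokens G ++ ∨ₜ ∷ ts) | go G (∨ₜ ∷ ts) | end ∨ₜ ts refl
            | ++-assoc (formulaTokens (rename {ms′ = ms′} ρ F)) (formulaTokens (rename {ms′ = ms′} ρ G) ++ ∨ₜ ∷ []) (run between ts)
            | ++-assoc (formulaTokens (rename {ms′ = ms′} ρ G)) (∨ₜ ∷ []) (run between ts) = refl

-- Only block 0 needs room for the new variable. All blocks grow, because the rewriting of the
-- formula then treats all variables alike; the spare bits of the other blocks are read by no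
-- formula.
widen : Token → Pieces
widen comma = tok stroke ∷ tok comma ∷ []
widen t     = tok t ∷ []

shifting : Phase → Token → Pieces
shifting _ comma = tok comma ∷ tok stroke ∷ []
shifting _ t     = tok t ∷ []

-- Dropping the first stroke of a block index lowers it by one. A comma met while still `between`
-- belongs to block 0, which stays where it is; for later blocks the position moves by N + 1, past
-- the spare bit and the first track.
retracking : Phase → Token → Pieces
retracking between stroke = []
retracking inBlock comma  = tok comma ∷ tok stroke ∷ rep total ∷ []
retracking _       comma  = tok comma ∷ tok stroke ∷ []
retracking _       t      = tok t ∷ []

nothingₕ : Token → Pieces
nothingₕ _ = []

shift-var : ∀ {n} → Renaming n n
shift-var i k = i , suc k

-- Block i + 1 goes to the second track of block i.
retrack-var : ∀ {n} → ℕ → Renaming (suc n) (suc n)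
retrack-var N zero    k = zero , suc k
retrack-var N (suc i) k = inject₁ i , suc (N + k)

headerRun-nothing : ∀ onFormula ν ts → headerRun nothingₕ onFormula ν ts ≡ []
headerRun-nothing onFormula ν []       = refl
headerRun-nothing onFormula ν (t ∷ ts) = headerRun-nothing onFormula ν ts

headerRun-widen : ∀ onFormula ν {n} (ms : Vec ℕ n) → headerRun widen onFormula ν (blockTokens ms) ≡ blockTokens (Vec.map suc ms)
headerRun-widen onFormula ν []       = refl
headerRun-widen onFormula ν (m ∷ ms) = strokes (suc m)
  where
  strokes : ∀ k → headerRun widen onFormula ν (replicate k stroke ++ comma ∷ blockTokens ms)
                    ≡ replicate (suc k) stroke ++ comma ∷ blockTokens (Vec.map suc ms)
  strokes zero    = cong (λ ts → stroke ∷ comma ∷ ts) (headerRun-widen onFormula ν ms)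
  strokes (suc k) = cong (stroke ∷_) (strokes k)

formulaRun-noheader : ∀ h onFormula ν p ts → formulaRun h onFormula ν p ts ≡ formulaRun nothingₕ onFormula ν p ts
formulaRun-noheader h onFormula ν p []       = refl
formulaRun-noheader h onFormula ν p (t ∷ ts) = cong (_ ++_) (formulaRun-noheader h onFormula ν (nextPhase p t) ts)

position-strokes : ∀ onFormula ν → (∀ t → (t ≡ stroke ⊎ t ≡ #) → expand ν (onFormula inPosition t) ≡ t ∷ []) →
  ∀ k ts → formulaRun nothingₕ onFormula ν inPosition ((replicate k stroke ++ # ∷ []) ++ ts)
    ≡ replicate k stroke ++ # ∷ formulaRun nothingₕ onFormula ν between ts
position-strokes onFormula ν copies zero    ts rewrite copies # (inj₂ refl) = refl
position-strokes onFormula ν copies (suc k) ts rewrite copies stroke (inj₁ refl) =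
  cong (stroke ∷_) (position-strokes onFormula ν copies k ts)

module _ (ν : Counter → ℕ) where

  shifting-formula : ∀ {n} {ms ms′ : Vec ℕ n} → Within ms ms′ shift-var → ∀ (F : Formula ms) ts →
    formulaRun nothingₕ shifting ν between (formulaTokens F ++ ts)
      ≡ formulaTokens (rename {ms′ = ms′} shift-var F) ++ formulaRun nothingₕ shifting ν between ts
  shifting-formula within = formulaRun-rename shifting ν shift-var within copies (λ i k ts → vars (toℕ i) k ts)
    where
    copies : ∀ t → nextPhase between t ≡ between → expand ν (shifting between t) ≡ t ∷ []
    copies #  _ = refl
    copies ⊥ₜ _ = refl
    copies ⊤ₜ _ = refl
    copies ¬ₜ _ = refl
    copies ∧ₜ _ = refl
    copies ∨ₜ _ = refl
    run = formulaRun nothingₕ shifting ν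
    in-position : ∀ k ts → run inPosition ((replicate k stroke ++ # ∷ []) ++ ts) ≡ (replicate k stroke ++ # ∷ []) ++ run between ts
    in-position k ts = trans (position-strokes shifting ν (λ { _ (inj₁ refl) → refl ; _ (inj₂ refl) → refl }) k ts)
                             (sym (++-assoc (replicate k stroke) (# ∷ []) (run between ts)))
    in-block : ∀ i k ts → run inBlock (varTokens i k ++ ts) ≡ varTokens i (suc k) ++ run between ts
    in-block zero    k ts = cong (λ ts → comma ∷ stroke ∷ ts) (in-position k ts)
    in-block (suc i) k ts = cong (stroke ∷_) (in-block i k ts)
    vars : ∀ i k ts → run between (varTokens i k ++ ts) ≡ varTokens i (suc k) ++ run between ts
    vars zero    k ts = cong (λ ts → comma ∷ stroke ∷ ts) (in-position k ts)
    vars (suc i) k ts = cong (stroke ∷_) (in-block i k ts)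

  retracking-formula : ∀ {n} {ms ms′ : Vec ℕ (suc n)} → Within ms ms′ (retrack-var (ν total)) → ∀ (F : Formula ms) ts →
    formulaRun nothingₕ retracking ν between (formulaTokens F ++ ts)
      ≡ formulaTokens (rename {ms′ = ms′} (retrack-var (ν total)) F) ++ formulaRun nothingₕ retracking ν between ts
  retracking-formula within = formulaRun-rename retracking ν (retrack-var (ν total)) within copies vars
    where
    copies : ∀ t → nextPhase between t ≡ between → expand ν (retracking between t) ≡ t ∷ []
    copies #  _ = refl
    copies ⊥ₜ _ = refl
    copies ⊤ₜ _ = refl
    copies ¬ₜ _ = refl
    copies ∧ₜ _ = refl
    copies ∨ₜ _ = refl
    run = formulaRun nothingₕ retracking ν
    in-position : ∀ k ts → run inPosition ((replicate k stroke ++ # ∷ []) ++ ts) ≡ (replicate k stroke ++ # ∷ []) ++ run between ts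
    in-position k ts = trans (position-strokes retracking ν (λ { _ (inj₁ refl) → refl ; _ (inj₂ refl) → refl }) k ts)
                             (sym (++-assoc (replicate k stroke) (# ∷ []) (run between ts)))
    in-block : ∀ i k ts → run inBlock (varTokens i k ++ ts) ≡ varTokens i (suc (ν total + k)) ++ run between ts
    in-block zero    k ts = cong (λ ts → comma ∷ stroke ∷ ts) (trans
      (cong₂ _++_ (++-identityʳ (replicate (ν total) stroke)) (in-position k ts)) (gather (ν total) k _))
      where
      gather : ∀ N k us → replicate N stroke ++ (replicate k stroke ++ # ∷ []) ++ us ≡ (replicate (N + k) stroke ++ # ∷ []) ++ us
      gather zero    k us = refl
      gather (suc N) k us = cong (stroke ∷_) (gather N k us)
    in-block (suc i) k ts = cong (stroke ∷_) (in-block i k ts)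
    vars : ∀ i k ts → run between (varTokens (toℕ i) k ++ ts)
             ≡ varTokens (toℕ (proj₁ (retrack-var (ν total) i k))) (proj₂ (retrack-var (ν total) i k)) ++ run between ts
    vars zero    k ts = cong (λ ts → comma ∷ stroke ∷ ts) (in-position k ts)
    vars (suc i) k ts rewrite toℕ-inject₁ i = in-block (toℕ i) k ts

encodeTokens : List Token → List Bool
encodeTokens = concatMap bits

-- The words asked to the oracle

probePieces : Pieces
probePieces = tok comma ∷ tok # ∷ tok comma ∷ tok stroke ∷ rep index ∷ tok # ∷ tok ∧ₜ ∷
  tok comma ∷ tok # ∷ tok ¬ₜ ∷ tok comma ∷ tok stroke ∷ rep index ∷ tok # ∷ tok ¬ₜ ∷ tok ∧ₜ ∷ tok ∨ₜ ∷ tok ∧ₜ ∷ []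

literalPieces : Bool → Pieces
literalPieces true  = tok comma ∷ tok stroke ∷ rep index ∷ tok # ∷ tok ∧ₜ ∷ []
literalPieces false = tok comma ∷ tok stroke ∷ rep index ∷ tok # ∷ tok ¬ₜ ∷ tok ∧ₜ ∷ []

-- With a single block there is nothing to compare.
lessPieces : ℕ → Pieces
lessPieces zero    = []
lessPieces (suc _) =
  tok stroke ∷ tok comma ∷ tok stroke ∷ rep index ∷ tok # ∷ tok ¬ₜ ∷
  tok comma ∷ tok stroke ∷ rep total ∷ rep index ∷ tok # ∷ tok ∨ₜ ∷ tok ∧ₜ ∷
  tok stroke ∷ tok comma ∷ tok stroke ∷ rep index ∷ tok # ∷ tok ¬ₜ ∷
  tok comma ∷ tok stroke ∷ rep total ∷ rep index ∷ tok # ∷ tok ∧ₜ ∷ tok ∨ₜ ∷ []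

-- One less than the length, as in `Word`. The additional bit in front is b in block 0 and spare
-- elsewhere; it is followed by one track of N bits, or by two if there is more than one block.
blockSize : ℕ → ℕ → ℕ
blockSize zero    N = N
blockSize (suc _) N = N + N

blockPieces : ℕ → Pieces
blockPieces zero    = tok stroke ∷ rep total ∷ tok comma ∷ []
blockPieces (suc _) = tok stroke ∷ rep total ∷ rep total ∷ tok comma ∷ []

headerPieces : ℕ → Pieces
headerPieces n = concat (replicate (suc n) (blockPieces n))

expand-++ : ∀ {K : Set} (ν : K → ℕ) ps qs → expand ν (ps ++ qs) ≡ expand ν ps ++ expand ν qs
expand-++ ν []           qs = refl
expand-++ ν (tok t ∷ ps) qs = cong (t ∷_) (expand-++ ν ps qs)
expand-++ ν (rep κ ∷ ps) qs = trans (cong (replicate (ν κ) stroke ++_) (expand-++ ν ps qs))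
  (sym (++-assoc (replicate (ν κ) stroke) (expand ν ps) (expand ν qs)))

widening shiftingᵀ retrackingᵀ : ∀ n → Transducer (Mode (suc n)) Counter
widening n    = rewriting widen (λ _ _ → []) (suc n)
shiftingᵀ n   = rewriting nothingₕ shifting (suc n)
retrackingᵀ n = rewriting nothingₕ retracking (suc n)

module _ (n : ℕ) where

  private
    run : Transducer (Mode (suc n)) Counter → (Counter → ℕ) → List Bool → List Bool
    run T ν = Transducer.transduction T ν (startMode (suc n))

    spell : (Counter → ℕ) → Pieces → List Bool
    spell ν ps = encodeTokens (expand ν ps)

  probeWord : List Bool → ℕ → List Bool
  probeWord w j = run (widening n) ν w ++ run (shiftingᵀ n) ν w ++ spell ν probePieces
    where ν = tally (length w) j

  literalsWord : ℕ → List Bool → List Bool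
  literalsWord N []       = bits ⊤ₜ
  literalsWord N (c ∷ cs) = literalsWord N cs ++ spell (tally N (length cs)) (literalPieces c)

  -- In Polish notation the formula for j positions is a prefix of the one for j + 1, so the machine
  -- extends it in place by one short suffix per round. This is why the last position is the most
  -- significant.
  lessWord : ℕ → ℕ → List Bool
  lessWord N zero    = bits ⊥ₜ
  lessWord N (suc j) = lessWord N j ++ spell (tally N j) (lessPieces n)

  verdictWord : List Bool → List Bool → List Bool
  verdictWord w cs =
    spell ν (headerPieces n) ++ literalsWord N cs ++
    lessWord N (length cs) ++ spell ν (tok ¬ₜ ∷ []) ++ run (shiftingᵀ n) ν w ++
    spell ν (tok ∨ₜ ∷ tok ∧ₜ ∷ tok comma ∷ tok # ∷ []) ++
    lessWord N (length cs) ++ spell ν (tok ¬ₜ ∷ tok ∧ₜ ∷ []) ++ run (shiftingᵀ n) ν w ++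
    spell ν (tok ∧ₜ ∷ tok comma ∷ tok # ∷ tok ¬ₜ ∷ []) ++ run (retrackingᵀ n) ν w ++
    spell ν (tok ¬ₜ ∷ tok ∧ₜ ∷ tok ∨ₜ ∷ tok ∧ₜ ∷ [])
    where
    N = length w
    ν = tally N (length cs)

  -- Replies to the probes, the latest first.
  data Replies (w : List Bool) : List Bool → Set where
    []  : Replies w []
    _∷_ : ∀ {c cs} → c ∈₊ answers (UVAL (suc n)) (probeWord w (length cs)) → Replies w cs → Replies w (c ∷ cs)

-- The queries as formulas, and their encodings

module _ {n : ℕ} {ms : Vec ℕ n} where

  -- An accumulating formulaTokens: the tokens of a large formula come out without
  -- any reassociation.
  tokensOnto : Formula ms → List Token → List Token
  tokensOnto (var i j)     ts = replicate (toℕ i) stroke ++ comma ∷ replicate (toℕ j) stroke ++ # ∷ ts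
  tokensOnto (const false) ts = ⊥ₜ ∷ ts
  tokensOnto (const true)  ts = ⊤ₜ ∷ ts
  tokensOnto (neg F)       ts = tokensOnto F (¬ₜ ∷ ts)
  tokensOnto (and F G)     ts = tokensOnto F (tokensOnto G (∧ₜ ∷ ts))
  tokensOnto (or F G)      ts = tokensOnto F (tokensOnto G (∨ₜ ∷ ts))

  onto-++ : ∀ F {ts us} → ts ≡ us → tokensOnto F ts ≡ formulaTokens F ++ us
  onto-++ (var i j) {ts} refl = sym (trans (++-assoc (replicate (toℕ i) stroke) (comma ∷ replicate (toℕ j) stroke ++ # ∷ []) ts)
    (cong (λ us → replicate (toℕ i) stroke ++ comma ∷ us) (++-assoc (replicate (toℕ j) stroke) (# ∷ []) ts)))
  onto-++ (const false) refl = refl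
  onto-++ (const true)  refl = refl
  onto-++ (neg F) {ts} refl = trans (onto-++ F refl) (sym (++-assoc (formulaTokens F) (¬ₜ ∷ []) ts))
  onto-++ (and F G) {ts} refl = trans (onto-++ F (onto-++ G refl))
    (sym (trans (++-assoc (formulaTokens F) (formulaTokens G ++ ∧ₜ ∷ []) ts) (cong (formulaTokens F ++_) (++-assoc (formulaTokens G) (∧ₜ ∷ []) ts))))
  onto-++ (or F G) {ts} refl = trans (onto-++ F (onto-++ G refl))
    (sym (trans (++-assoc (formulaTokens F) (formulaTokens G ++ ∨ₜ ∷ []) ts) (cong (formulaTokens F ++_) (++-assoc (formulaTokens G) (∨ₜ ∷ []) ts))))

  formulaTokens≡ : ∀ F → formulaTokens F ≡ tokensOnto F []
  formulaTokens≡ F = sym (trans (onto-++ F refl) (++-identityʳ (formulaTokens F)))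

  v : Fin n → ℕ → Formula ms
  v i k = var i (clamp _ k)

  iff : Formula ms → Formula ms → Formula ms
  iff F G = or (and F G) (and (neg F) (neg G))

module _ {n : ℕ} {ms : Vec ℕ (suc n)} where

  -- Position 0 of block 0 is the bit b, so x_j sits at j + 1.
  candidate : ℕ → Formula ms
  candidate j = v zero (suc j)

  literal : Bool → ℕ → Formula ms
  literal c j = if c then candidate j else neg (candidate j)

  literals : List Bool → Formula ms
  literals []       = const true
  literals (c ∷ cs) = and (literals cs) (literal c (length cs))

probe : ∀ {n} {ms : Vec ℕ (suc n)} → Formula ms → ℕ → Formula (Vec.map suc ms)
probe F j = and (rename shift-var F) (iff (v zero 0) (candidate j))

-- Compares the first track of block 1 with the second track of block 0.
lessThan : ∀ {n} {ms : Vec ℕ (suc n)} → ℕ → ℕ → Formula ms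
lessThan {zero}  N j       = const false
lessThan {suc n} N zero    = const false
lessThan {suc n} N (suc j) = or (and (lessThan N j) (or (neg y) z)) (and (neg y) z)
  where
  y = v (suc zero) (suc j)
  z = v zero (suc (N + j))

-- With b = 0, the disjunction next to `literals` says that every y below z passes, and the last
-- conjunct that z itself fails, its play moved to the second track. With b = 1 no y may lie below z
-- and every y must pass. For a single block `lessThan` is false and `retrack-var` merely shifts, so
-- what remains besides `literals` is b ↔ F.
verdict : ∀ {n} {ms ms′ : Vec ℕ (suc n)} → ℕ → List Bool → Formula ms → Formula ms′
verdict {n} N cs F =
  and (and (literals cs) (or (neg y<z) (rename shift-var F)))
      (or (and (and b (neg y<z)) (rename shift-var F)) (and (neg b) (neg (rename (retrack-var N) F))))
  where
  y<z = lessThan N (length cs)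
  b = v zero 0

infixr 5 _⊕_

-- A record rather than a bare equation, so that the token lists are inferred when spellings are
-- joined by `_⊕_`.
record Spells (w : List Bool) (ts : List Token) : Set where
  constructor spells
  field spelling : w ≡ encodeTokens ts

open Spells

_⊕_ : ∀ {u w ts us} → Spells u ts → Spells w us → Spells (u ++ w) (ts ++ us)
_⊕_ {ts = ts} {us} (spells refl) (spells refl) = spells (sym (concatMap-++ bits ts us))

pieces : ∀ ν (ps : Pieces) → Spells (encodeTokens (expand ν ps)) (expand ν ps)
pieces ν ps = spells refl

respell : ∀ {w ts us} → Spells w ts → ts ≡ us → Spells w us
respell s refl = s

strokes-+ : ∀ m n (ts : List Token) → replicate m stroke ++ replicate n stroke ++ ts ≡ replicate (m + n) stroke ++ ts
strokes-+ zero    n ts = refl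
strokes-+ (suc m) n ts = cong (stroke ∷_) (strokes-+ m n ts)

module Fitting {n N : ℕ} {ms : Vec ℕ (suc n)} (fits : AllV.All (_< N) ms) where

  N≤blockSize : ∀ n → N ≤ blockSize n N
  N≤blockSize zero    = ≤-refl
  N≤blockSize (suc n) = m≤m+n N N

  within-shift : Within ms (Vec.replicate (suc n) (blockSize n N)) shift-var
  within-shift i k≤ = subst (_ ≤_) (sym (lookup-replicate i (blockSize n N)))
    (≤-trans (≤-<-trans k≤ (lookup⁺ fits i)) (N≤blockSize n))

  within-retrack : Within ms (Vec.replicate (suc n) (blockSize n N)) (retrack-var N)
  within-retrack zero    k≤ = within-shift zero k≤
  within-retrack (suc i) {k} k≤ = lemma i (≤-<-trans k≤ (lookup⁺ fits (suc i)))
    where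
    lemma : ∀ {n} (i : Fin n) → k < N → suc (N + k) ≤ lookup (Vec.replicate (suc n) (blockSize n N)) (inject₁ i)
    lemma {suc n} i k<N rewrite lookup-replicate (inject₁ i) (N + N) = ≤-trans (≤-reflexive (sym (+-suc N k))) (+-monoʳ-≤ N k<N)

module _ {n : ℕ} (ms : Vec ℕ (suc n)) (F : Formula ms) where

  private
    w : List Bool
    w = encode (ms , F)

  run-formula : ∀ onFormula ν →
    Transducer.transduction (rewriting nothingₕ onFormula (suc n)) ν (startMode (suc n)) w
      ≡ encodeTokens (formulaRun nothingₕ onFormula ν between (formulaTokens F ++ []))
  run-formula onFormula ν = trans (transduction-tokens nothingₕ onFormula ν (startMode (suc n)) (blockTokens ms ++ formulaTokens F))
    (cong encodeTokens (trans (modeRun-blocks nothingₕ onFormula ν ms (formulaTokens F))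
      (trans (cong (_++ formulaRun nothingₕ onFormula ν between (formulaTokens F)) (headerRun-nothing onFormula ν (blockTokens ms)))
             (cong (formulaRun nothingₕ onFormula ν between) (sym (++-identityʳ (formulaTokens F)))))))

  module _ {ms′ : Vec ℕ (suc n)} (ν : Counter → ℕ) where

    run-shifting : Within ms ms′ shift-var →
      Spells (Transducer.transduction (shiftingᵀ n) ν (startMode (suc n)) w) (formulaTokens (rename {ms′ = ms′} shift-var F))
    run-shifting within = spells (trans (run-formula shifting ν) (cong encodeTokens
      (trans (shifting-formula ν within F []) (++-identityʳ _))))

    run-retracking : Within ms ms′ (retrack-var (ν total)) →
      Spells (Transducer.transduction (retrackingᵀ n) ν (startMode (suc n)) w)
             (formulaTokens (rename {ms′ = ms′} (retrack-var (ν total)) F))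
    run-retracking within = spells (trans (run-formula retracking ν) (cong encodeTokens
      (trans (retracking-formula ν within F []) (++-identityʳ _))))

  run-widening : ∀ ν → Spells (Transducer.transduction (widening n) ν (startMode (suc n)) w) (blockTokens (Vec.map suc ms))
  run-widening ν = spells (trans (transduction-tokens widen (λ _ _ → []) ν (startMode (suc n)) (blockTokens ms ++ formulaTokens F))
    (cong encodeTokens (trans (modeRun-blocks widen (λ _ _ → []) ν ms (formulaTokens F))
      (trans (cong₂ _++_ (headerRun-widen (λ _ _ → []) ν ms) (silent between (formulaTokens F)))
             (++-identityʳ _)))))
    where
    silent : ∀ p ts → formulaRun widen (λ _ _ → []) ν p ts ≡ []
    silent p []       = refl
    silent p (t ∷ ts) = silent (nextPhase p t) ts

  within-map : Within ms (Vec.map suc ms) shift-var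
  within-map i k≤ = subst (_ ≤_) (sym (lookup-map i suc ms)) (s≤s k≤)

  -- For larger j the word decodes to nothing and its reply is arbitrary; `replies-recall` relies
  -- only on positions inside the first block.
  probeWord-encode : ∀ {j} → j ≤ head ms → probeWord n w j ≡ encode (Vec.map suc ms , probe F j)
  probeWord-encode {j} j≤ = (run-widening ν ⊕ respell (run-shifting ν within-map ⊕ pieces ν probePieces)
    (sym (trans (formulaTokens≡ (probe F j)) (onto-++ (rename shift-var F) tail≡)))) .spelling
    where
    ν = tally (length w) j
    tail≡ : tokensOnto (iff {ms = Vec.map suc ms} (v zero 0) (candidate j)) (∧ₜ ∷ []) ≡ expand ν probePieces
    tail≡ = lemma ms j≤
      where
      lemma : ∀ {n} (ms : Vec ℕ (suc n)) → j ≤ head ms →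
        tokensOnto (iff {ms = Vec.map suc ms} (v zero 0) (candidate j)) (∧ₜ ∷ []) ≡ expand ν probePieces
      lemma (m ∷ ms) j≤ rewrite toℕ-clamp j≤ = refl

  module _ (cs : List Bool) (cs≤ : length cs ≤ length w) (fits : AllV.All (_< length w) ms) where

    private
      N = length w
      M = blockSize n N
      hs = Vec.replicate (suc n) M
      ν = tally N (length cs)

    open Fitting fits

    literals-encode : ∀ cs → length cs ≤ N → Spells (literalsWord n N cs) (formulaTokens (literals {ms = hs} cs))
    literals-encode []       _    = spells refl
    literals-encode (c ∷ cs) len≤ = respell (literals-encode cs (<⇒≤ len≤) ⊕ pieces (tally N (length cs)) (literalPieces c))
      (sym (trans (formulaTokens≡ (literals {ms = hs} (c ∷ cs))) (onto-++ (literals {ms = hs} cs) (last c))))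
      where
      last : ∀ c → tokensOnto (literal {ms = hs} c (length cs)) (∧ₜ ∷ []) ≡ expand (tally N (length cs)) (literalPieces c)
      last true  rewrite toℕ-clamp (≤-trans len≤ (N≤blockSize n)) = refl
      last false rewrite toℕ-clamp (≤-trans len≤ (N≤blockSize n)) = refl

    less-encode : ∀ n j → j ≤ N →
      Spells (lessWord n N j) (formulaTokens (lessThan {ms = Vec.replicate (suc n) (blockSize n N)} N j))
    less-encode zero    zero    _   = spells refl
    less-encode zero    (suc j) j<N = respell (less-encode zero j (<⇒≤ j<N) ⊕ pieces (tally N j) []) refl
    less-encode (suc n) zero    _   = spells refl
    less-encode (suc n) (suc j) j<N = respell (less-encode (suc n) j (<⇒≤ j<N) ⊕ pieces (tally N j) (lessPieces (suc n)))
      (sym (trans (formulaTokens≡ (lessThan {suc n} {hs′} N (suc j))) (onto-++ (lessThan {ms = hs′} N j) last)))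
      where
      hs′ = Vec.replicate (suc (suc n)) (N + N)
      y z : Formula hs′
      y = v (suc zero) (suc j)
      z = v zero (suc (N + j))
      last : tokensOnto (or (neg y) z) (∧ₜ ∷ tokensOnto (and (neg y) z) (∨ₜ ∷ [])) ≡ expand (tally N j) (lessPieces (suc n))
      last rewrite toℕ-clamp {N + N} {suc j} (≤-trans j<N (m≤m+n N N))
                 | toℕ-clamp {N + N} {suc (N + j)} (≤-trans (≤-reflexive (sym (+-suc N j))) (+-monoʳ-≤ N j<N))
                 | strokes-+ N j (# ∷ ∧ₜ ∷ ∨ₜ ∷ [])
                 | strokes-+ N j (# ∷ ∨ₜ ∷ ∧ₜ ∷ stroke ∷ comma ∷ stroke ∷ replicate j stroke ++
                     # ∷ ¬ₜ ∷ comma ∷ stroke ∷ replicate (N + j) stroke ++ # ∷ ∧ₜ ∷ ∨ₜ ∷ []) = refl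

    header-encode : expand ν (headerPieces n) ≡ blockTokens hs
    header-encode = blocks (suc n)
      where
      block≡ : ∀ n ts → expand ν (blockPieces n) ++ ts ≡ replicate (suc (blockSize n N)) stroke ++ comma ∷ ts
      block≡ zero    ts = cong (stroke ∷_) (++-assoc (replicate N stroke) (comma ∷ []) ts)
      block≡ (suc n) ts = cong (stroke ∷_) (trans (++-assoc (replicate N stroke) (replicate N stroke ++ comma ∷ []) ts)
        (trans (cong (replicate N stroke ++_) (++-assoc (replicate N stroke) (comma ∷ []) ts)) (strokes-+ N N (comma ∷ ts))))
      blocks : ∀ k → expand ν (concat (replicate k (blockPieces n))) ≡ blockTokens (Vec.replicate k M)
      blocks zero    = refl
      blocks (suc k) = trans (expand-++ ν (blockPieces n) (concat (replicate k (blockPieces n))))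
        (trans (cong (expand ν (blockPieces n) ++_) (blocks k)) (block≡ n (blockTokens (Vec.replicate k M))))

    verdictWord-encode : verdictWord n w cs ≡ encode (hs , verdict N cs F)
    verdictWord-encode = (respell (pieces ν (headerPieces n)) header-encode ⊕ respell
      (literals-encode cs cs≤ ⊕ L ⊕ pieces ν (tok ¬ₜ ∷ []) ⊕ F↑ ⊕
       pieces ν (tok ∨ₜ ∷ tok ∧ₜ ∷ tok comma ∷ tok # ∷ []) ⊕ L ⊕ pieces ν (tok ¬ₜ ∷ tok ∧ₜ ∷ []) ⊕ F↑ ⊕
       pieces ν (tok ∧ₜ ∷ tok comma ∷ tok # ∷ tok ¬ₜ ∷ []) ⊕ run-retracking {hs} ν within-retrack ⊕
       pieces ν (tok ¬ₜ ∷ tok ∧ₜ ∷ tok ∨ₜ ∷ tok ∧ₜ ∷ []))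
      (sym (trans (formulaTokens≡ (verdict {ms′ = hs} N cs F))
        (onto-++ (literals {ms = hs} cs) (onto-++ (lessThan {ms = hs} N (length cs)) (cong (¬ₜ ∷_)
          (onto-++ (rename {ms′ = hs} shift-var F) (cong (λ ts → ∨ₜ ∷ ∧ₜ ∷ comma ∷ # ∷ ts)
            (onto-++ (lessThan {ms = hs} N (length cs)) (cong (λ ts → ¬ₜ ∷ ∧ₜ ∷ ts)
              (onto-++ (rename {ms′ = hs} shift-var F) (cong (λ ts → ∧ₜ ∷ comma ∷ # ∷ ¬ₜ ∷ ts)
                (onto-++ (rename {ms′ = hs} (retrack-var N) F) refl))))))))))))) .spelling
      where
      L = less-encode n (length cs) cs≤
      F↑ = run-shifting {hs} ν within-shift

-- Values of the queried formulas

v-value : ∀ {n} {ms : Vec ℕ n} i {k} (xs : AllV.All Word ms) → k ≤ lookup ms i →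
  ⟦ v {ms = ms} i k ⟧ xs ≡ lookup⁺ xs i ‼ k
v-value i xs k≤ = trans (lookup-‼ (lookup⁺ xs i) (clamp _ _)) (cong (lookup⁺ xs i ‼_) (toℕ-clamp k≤))

rename-value : ∀ {n n′} {ms : Vec ℕ n} {ms′ : Vec ℕ n′} (ρ : Renaming n n′) → Within ms ms′ ρ →
  ∀ {xs : AllV.All Word ms} {xs′ : AllV.All Word ms′} →
  (∀ i {k} → k < suc (lookup ms i) → lookup⁺ xs′ (proj₁ (ρ i k)) ‼ proj₂ (ρ i k) ≡ lookup⁺ xs i ‼ k) →
  ∀ F → ⟦ rename {ms′ = ms′} ρ F ⟧ xs′ ≡ ⟦ F ⟧ xs
rename-value ρ within {xs} {xs′} agree (var i j) = trans
  (v-value (proj₁ (ρ i (toℕ j))) xs′ (within i (s≤s⁻¹ (toℕ<n j))))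
  (trans (agree i (toℕ<n j)) (sym (lookup-‼ (lookup⁺ xs i) j)))
rename-value ρ within agree (const b) = refl
rename-value ρ within agree (neg F)   = cong not (rename-value ρ within agree F)
rename-value ρ within agree (and F G) = cong₂ _∧_ (rename-value ρ within agree F) (rename-value ρ within agree G)
rename-value ρ within agree (or F G)  = cong₂ _∨_ (rename-value ρ within agree F) (rename-value ρ within agree G)

-- Unlike n≤1+n it reduces, so that slices computes along it.
n≤1+n′ : ∀ n → n ≤ suc n
n≤1+n′ zero    = z≤n
n≤1+n′ (suc n) = s≤s (n≤1+n′ n)

slices-‼ : ∀ s {j k M} (j≤k : j ≤ k) (ms : Vec ℕ j) (ws : AllV.All Word (Vec.replicate k M)) i {l} → l < suc (lookup ms i) →
  lookup⁺ (slices s j≤k ms ws) i ‼ l ≡ lookup⁺ ws (inject≤ i j≤k) ‼ (s + l)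
slices-‼ s (s≤s j≤k) (m ∷ ms) (w ∷ ws) zero    l< = slice-‼ s w l<
slices-‼ s (s≤s j≤k) (m ∷ ms) (w ∷ ws) (suc i) l< = slices-‼ s j≤k ms ws i l<

inject≤-inject₁ : ∀ {n} (i : Fin n) → inject≤ i (n≤1+n′ n) ≡ inject₁ i
inject≤-inject₁ zero    = refl
inject≤-inject₁ (suc i) = cong suc (inject≤-inject₁ i)

‼-index : ∀ {n} {ms : Vec ℕ n} (ws : AllV.All Word ms) {i j} k → i ≡ j → lookup⁺ ws i ‼ k ≡ lookup⁺ ws j ‼ k
‼-index ws k refl = refl

module _ {n : ℕ} {m : ℕ} {ms : Vec ℕ n} (F : Formula (m ∷ ms)) {M : ℕ} where

  private
    hs = Vec.replicate (suc n) M

  shift-value : Within (m ∷ ms) hs shift-var → ∀ Xs →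
    ⟦ rename {ms′ = hs} shift-var F ⟧ Xs ≡ ⟦ F ⟧ (slices 1 ≤-refl (m ∷ ms) Xs)
  shift-value within Xs = rename-value {ms′ = hs} shift-var within (λ i {k} k< → sym
    (trans (slices-‼ 1 ≤-refl (m ∷ ms) Xs i k<) (‼-index Xs (suc k) (inject≤-refl i ≤-refl)))) F

  retrack-value : ∀ N → Within (m ∷ ms) hs (retrack-var N) → ∀ X (ws : AllV.All Word (Vec.replicate n M)) →
    ⟦ rename {ms′ = hs} (retrack-var N) F ⟧ (X ∷ ws) ≡ ⟦ F ⟧ (slice 1 (suc m) X ∷ slices (1 + N) (n≤1+n′ n) ms (X ∷ ws))
  retrack-value N within X ws = rename-value {ms′ = hs} (retrack-var N) within
    (λ { zero    k< → sym (slice-‼ 1 X k<)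
       ; (suc i) {k} k< → sym (trans (slices-‼ (1 + N) (n≤1+n′ n) ms (X ∷ ws) i k<)
           (‼-index (X ∷ ws) (suc (N + k)) (inject≤-inject₁ i))) }) F

match : (ℕ → Bool) → List Bool → Bool
match u []       = true
match u (c ∷ cs) = match u cs ∧ (if c then u (length cs) else not (u (length cs)))

-- Replies are listed latest first, so the head answers the probe with index `length cs`.
recall : List Bool → ℕ → Bool
recall []       k = false
recall (c ∷ cs) k with k ≟ length cs
... | yes _ = c
... | no  _ = recall cs k

match-sound : ∀ u cs → match u cs ≡ true → ∀ {k} → k < length cs → u k ≡ recall cs k
match-sound u (c ∷ cs) eq {k} (s≤s k≤) with k ≟ length cs
... | no  k≢   = match-sound u cs (proj₁ (∧-elim eq)) (≤∧≢⇒< k≤ k≢)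
... | yes refl = last c (proj₂ (∧-elim {match u cs} eq))
  where
  last : ∀ c → (if c then u (length cs) else not (u (length cs))) ≡ true → u (length cs) ≡ c
  last true  eq = eq
  last false eq with u (length cs)
  ... | false = refl

match-complete : ∀ u cs → (∀ {k} → k < length cs → u k ≡ recall cs k) → match u cs ≡ true
match-complete u []       agree = refl
match-complete u (c ∷ cs) agree = ∧-intro (match-complete u cs λ {k} k< → trans (agree (m<n⇒m<1+n k<)) (older k<)) (last c newest)
  where
  older : ∀ {k} → k < length cs → recall (c ∷ cs) k ≡ recall cs k
  older {k} k< with k ≟ length cs
  ... | yes refl = contradiction k< (<-irrefl refl)
  ... | no  _    = refl
  newest : u (length cs) ≡ c
  newest with length cs ≟ length cs | agree {length cs} ≤-refl
  ... | yes _ | eq = eq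
  ... | no ≢  | _  = contradiction refl ≢
  last : ∀ c → u (length cs) ≡ c → (if c then u (length cs) else not (u (length cs))) ≡ true
  last true  eq = eq
  last false eq rewrite eq = refl

literals-value : ∀ {n M} {ms : Vec ℕ n} cs → length cs ≤ M → ∀ X (ws : AllV.All Word ms) →
  ⟦ literals {ms = M ∷ ms} cs ⟧ (X ∷ ws) ≡ match (λ k → X ‼ suc k) cs
literals-value []       _   X ws = refl
literals-value {ms = ms} (c ∷ cs) cs≤ X ws = cong₂ _∧_ (literals-value cs (<⇒≤ cs≤) X ws) (last c)
  where
  last : ∀ c → ⟦ literal {ms = _ ∷ ms} c (length cs) ⟧ (X ∷ ws) ≡ (if c then X ‼ suc (length cs) else not (X ‼ suc (length cs)))
  last true  = v-value zero (X ∷ ws) cs≤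
  last false = cong not (v-value zero (X ∷ ws) cs≤)

less-value : ∀ {n N} {ms : Vec ℕ n} j → j ≤ N → ∀ X Y (ws : AllV.All Word ms) →
  ⟦ lessThan {ms = N + N ∷ N + N ∷ ms} N j ⟧ (X ∷ Y ∷ ws) ≡ lexLess (λ k → Y ‼ suc k) (λ k → X ‼ suc (N + k)) j
less-value zero    _   X Y ws = refl
less-value {N = N} (suc j) j<N X Y ws
  rewrite less-value j (<⇒≤ j<N) X Y ws
        | v-value (suc zero) {suc j} (X ∷ Y ∷ ws) (≤-trans j<N (m≤m+n N N))
        | v-value zero {suc (N + j)} (X ∷ Y ∷ ws) (≤-trans (≤-reflexive (sym (+-suc N j))) (+-monoʳ-≤ N j<N)) = refl

lexLess-cong : ∀ {u u′ t t′ : ℕ → Bool} j → (∀ {k} → k < j → u k ≡ u′ k) → (∀ {k} → k < j → t k ≡ t′ k) →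
  lexLess u t j ≡ lexLess u′ t′ j
lexLess-cong zero    u≗ t≗ = refl
lexLess-cong (suc j) u≗ t≗ rewrite lexLess-cong j (u≗ ∘ m<n⇒m<1+n) (t≗ ∘ m<n⇒m<1+n) | u≗ {j} ≤-refl | t≗ {j} ≤-refl = refl

-- What the probes reveal

answers-UVAL : ∀ {n m} {ms : Vec ℕ n} (F : Formula (m ∷ ms)) → answers (UVAL (suc n)) (encode (m ∷ ms , F)) ≡ uval ⟦ F ⟧
answers-UVAL {n} {m} {ms} F rewrite decode-encode (m ∷ ms , F) = refl

answers-USAT : ∀ {n m} {ms : Vec ℕ n} (F : Formula (m ∷ ms)) → answers (USAT (suc n)) (encode (m ∷ ms , F)) ≡ usat ⟦ F ⟧
answers-USAT {n} {m} {ms} F rewrite decode-encode (m ∷ ms , F) = refl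

module _ {n m} {ms : Vec ℕ n} (f : Fun (m ∷ ms)) where

  uval-unique : ∀ {x} → solutions f ≡ x ∷ [] → uval f ≡ only (π₁ x)
  uval-unique eq rewrite eq = refl

  uval-intro : ∀ {y} → (∀ {x} → solutions f ≡ x ∷ [] → y ≡ π₁ x) → y ∈₊ uval f
  uval-intro h with solutions f
  ... | []        = tt
  ... | x ∷ []    = h refl
  ... | _ ∷ _ ∷ _ = tt

  usat-promised : (length (solutions f) ≤ᵇ 1) ≡ true → usat f ≡ only (sat f)
  usat-promised eq rewrite eq = refl

  usat-intro : ∀ {y} → ((length (solutions f) ≤ᵇ 1) ≡ true → y ≡ sat f) → y ∈₊ usat f
  usat-intro h with length (solutions f) ≤ᵇ 1
  ... | true  = h refl
  ... | false = tt

tails : ∀ {n} (ms : Vec ℕ n) → AllV.All Word (Vec.map suc ms) → AllV.All Word ms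
tails []       []       = []
tails (m ∷ ms) (w ∷ ws) = slice 1 (suc m) w ∷ tails ms ws

tails-‼ : ∀ {n} (ms : Vec ℕ n) ws i {k} → k < suc (lookup ms i) → lookup⁺ ws i ‼ suc k ≡ lookup⁺ (tails ms ws) i ‼ k
tails-‼ (m ∷ ms) (w ∷ ws) zero    k< = sym (slice-‼ 1 w k<)
tails-‼ (m ∷ ms) (w ∷ ws) (suc i) k< = tails-‼ ms ws i k<

slice-tail : ∀ {l} b (x : Vec Bool l) → slice 1 l (b ∷ x) ≡ x
slice-tail b x = ‼-ext (slice-‼ 1 (b ∷ x))

mutual
  -- `f` ignores the bits added in front, so quantifying over them is void; `b` is a condition that
  -- block 0 has already settled.
  sat-tails : ∀ {n} (ms : Vec ℕ n) (f : Fun ms) b → sat {ms = Vec.map suc ms} (λ ws → f (tails ms ws) ∧ b) ≡ sat f ∧ b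
  sat-tails []       f b = refl
  sat-tails (m ∷ ms) f b = trans (any-cong (λ w → co-sat-tails ms (f at slice 1 (suc m) w) b) (words (suc m)))
    (some-∧-const (slice 1 (suc m)) (λ y → false ∷ y , slice-tail false y) (λ y → co-sat (f at y)) b)

  co-sat-tails : ∀ {n} (ms : Vec ℕ n) (f : Fun ms) b → co-sat {ms = Vec.map suc ms} (λ ws → f (tails ms ws) ∧ b) ≡ co-sat f ∧ b
  co-sat-tails []       f b = refl
  co-sat-tails (m ∷ ms) f b = trans (all-cong (λ w → sat-tails ms (f at slice 1 (suc m) w) b) (words (suc m)))
    (every-∧-const (slice 1 (suc m)) (λ y → false ∷ y , slice-tail false y) (λ y → sat (f at y)) b)

module _ {n m} {ms : Vec ℕ n} (F : Formula (m ∷ ms)) where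

  agreeing : Bool → Bool → Bool
  agreeing a b = (a ∧ b) ∨ (not a ∧ not b)

  probe-value : ∀ {j} → j ≤ m → ∀ b x →
    co-sat (⟦ probe F j ⟧ at (b ∷ x)) ≡ co-sat (⟦ F ⟧ at x) ∧ agreeing b (x ‼ j)
  probe-value {j} j≤m b x = trans
    (co-sat-cong (λ ws → cong₂ _∧_
      (trans (rename-value {ms′ = Vec.map suc (m ∷ ms)} shift-var within (λ i k< → tails-‼ (m ∷ ms) ((b ∷ x) ∷ ws) i k<) F)
             (cong (λ x → ⟦ F ⟧ (x ∷ tails ms ws)) (slice-tail b x)))
      (cong (agreeing b) (v-value zero {suc j} ((b ∷ x) ∷ ws) (s≤s j≤m)))))
    (co-sat-tails ms (⟦ F ⟧ at x) (agreeing b (x ‼ j)))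
    where
    within : Within (m ∷ ms) (Vec.map suc (m ∷ ms)) shift-var
    within i k≤ = subst (_ ≤_) (sym (lookup-map i suc (m ∷ ms))) (s≤s k≤)

  -- The solution of F extends to a solution of the probe by exactly one choice of the new bit,
  -- namely x_j, and nothing else solves the probe.
  probe-answer : ∀ {j x} → j ≤ m → solutions ⟦ F ⟧ ≡ x ∷ [] → uval ⟦ probe F j ⟧ ≡ only (x ‼ j)
  probe-answer {j} {x} j≤m eq = uval-unique ⟦ probe F j ⟧ {(x ‼ j) ∷ x}
    (filter-singleton (λ X → co-sat (⟦ probe F j ⟧ at X))
      (trans (probe-value j≤m (x ‼ j) x) (∧-intro fx (agreeing-refl (x ‼ j))))
      (λ { (b ∷ y) sol → let fy , b~ = ∧-elim (trans (sym (probe-value j≤m b y)) sol)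
                             y≡x = x-unique y fy in
             cong₂ _∷_ (trans (agreeing⇒≡ b (y ‼ j) b~) (cong (_‼ j) y≡x)) y≡x }))
    where
    fx = proj₁ (singleton-filter (λ x → co-sat (⟦ F ⟧ at x)) eq)
    x-unique = proj₂ (singleton-filter (λ x → co-sat (⟦ F ⟧ at x)) eq)
    agreeing-refl : ∀ a → agreeing a a ≡ true
    agreeing-refl true  = refl
    agreeing-refl false = refl
    agreeing⇒≡ : ∀ a b → agreeing a b ≡ true → a ≡ b
    agreeing⇒≡ true  true  _ = refl
    agreeing⇒≡ false false _ = refl

  -- A unique solution of F puts every probe of a position in the first block inside the promise,
  -- where the oracle has no choice.
  replies-recall : ∀ {cs x} → Replies n (encode (m ∷ ms , F)) cs → solutions ⟦ F ⟧ ≡ x ∷ [] →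
    ∀ {k} → k < length cs → k ≤ m → recall cs k ≡ x ‼ k
  replies-recall {c ∷ cs} (c∈ ∷ rs) eq {k} (s≤s k≤) k≤m with k ≟ length cs
  ... | no  k≢   = replies-recall rs eq (≤∧≢⇒< k≤ k≢) k≤m
  ... | yes refl = subst (c ∈₊_) (trans (cong (answers (UVAL (suc n))) (probeWord-encode (m ∷ ms) F k≤m))
                     (trans (answers-UVAL (probe F (length cs))) (probe-answer k≤m eq))) c∈

-- The last query has exactly one solution

slice-slice : ∀ {l} s {m N} (x : Vec Bool l) → m ≤ N → slice 0 m (slice s N x) ≡ slice s m x
slice-slice s {m} {N} x m≤N = ‼-ext λ k<m →
  trans (slice-‼ 0 (slice s N x) k<m) (trans (slice-‼ s x (≤-trans k<m m≤N)) (sym (slice-‼ s x k<m)))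

slice-pad : ∀ {m N} (x : Vec Bool m) → m ≤ N → slice 0 m (slice 0 N x) ≡ x
slice-pad x m≤N = trans (slice-slice 0 x m≤N) (‼-ext (slice-‼ 0 x))

-- Blocks 0 and 1 have fixed `e`, `b` and `l`. For each of their values the body is a constant or
-- `g`, so they leave the scope of the remaining quantifiers.
sat-case : ∀ {n} {ms : Vec ℕ n} e b l (g : Fun ms) →
  sat (λ ys → e ∧ (if b then not l ∧ g ys else not l ∨ g ys)) ≡ e ∧ (if b then not l ∧ sat g else not l ∨ sat g)
sat-case {ms = ms} false b     l     g = sat-const ms false
sat-case           true  true  false g = refl
sat-case {ms = ms} true  true  true  g = sat-const ms false
sat-case {ms = ms} true  false false g = sat-const ms true
sat-case           true  false true  g = refl

co-sat-or-not : ∀ {n} {ms : Vec ℕ n} b (g : Fun ms) → co-sat (λ us → b ∨ not (g us)) ≡ b ∨ not (sat g)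
co-sat-or-not {ms = ms} true  g = co-sat-const ms true
co-sat-or-not           false g = co-sat-dual g

module _ {n m N₀ : ℕ} {ms : Vec ℕ n} (F : Formula (m ∷ ms)) (cs : List Bool) (len : length cs ≡ suc N₀)
         (fits : AllV.All (_< suc N₀) (m ∷ ms)) where

  private
    N = suc N₀
    f = ⟦ F ⟧

  guess : Word m
  guess = tabulate (recall cs ∘ toℕ)

  matches : ∀ {l} → Vec Bool l → Bool
  matches X = match (λ k → X ‼ suc k) cs

  matches⇒ : ∀ {l} (X : Vec Bool l) → matches X ≡ true → slice 1 (suc m) X ≡ guess
  matches⇒ X eq = ‼-ext λ k< → trans (slice-‼ 1 X k<)
    (trans (match-sound _ cs eq (subst (_ <_) (sym len) (≤-trans k< (AllV.head fits)))) (sym (tabulate-‼ (recall cs) k<)))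

  -- All N replies, not only those for the first block of F: the rest of the track must be pinned as
  -- well, or the last query would have several solutions.
  full : Vec Bool N
  full = tabulate (recall cs ∘ toℕ)

  matches-full : ∀ {l} (X : Vec Bool l) → slice 1 N X ≡ full → matches X ≡ true
  matches-full X eq = match-complete _ cs λ {k} k< → let k<N = subst (_ <_) len k< in
    trans (sym (slice-‼ 1 X k<N)) (trans (cong (_‼ k) eq) (tabulate-‼ (recall cs) k<N))

  full-matches : ∀ {l} (X : Vec Bool l) → matches X ≡ true → slice 1 N X ≡ full
  full-matches X eq = ‼-ext λ k< → trans (slice-‼ 1 X k<)
    (trans (match-sound _ cs eq (subst (_ <_) (sym len) k<)) (sym (tabulate-‼ (recall cs) k<)))

module SingleBlock {m N₀ : ℕ} (F : Formula (m ∷ [])) (cs : List Bool) (len : length cs ≡ suc N₀)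
         (fits : AllV.All (_< suc N₀) (m ∷ [])) where

  private
    N = suc N₀
    f = ⟦ F ⟧
    V : Formula (N ∷ [])
    V = verdict N cs F
    γ = f (guess F cs len fits ∷ [])

  open Fitting fits

  verdict-value : ∀ b X → let e = matches F cs len fits (b ∷ X); a = f (slice 1 (suc m) (b ∷ X) ∷ []) in
    co-sat (⟦ V ⟧ at (b ∷ X)) ≡ (e ∧ (true ∨ a)) ∧ (((b ∧ true) ∧ a) ∨ (not b ∧ not a))
  verdict-value b X
    rewrite literals-value cs (≤-reflexive len) (b ∷ X) []
          | shift-value F within-shift ((b ∷ X) ∷ [])
          | retrack-value F N within-retrack (b ∷ X) [] = refl

  verdict-unique : ∃[ X ] solutions ⟦ V ⟧ ≡ X ∷ [] × π₁ X ≡ γ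
  verdict-unique = γ ∷ full F cs len fits , filter-singleton _ solves unique , refl
    where
    X = γ ∷ full F cs len fits
    e≡ = matches-full F cs len fits X (slice-tail γ (full F cs len fits))
    sound : ∀ e a b → (e ∧ (true ∨ a)) ∧ (((b ∧ true) ∧ a) ∨ (not b ∧ not a)) ≡ true → e ≡ true × b ≡ a
    sound true true  true  _ = refl , refl
    sound true false false _ = refl , refl
    complete : ∀ a → (true ∧ (true ∨ a)) ∧ (((a ∧ true) ∧ a) ∨ (not a ∧ not a)) ≡ true
    complete true  = refl
    complete false = refl
    solves : co-sat (⟦ V ⟧ at X) ≡ true
    solves rewrite verdict-value γ (full F cs len fits) | e≡ | matches⇒ F cs len fits X e≡ = complete γ
    unique : ∀ Y → co-sat (⟦ V ⟧ at Y) ≡ true → Y ≡ X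
    unique (b ∷ Y) sol with sound _ _ b (trans (sym (verdict-value b Y)) sol)
    ... | e , b≡ = cong₂ _∷_ (trans b≡ (cong (λ x → f (x ∷ [])) (matches⇒ F cs len fits (b ∷ Y) e)))
                     (trans (sym (slice-tail b Y)) (full-matches F cs len fits (b ∷ Y) e))

module SeveralBlocks {n m m₁ N₀ : ℕ} {ms : Vec ℕ n} (F : Formula (m ∷ m₁ ∷ ms)) (cs : List Bool) (len : length cs ≡ suc N₀)
         (fits : AllV.All (_< suc N₀) (m ∷ m₁ ∷ ms)) where

  private
    N = suc N₀
    f = ⟦ F ⟧
    hs = Vec.replicate (suc (suc n)) (N + N)
    V : Formula hs
    V = verdict N cs F
    m₁<N : m₁ < N
    m₁<N = AllV.head (AllV.tail fits)

  open Fitting fits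
  open Tracks N

  -- N bits stand for block 1 of F through their initial segment. That several y stand for the same
  -- word is harmless: the universal quantifier does not notice, and `Least` still picks a single
  -- one.
  branch : Word m → Vec Bool N → Bool
  branch x y = sat (f at x at slice 0 (suc m₁) y)

  module _ (b : Bool) (X : Vec Bool (N + N)) where
    private
      x = slice 1 (suc m) (b ∷ X)
      z = slice (1 + N) N (b ∷ X)
      e = matches F cs len fits (b ∷ X)

    combine : Bool → Bool → Bool
    combine l a = if b then not l ∧ a else not l ∨ a

    -- Block 1 enters with all N bits of its track, hence the entry `N₀`: y is compared with z over
    -- the whole track and not only over the bits that F reads.
    A : Fun (N₀ ∷ ms)
    A (y ∷ ys) = e ∧ combine (lessW y z) (f (x ∷ slice 0 (suc m₁) y ∷ ys))

    B : Fun ms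
    B us = b ∨ not (f (x ∷ slice 0 (suc m₁) z ∷ us))

    L≡ : ∀ (Y : Word (N + N)) → lexLess (λ k → Y ‼ suc k) (λ k → (b ∷ X) ‼ suc (N + k)) (length cs) ≡ lessW (slice 1 N Y) z
    L≡ Y rewrite len = lexLess-cong N (λ k< → sym (slice-‼ 1 Y k<)) (λ k< → sym (slice-‼ (1 + N) (b ∷ X) k<))

    -- Sorts the verdict by tracks. The propositional identity is checked in `table`: b = 1 asks
    -- nothing of the second track, b = 0 asks it to refute F at z.
    V≡A∧B : ∀ ws → ⟦ V ⟧ ((b ∷ X) ∷ ws) ≡ A (slices 1 ≤-refl (N₀ ∷ ms) ws) ∧ B (slices (1 + N) (n≤1+n′ n) ms ws)
    V≡A∧B (Y ∷ ws)
      rewrite literals-value cs (≤-trans (≤-reflexive len) (m≤m+n N N)) (b ∷ X) (Y ∷ ws)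
            | less-value {N = N} (length cs) (≤-reflexive len) (b ∷ X) Y ws
            | shift-value F within-shift ((b ∷ X) ∷ Y ∷ ws)
            | retrack-value F N within-retrack (b ∷ X) (Y ∷ ws)
            | slice-slice 1 Y m₁<N
            | slice-slice (1 + N) (b ∷ X) m₁<N
            | L≡ Y = table b e (lessW (slice 1 N Y) z) _ _
      where
      table : ∀ b e l a a′ → (e ∧ (not l ∨ a)) ∧ (((b ∧ not l) ∧ a) ∨ (not b ∧ not a′)) ≡
                (e ∧ (if b then not l ∧ a else not l ∨ a)) ∧ (b ∨ not a′)
      table true  false l     a     a′ = refl
      table true  true  true  true  a′ = refl
      table true  true  true  false a′ = refl
      table true  true  false true  a′ = refl
      table true  true  false false a′ = refl
      table false e     l     a     a′ = refl

    verdict-value : co-sat (⟦ V ⟧ at (b ∷ X)) ≡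
      everyW (λ y → e ∧ combine (lessW y z) (branch x y)) ∧ (b ∨ not (branch x z))
    verdict-value = trans (co-sat-cong V≡A∧B)
      (trans (co-sat-∧ (n≤1+n′ n) (N₀ ∷ ms) ms (≤-refl ∷ AllV.tail (AllV.tail fits)) (AllV.tail (AllV.tail fits)) A B)
        (cong₂ _∧_ (all-cong (λ y → sat-case e b (lessW y z) (f at x at slice 0 (suc m₁) y)) (words N₀))
                   (co-sat-or-not b (f at x at slice 0 (suc m₁) z))))

  private
    g = guess F cs len fits
    γ = co-sat (f at g)

  γ≡ : γ ≡ everyW (branch g)
  γ≡ = Bool-ext
    (λ eq → all-intro _ (words N₀) λ y → all-elim _ eq (∈-bitVectors (slice 0 (suc m₁) y)))
    (λ eq → all-intro _ (words m₁) λ y → trans (cong (λ y → sat (f at g at y)) (sym (slice-pad y m₁<N)))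
              (all-elim (branch g) eq (∈-bitVectors (slice 0 N y))))

  tracks-ext : ∀ {b} {X Y : Vec Bool (N + N)} → first N (b ∷ X) ≡ first N (b ∷ Y) → second N (b ∷ X) ≡ second N (b ∷ Y) → X ≡ Y
  tracks-ext {b} {X} {Y} eq₁ eq₂ = ‼-ext agree
    where
    agree : ∀ {k} → k < N + N → X ‼ k ≡ Y ‼ k
    agree {k} k< with k <? N
    ... | yes k<N = trans (sym (slice-‼ 1 (b ∷ X) k<N)) (trans (cong (_‼ k) eq₁) (slice-‼ 1 (b ∷ Y) k<N))
    ... | no  k≮N = subst (λ k → X ‼ k ≡ Y ‼ k) (m+[n∸m]≡n (≮⇒≥ k≮N))
      (trans (sym (slice-‼ (1 + N) (b ∷ X) r<)) (trans (cong (_‼ (k ∸ N)) eq₂) (slice-‼ (1 + N) (b ∷ Y) r<)))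
      where
      r< : k ∸ N < N
      r< = +-cancelˡ-< N _ _ (subst (_< N + N) (sym (m+[n∸m]≡n (≮⇒≥ k≮N))) k<)

  -- Shared by both verdicts: `P` is constantly true for b = 1 and singles out the refuting words
  -- for b = 0. The bit b, the first track and z are all forced, and together they are the whole of
  -- block 0.
  verdict-unique′ : ∀ b (P : Vec Bool N → Bool) z₀ → Least P z₀ →
    (∀ b′ z → (everyW (λ y → if b′ then not (lessW y z) ∧ branch g y else not (lessW y z) ∨ branch g y)
                 ∧ (b′ ∨ not (branch g z))) ≡ true → b′ ≡ b × Least P z) →
    (∀ z → Least P z → (everyW (λ y → if b then not (lessW y z) ∧ branch g y else not (lessW y z) ∨ branch g y)
                 ∧ (b ∨ not (branch g z))) ≡ true) →
    ∃[ X ] solutions ⟦ V ⟧ ≡ X ∷ [] × π₁ X ≡ b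
  verdict-unique′ b P z₀ least sound complete = join b (full F cs len fits) z₀ , filter-singleton _ solves unique , refl
    where
    X = join b (full F cs len fits) z₀
    first≡ : first N X ≡ full F cs len fits
    first≡ = first-join b (full F cs len fits) z₀ ≤-refl
    second≡ : second N X ≡ z₀
    second≡ = second-join b (full F cs len fits) z₀ ≤-refl
    e≡ = matches-full F cs len fits X first≡
    solves : co-sat (⟦ V ⟧ at X) ≡ true
    solves = trans (verdict-value b (Vec.tail X)) (subst₃ e≡ (matches⇒ F cs len fits X e≡) second≡ (complete z₀ least))
      where
      subst₃ : ∀ {e x z} → e ≡ true → x ≡ g → z ≡ z₀ →
        (everyW (λ y → if b then not (lessW y z₀) ∧ branch g y else not (lessW y z₀) ∨ branch g y) ∧ (b ∨ not (branch g z₀))) ≡ true →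
        (everyW (λ y → e ∧ (if b then not (lessW y z) ∧ branch x y else not (lessW y z) ∨ branch x y)) ∧ (b ∨ not (branch x z))) ≡ true
      subst₃ refl refl refl h = h
    unique : ∀ Y → co-sat (⟦ V ⟧ at Y) ≡ true → Y ≡ X
    unique (b′ ∷ Y) sol = conclude (sound b′ z (unpack e x≡ holds))
      where
      z = second N (b′ ∷ Y)
      holds = trans (sym (verdict-value b′ Y)) sol
      e : matches F cs len fits (b′ ∷ Y) ≡ true
      e = proj₁ (∧-elim {matches F cs len fits (b′ ∷ Y)} (all-elim _ (proj₁ (∧-elim holds)) (∈-bitVectors z)))
      x≡ = matches⇒ F cs len fits (b′ ∷ Y) e
      unpack : ∀ {e x} → e ≡ true → x ≡ g →
        (everyW (λ y → e ∧ (if b′ then not (lessW y z) ∧ branch x y else not (lessW y z) ∨ branch x y)) ∧ (b′ ∨ not (branch x z))) ≡ true →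
        (everyW (λ y → if b′ then not (lessW y z) ∧ branch g y else not (lessW y z) ∨ branch g y) ∧ (b′ ∨ not (branch g z))) ≡ true
      unpack refl refl h = h
      conclude : b′ ≡ b × Least P z → b′ ∷ Y ≡ X
      conclude (refl , least′) = cong (b ∷_) (tracks-ext {b}
        (trans (full-matches F cs len fits (b ∷ Y) e) (sym first≡))
        (trans (least-unique {P = P} least′ least) (sym second≡)))

  verdict-unique : ∃[ X ] solutions ⟦ V ⟧ ≡ X ∷ [] × π₁ X ≡ γ
  verdict-unique with everyW (branch g) in eq
  ... | true  = let z₀ , least = least-exists (λ _ → true) (Vec.replicate N true) refl
                    X , sols , X≡ = verdict-unique′ true (λ _ → true) z₀ least sound complete in
                X , sols , trans X≡ (sym (trans γ≡ eq))
    where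
    holds : ∀ y → branch g y ≡ true
    holds y = all-elim (branch g) eq (∈-bitVectors y)
    sound : ∀ b z → (everyW (λ y → if b then not (lessW y z) ∧ branch g y else not (lessW y z) ∨ branch g y)
                 ∧ (b ∨ not (branch g z))) ≡ true → b ≡ true × Least (λ _ → true) z
    sound true z h = refl , refl , λ y y<z → contradiction
      (trans (sym (cong not y<z)) (proj₁ (∧-elim (all-elim _ (proj₁ (∧-elim h)) (∈-bitVectors y))))) λ ()
    sound false z h with () ← trans (sym (cong not (holds z))) (proj₂ (∧-elim {everyW (λ y → not (lessW y z) ∨ branch g y)} h))
    complete : ∀ z → Least (λ _ → true) z → everyW (λ y → not (lessW y z) ∧ branch g y) ∧ true ≡ true
    complete z (_ , least) = ∧-intro (all-intro _ (words N₀) λ y → ∧-intro (not-less y) (holds y)) refl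
      where
      not-less : ∀ y → not (lessW y z) ≡ true
      not-less y with lessW y z in y<z
      ... | true  with () ← least y y<z
      ... | false = refl
  ... | false = let w , ¬w = any-elim (not ∘ branch g) (words N₀) (trans (any-dual (branch g) (words N₀)) (cong not eq))
                    z₀ , least = least-exists (not ∘ branch g) w ¬w
                    X , sols , X≡ = verdict-unique′ false (not ∘ branch g) z₀ least sound complete in
                X , sols , trans X≡ (sym (trans γ≡ eq))
    where
    sound : ∀ b z → (everyW (λ y → if b then not (lessW y z) ∧ branch g y else not (lessW y z) ∨ branch g y)
                 ∧ (b ∨ not (branch g z))) ≡ true → b ≡ false × Least (not ∘ branch g) z
    -- The bit 1 would make every branch succeed, against the case at hand.
    sound true z h with () ← trans (sym eq) (all-intro (branch g) (words N₀) λ y →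
      proj₂ (∧-elim {not (lessW y z)} (all-elim _ (proj₁ (∧-elim h)) (∈-bitVectors y))))
    sound false z h = refl , proj₂ (∧-elim {everyW (λ y → not (lessW y z) ∨ branch g y)} h) , λ y y<z →
      cong not (trans (sym (cong (λ l → not l ∨ branch g y) y<z)) (all-elim _ (proj₁ (∧-elim h)) (∈-bitVectors y)))
    complete : ∀ z → Least (not ∘ branch g) z → everyW (λ y → not (lessW y z) ∨ branch g y) ∧ not (branch g z) ≡ true
    complete z (¬z , least) = ∧-intro (all-intro _ (words N₀) earlier) ¬z
      where
      earlier : ∀ y → not (lessW y z) ∨ branch g y ≡ true
      earlier y with lessW y z in y<z
      ... | false = refl
      ... | true  = unnot (least y y<z)
        where
        unnot : ∀ {a} → not a ≡ false → a ≡ true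
        unnot {true} _ = refl

verdict-unique : ∀ {n m N₀} {ms : Vec ℕ n} (F : Formula (m ∷ ms)) cs (len : length cs ≡ suc N₀)
  (fits : AllV.All (_< suc N₀) (m ∷ ms)) →
  ∃[ X ] solutions ⟦ verdict {ms′ = Vec.replicate (suc n) (blockSize n (suc N₀))} (suc N₀) cs F ⟧ ≡ X ∷ [] ×
         π₁ X ≡ co-sat (⟦ F ⟧ at guess F cs len fits)
verdict-unique {ms = []}     F cs len fits = SingleBlock.verdict-unique F cs len fits
verdict-unique {ms = _ ∷ _} F cs len fits = SeveralBlocks.verdict-unique F cs len fits

-- From the last query to the answer

length-encodeTokens : ∀ ts → length ts ≤ length (encodeTokens ts)
length-encodeTokens []       = z≤n
length-encodeTokens (t ∷ ts) = ≤-trans (s≤s (length-encodeTokens ts)) (three t)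
  where
  three : ∀ t → suc (length (encodeTokens ts)) ≤ length (bits t ++ encodeTokens ts)
  three stroke = s≤s (m≤n+m _ 2)
  three comma  = s≤s (m≤n+m _ 2)
  three #      = s≤s (m≤n+m _ 2)
  three ⊥ₜ     = s≤s (m≤n+m _ 2)
  three ⊤ₜ     = s≤s (m≤n+m _ 2)
  three ¬ₜ     = s≤s (m≤n+m _ 2)
  three ∧ₜ     = s≤s (m≤n+m _ 2)
  three ∨ₜ     = s≤s (m≤n+m _ 2)

-- Block lengths are written in unary and closed by a comma, so the input outgrows each of them.
-- Strictness matters: a block is one longer than its entry and must still fit into a track of N
-- bits.
blocks-fit : ∀ {n} (ms : Vec ℕ n) (ts : List Token) → AllV.All (_< length (blockTokens ms ++ ts)) ms
blocks-fit []       ts = []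
blocks-fit (m ∷ ms) ts = s≤s (strokes≤ m) ∷
  AllV.map (λ k< → ≤-trans k< (≤-trans (n≤1+n _) (rest≤ (suc m)))) (blocks-fit ms ts)
  where
  strokes≤ : ∀ k → k ≤ length ((replicate k stroke ++ comma ∷ blockTokens ms) ++ ts)
  strokes≤ zero    = z≤n
  strokes≤ (suc k) = s≤s (strokes≤ k)
  rest≤ : ∀ k → length (comma ∷ blockTokens ms ++ ts) ≤ length ((replicate k stroke ++ comma ∷ blockTokens ms) ++ ts)
  rest≤ zero    = ≤-refl
  rest≤ (suc k) = ≤-trans (rest≤ k) (n≤1+n _)

-- A guess that satisfies F shows that F has a solution, wherever the guess came from. Conversely,
-- under the promise a solution is the only one, so the probes inside the block were answered
-- truthfully and the guess is that solution.
usat-of-verdict : ∀ {n m} {ms : Vec ℕ n} (F : Formula (m ∷ ms)) cs y → let w = encode (m ∷ ms , F) in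
  length cs ≡ length w → Replies n w cs → y ∈₊ answers (UVAL (suc n)) (verdictWord n w cs) → y ∈₊ usat ⟦ F ⟧
usat-of-verdict {n} {m} {ms} F cs y len rs y∈ = usat-intro ⟦ F ⟧ λ promise → trans y≡γ (Bool-ext any-intro′ (any-elim′ promise))
  where
  w = encode (m ∷ ms , F)
  fits : AllV.All (_< length w) (m ∷ ms)
  fits = AllV.map (λ k< → ≤-trans k< (length-encodeTokens (blockTokens (m ∷ ms) ++ formulaTokens F))) (blocks-fit (m ∷ ms) (formulaTokens F))
  g = guess F cs len fits
  unique = verdict-unique F cs len fits
  y≡γ : y ≡ co-sat (⟦ F ⟧ at g)
  y≡γ = trans (subst (y ∈₊_) (trans (cong (answers (UVAL (suc n))) (verdictWord-encode (m ∷ ms) F cs (≤-reflexive len) fits))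
          (trans (answers-UVAL (verdict {ms′ = Vec.replicate (suc n) (blockSize n (length w))} (length w) cs F)) (uval-unique ⟦ verdict {ms′ = Vec.replicate (suc n) (blockSize n (length w))} (length w) cs F ⟧ (proj₁ (proj₂ unique))))) y∈) (proj₂ (proj₂ unique))
  any-intro′ : co-sat (⟦ F ⟧ at g) ≡ true → sat ⟦ F ⟧ ≡ true
  any-intro′ eq = any-intro _ (∈-bitVectors g) eq
  any-elim′ : (length (solutions ⟦ F ⟧) ≤ᵇ 1) ≡ true → sat ⟦ F ⟧ ≡ true → co-sat (⟦ F ⟧ at g) ≡ true
  any-elim′ promise eq with x , fx ← any-elim _ (words m) eq = trans (cong (λ x → co-sat (⟦ F ⟧ at x)) g≡x) fx
    where
    sols : solutions ⟦ F ⟧ ≡ x ∷ []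
    sols = filter-singleton _ fx λ y fy → filter≤1 (λ x → co-sat (⟦ F ⟧ at x)) promise fy fx
    g≡x : g ≡ x
    g≡x = ‼-ext λ k< → trans (tabulate-‼ (recall cs) k<)
      (replies-recall F rs sols (subst (_ <_) (sym len) (≤-trans k< (AllV.head fits))) (s≤s⁻¹ k<))

verdict-correct : ∀ n w {cs y} → length cs ≡ length w → Replies n w cs →
  y ∈₊ answers (UVAL (suc n)) (verdictWord n w cs) → y ∈₊ answers (USAT (suc n)) w
verdict-correct n []      len rs y∈ = tt
verdict-correct n (a ∷ w) {cs} {y} len rs y∈ with decode (suc n) (a ∷ w) in eq
... | nothing            = tt
... | just (m ∷ ms , F) with refl ← decode-inverse (suc n) (a ∷ w) eq = usat-of-verdict F cs y len rs y∈

-- Time bounds, and asking a written word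

askTime : ℕ → ℕ
askTime n = rewindTime n + (1 + (sweepTime n 1 + 1))

sweepᴾ : ∀ {f g} → PolyBounded f → PolyBounded g → PolyBounded (λ N → sweepTime (f N) (g N))
sweepᴾ p q = p *ᴾ (constᴾ 3 +ᴾ q) +ᴾ constᴾ 2

forEachᴾ : ∀ {f g} → PolyBounded f → PolyBounded g → PolyBounded (λ N → forEachTime (f N) (g N))
forEachᴾ p q = constᴾ 2 +ᴾ sweepᴾ p (constᴾ 1) +ᴾ sweepᴾ p q

askᴾ : ∀ {f} → PolyBounded f → PolyBounded (λ N → askTime (f N))
askᴾ p = constᴾ 2 +ᴾ sweepᴾ p (constᴾ 1) +ᴾ (constᴾ 1 +ᴾ (sweepᴾ p (constᴾ 1) +ᴾ constᴾ 1))

piecesᴾ : ∀ ℓ → PolyBounded (λ N → piecesTime N ℓ)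
piecesᴾ ℓ = constᴾ ℓ *ᴾ (constᴾ 4 +ᴾ forEachᴾ idᴾ (constᴾ 4)) +ᴾ constᴾ 1

transduceᴾ : ∀ ℓ → PolyBounded (λ N → transduceTime N ℓ)
transduceᴾ ℓ = forEachᴾ idᴾ (piecesᴾ ℓ +ᴾ constᴾ 1)

askTime-mono : ∀ {m n} → m ≤ n → askTime m ≤ askTime n
askTime-mono m≤n = +-mono-≤ (+-monoʳ-≤ 2 (sweepTime-monoˡ 1 m≤n)) (+-monoʳ-≤ 1 (+-monoˡ-≤ 1 (sweepTime-monoˡ 1 m≤n)))

module _ {Γ : Set} {k : ℕ} where

  -- The last sweep takes the head back behind the word, where the next word will be written.
  askWritten : Cmd Γ (7 + k) Bool
  askWritten = rewind O >>= λ _ → query >>= λ y → sweep rightwards O (λ _ _ → done tt) tt >>= λ _ → done y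

module Asking (H : Host) (φ : PromiseProblem) where
  open Host H
  open Emission (hosted H) φ public

  queryWord-atStart : ∀ (L : List (Symbol Extra)) w → queryWord (atStart L w) ≡ w
  queryWord-atStart L []      = refl
  queryWord-atStart L (b ∷ w) = cong (b ∷_) (prefix w)
    where
    prefix : ∀ w → bitPrefix {Extra} (map bit w ++ blank ∷ []) ≡ w
    prefix []      = refl
    prefix (b ∷ w) = cong (b ∷_) (prefix w)

  ask-exec : ∀ ts {L} w → Exec askWritten (ts [ O ]≔ written L w) (askTime (length w))
    (λ y ts′ → y ∈₊ answers φ w × ts′ ≡ ts [ O ]≔ written L w)
  ask-exec ts {L} w = then-exec (rewind-exec ts w) (bind-exec query-exec λ { {y} (y∈ , refl) →
    then-exec forwards (exec-post (λ { (refl , refl) → subst (λ v → y ∈₊ answers φ v) asked y∈ , refl }) done-exec) })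
    where
    asked : queryWord (lookup (ts [ O ]≔ atStart L w) O) ≡ w
    asked = trans (cong queryWord (lookup∘updateAt O ts)) (queryWord-atStart L w)
    forwards : Exec (sweep rightwards O (λ _ _ → done tt) tt) (ts [ O ]≔ atStart L w) (sweepTime (length w) 1)
                 (Returns tt (ts [ O ]≔ written L w))
    forwards = exec-post (λ { (_ , refl , refl) → refl , refl })
      (sweep-exec {d = rightwards} {O} (λ _ _ ts′ → ts′ ≡ ts) w
        (λ { _ _ _ _ refl → exec-post (λ { (refl , refl) → _ , refl , refl }) done-exec })
        {v = []} w {blank ∷ L} {blank ∷ []} refl refl refl)

  emit-ask : ∀ {c : Command ⊤} {ts w t} o → Emits O c ts tt w t →
    Exec (move rightwards O >>= λ _ → c >>= λ _ → askWritten) (ts [ O ]≔ tape o blank []) (1 + (t + askTime t))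
      (λ y ts′ → y ∈₊ answers φ w × ts′ ≡ ts [ O ]≔ written o w)
  emit-ask {ts = ts} {w} o e = then-exec (op-exec ts) (then-exec (e .runs (blank ∷ o))
    -- The time spent on writing bounds the length of the query, so `askTime t` covers the passes
    -- over it.
    (exec-weaken (askTime-mono (e .size)) (ask-exec ts w)))

-- `UVAL` from one query to `USAT`

probeBits : List Bool
probeBits = encodeTokens (comma ∷ # ∷ ∧ₜ ∷ [])

-- In Polish notation a conjunct is added at the end of the word: `probeBits` spells the first
-- variable and the connective, and the machine copies its input unread.
firstBit-correct : ∀ n w {y} → y ∈₊ answers (USAT (suc n)) (w ++ probeBits) → y ∈₊ answers (UVAL (suc n)) w
firstBit-correct n []      y∈ = tt
firstBit-correct n (a ∷ w) {y} y∈ with decode (suc n) (a ∷ w) in eq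
... | nothing           = tt
... | just (m ∷ ms , F) = uval-intro ⟦ F ⟧ first
  where
  G : Formula (m ∷ ms)
  G = and F (var zero zero)
  encoded : (a ∷ w) ++ probeBits ≡ encode (m ∷ ms , G)
  encoded = trans (cong (_++ probeBits) (decode-inverse (suc n) (a ∷ w) eq))
    (trans (sym (concatMap-++ bits (blockTokens (m ∷ ms) ++ formulaTokens F) _))
           (cong encodeTokens (++-assoc (blockTokens (m ∷ ms)) (formulaTokens F) _)))
  y∈G : y ∈₊ usat ⟦ G ⟧
  y∈G = subst (y ∈₊_) (trans (cong (answers (USAT (suc n))) encoded) (answers-USAT G)) y∈
  conjoin : ∀ {k} {ms : Vec ℕ k} (f : Fun ms) b → co-sat (λ xs → f xs ∧ b) ≡ co-sat f ∧ b
  conjoin f true  = trans (co-sat-cong (λ xs → ∧-identityʳ (f xs))) (sym (∧-identityʳ _))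
  conjoin {ms = ms} f false = trans (trans (co-sat-cong (λ xs → ∧-zeroʳ (f xs))) (co-sat-const ms false)) (sym (∧-zeroʳ _))
  solves : ∀ x → co-sat (⟦ G ⟧ at x) ≡ co-sat (⟦ F ⟧ at x) ∧ π₁ x
  solves (b ∷ x) = conjoin (⟦ F ⟧ at (b ∷ x)) b
  first : ∀ {x} → solutions ⟦ F ⟧ ≡ x ∷ [] → y ≡ π₁ x
  first {x} sols = trans (subst (y ∈₊_) (usat-promised ⟦ G ⟧ (filter≤1⁻ (λ x → co-sat (⟦ G ⟧ at x)) same)) y∈G) (Bool-ext
    (λ sat → let z , Gz = any-elim _ (words m) sat; Fz , z₁ = ∧-elim (trans (sym (solves z)) Gz) in
             trans (cong π₁ (sym (unique z Fz))) z₁)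
    (λ x₁ → any-intro _ (∈-bitVectors x) (trans (solves x) (∧-intro Fx x₁))))
    where
    Fx = proj₁ (singleton-filter (λ x → co-sat (⟦ F ⟧ at x)) sols)
    unique = proj₂ (singleton-filter (λ x → co-sat (⟦ F ⟧ at x)) sols)
    same : ∀ {z z′} → co-sat (⟦ G ⟧ at z) ≡ true → co-sat (⟦ G ⟧ at z′) ≡ true → z ≡ z′
    same {z} {z′} e e′ = trans (unique z (proj₁ (∧-elim (trans (sym (solves z)) e))))
                          (sym (unique z′ (proj₁ (∧-elim (trans (sym (solves z′)) e′)))))

module FirstBit (n : ℕ) where

  firstBit : ∀ {Γ k} → Cmd Γ (7 + k) Bool
  firstBit = move rightwards O >>= λ _ → (copy O W >>= λ _ → pushes O probeBits) >>= λ _ → askWritten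

  -- The 10 is made up of the nine bits of `probeBits` and the closing step of `pushes`.
  firstBitTime : ℕ → ℕ
  firstBitTime N = 1 + ((forEachTime N 1 + 10) + askTime (forEachTime N 1 + 10))

  firstBitᴾ : PolyBounded firstBitTime
  firstBitᴾ = constᴾ 1 +ᴾ (emittingᴾ +ᴾ askᴾ emittingᴾ)
    where
    emittingᴾ : PolyBounded (λ N → forEachTime N 1 + 10)
    emittingᴾ = forEachᴾ idᴾ (constᴾ 1) +ᴾ constᴾ 10

  module _ (H : Host) where
    open Asking H (USAT (suc n))

    firstBit-exec : Answers (UVAL (suc n)) (USAT (suc n)) H firstBit (eval (proj₁ firstBitᴾ))
    firstBit-exec w {o} {l} {c} {d} {j} {e} {λ′} {ts} = exec-weaken (proj₂ firstBitᴾ (length w)) (exec-post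
      (λ { (y∈ , refl) → firstBit-correct n w y∈ , (_ ∷ _ ∷ _ ∷ _ ∷ _ ∷ _ ∷ _ ∷ []) , refl })
      (emit-ask {ts = work (o ∷ (map bit w ʳ++ blank ∷ l) ∷ c ∷ d ∷ j ∷ e ∷ λ′ ∷ []) ts} o
        (emits-copy w (λ ()) refl then emits-pushes probeBits)))

UVAL-by-USAT : ∀ n → Subroutine (UVAL (suc n)) (USAT (suc n))
UVAL-by-USAT n = record { command = firstBit ; time = proj₁ firstBitᴾ ; correct = firstBit-exec }
  where open FirstBit n

-- `USAT` from queries to `UVAL`

counter : ∀ {k} → Counter → Fin (7 + k)
counter total = C
counter index = J

module _ {Γ : Set} {k : ℕ} (n : ℕ) where

  private
    emit : Fin (7 + k) → Pieces → Cmd Γ (7 + k) ⊤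
    emit = emitPieces counter

    rewrite-input : Transducer (Mode (suc n)) Counter → Cmd Γ (7 + k) (Mode (suc n) × Buffer)
    rewrite-input T = transduce counter O T W (startMode (suc n))

  emitProbe emitVerdict prepare : Cmd Γ (7 + k) ⊤
  emitProbe = rewrite-input (widening n) >>= λ _ → rewrite-input (shiftingᵀ n) >>= λ _ → emit O probePieces

  emitVerdict =
    emit O (headerPieces n) >>= λ _ → copy O E >>= λ _ → copy O Λ >>= λ _ → emit O (tok ¬ₜ ∷ []) >>= λ _ →
    rewrite-input (shiftingᵀ n) >>= λ _ → emit O (tok ∨ₜ ∷ tok ∧ₜ ∷ tok comma ∷ tok # ∷ []) >>= λ _ →
    copy O Λ >>= λ _ → emit O (tok ¬ₜ ∷ tok ∧ₜ ∷ []) >>= λ _ → rewrite-input (shiftingᵀ n) >>= λ _ →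
    emit O (tok ∧ₜ ∷ tok comma ∷ tok # ∷ tok ¬ₜ ∷ []) >>= λ _ → rewrite-input (retrackingᵀ n) >>= λ _ →
    emit O (tok ¬ₜ ∷ tok ∧ₜ ∷ tok ∨ₜ ∷ tok ∧ₜ ∷ [])

  prepare =
    -- The main loop needs N rounds but cannot run over `W`, which every probe reads from start to
    -- end; `D` is a copy that only counts the rounds.
    move rightwards C >>= λ _ → forEach W (λ _ _ → push C true) tt >>= λ _ → move rightwards D >>= λ _ → copy D W >>= λ _ →
    move rightwards J >>= λ _ → move rightwards E >>= λ _ → pushes E (bits ⊤ₜ) >>= λ _ →
    move rightwards Λ >>= λ _ → pushes Λ (bits ⊥ₜ)

  record-reply : Bool → Cmd Γ (7 + k) ⊤
  -- `J` advances last, since both suffixes speak of the position just probed.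
  record-reply y = emit E (literalPieces y) >>= λ _ → emit Λ (lessPieces n) >>= λ _ → push J true

  ask-probe : Cmd Γ (7 + k) ⊤
  ask-probe = (move rightwards O >>= λ _ → emitProbe >>= λ _ → askWritten) >>= record-reply

  decide : Cmd Γ (7 + k) Bool
  decide = prepare >>= λ _ → forEach D (λ _ _ → ask-probe) tt >>= λ _ →
    move rightwards O >>= λ _ → emitVerdict >>= λ _ → askWritten

module Deciding (n : ℕ) where

  -- In `transduceTime N 3`, 3 bounds the number of pieces per input token, and 6 is the length of
  -- the longer literal. The summand 3 in `literalsTime` and `lessTime` counts the bits of the
  -- constant with which the tapes `E` and `Λ` begin.
  probeTime literalsTime lessTime roundTime prepareTime verdictTime decideTime : ℕ → ℕ
  probeTime N    = transduceTime N 3 + (transduceTime N 3 + piecesTime N (length probePieces))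
  literalsTime N = 3 + N * piecesTime N 6
  lessTime N     = 3 + N * piecesTime N (length (lessPieces n))
  roundTime N    = (1 + (probeTime N + askTime (probeTime N))) +
                   (piecesTime N 6 + (piecesTime N (length (lessPieces n)) + 1))
  prepareTime N  = 1 + (forEachTime N 1 + (1 + (forEachTime N 1 + (1 + (1 + (4 + (1 + 4)))))))
  verdictTime N  =
    piecesTime N (length (headerPieces n)) + (forEachTime (literalsTime N) 1 + (forEachTime (lessTime N) 1 +
    (piecesTime N 1 + (transduceTime N 3 + (piecesTime N 4 + (forEachTime (lessTime N) 1 + (piecesTime N 2 +
    (transduceTime N 3 + (piecesTime N 4 + (transduceTime N 3 + piecesTime N 4))))))))))
  decideTime N   = prepareTime N + (forEachTime N (roundTime N) + (1 + (verdictTime N + askTime (verdictTime N))))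

  decideᴾ : PolyBounded decideTime
  decideᴾ = prepareᴾ +ᴾ (forEachᴾ idᴾ roundᴾ +ᴾ (constᴾ 1 +ᴾ (verdictᴾ +ᴾ askᴾ verdictᴾ)))
    where
    probeᴾ : PolyBounded probeTime
    probeᴾ = transduceᴾ 3 +ᴾ (transduceᴾ 3 +ᴾ piecesᴾ (length probePieces))
    roundᴾ : PolyBounded roundTime
    roundᴾ = constᴾ 1 +ᴾ (probeᴾ +ᴾ askᴾ probeᴾ) +ᴾ (piecesᴾ 6 +ᴾ (piecesᴾ (length (lessPieces n)) +ᴾ constᴾ 1))
    prepareᴾ : PolyBounded prepareTime
    prepareᴾ = constᴾ 1 +ᴾ (forEachᴾ idᴾ (constᴾ 1) +ᴾ (constᴾ 1 +ᴾ (forEachᴾ idᴾ (constᴾ 1) +ᴾ constᴾ 11)))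
    literalsᴾ : PolyBounded literalsTime
    literalsᴾ = constᴾ 3 +ᴾ idᴾ *ᴾ piecesᴾ 6
    lessᴾ : PolyBounded lessTime
    lessᴾ = constᴾ 3 +ᴾ idᴾ *ᴾ piecesᴾ (length (lessPieces n))
    verdictᴾ : PolyBounded verdictTime
    verdictᴾ = piecesᴾ (length (headerPieces n)) +ᴾ (forEachᴾ literalsᴾ (constᴾ 1) +ᴾ (forEachᴾ lessᴾ (constᴾ 1) +ᴾ
      (piecesᴾ 1 +ᴾ (transduceᴾ 3 +ᴾ (piecesᴾ 4 +ᴾ (forEachᴾ lessᴾ (constᴾ 1) +ᴾ (piecesᴾ 2 +ᴾ
      (transduceᴾ 3 +ᴾ (piecesᴾ 4 +ᴾ (transduceᴾ 3 +ᴾ piecesᴾ 4))))))))))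

  output≤3 : ∀ {onHeader onFormula} → (∀ t → length (onHeader t) ≤ 3) → (∀ p t → length (onFormula p t) ≤ 3) →
    ∀ {k} (m : Mode k) t → length (outputMode onHeader onFormula m t) ≤ 3
  output≤3 h f (phase p)  t = f p t
  output≤3 h f header     t = h t
  output≤3 h f (beyond m) t = output≤3 h f m t

  widen≤3 : ∀ t → length (widen t) ≤ 3
  widen≤3 stroke = s≤s z≤n
  widen≤3 comma  = s≤s (s≤s z≤n)
  widen≤3 #      = s≤s z≤n
  widen≤3 ⊥ₜ     = s≤s z≤n
  widen≤3 ⊤ₜ     = s≤s z≤n
  widen≤3 ¬ₜ     = s≤s z≤n
  widen≤3 ∧ₜ     = s≤s z≤n
  widen≤3 ∨ₜ     = s≤s z≤n

  shifting≤3 : ∀ p t → length (shifting p t) ≤ 3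
  shifting≤3 p stroke = s≤s z≤n
  shifting≤3 p comma  = s≤s (s≤s z≤n)
  shifting≤3 p #      = s≤s z≤n
  shifting≤3 p ⊥ₜ     = s≤s z≤n
  shifting≤3 p ⊤ₜ     = s≤s z≤n
  shifting≤3 p ¬ₜ     = s≤s z≤n
  shifting≤3 p ∧ₜ     = s≤s z≤n
  shifting≤3 p ∨ₜ     = s≤s z≤n

  retracking≤3 : ∀ p t → length (retracking p t) ≤ 3
  retracking≤3 between    stroke = z≤n
  retracking≤3 between    comma  = s≤s (s≤s z≤n)
  retracking≤3 between    #      = s≤s z≤n
  retracking≤3 between    ⊥ₜ     = s≤s z≤n
  retracking≤3 between    ⊤ₜ     = s≤s z≤n
  retracking≤3 between    ¬ₜ     = s≤s z≤n
  retracking≤3 between    ∧ₜ     = s≤s z≤n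
  retracking≤3 between    ∨ₜ     = s≤s z≤n
  retracking≤3 inBlock    stroke = s≤s z≤n
  retracking≤3 inBlock    comma  = s≤s (s≤s (s≤s z≤n))
  retracking≤3 inBlock    #      = s≤s z≤n
  retracking≤3 inBlock    ⊥ₜ     = s≤s z≤n
  retracking≤3 inBlock    ⊤ₜ     = s≤s z≤n
  retracking≤3 inBlock    ¬ₜ     = s≤s z≤n
  retracking≤3 inBlock    ∧ₜ     = s≤s z≤n
  retracking≤3 inBlock    ∨ₜ     = s≤s z≤n
  retracking≤3 inPosition stroke = s≤s z≤n
  retracking≤3 inPosition comma  = s≤s (s≤s z≤n)
  retracking≤3 inPosition #      = s≤s z≤n
  retracking≤3 inPosition ⊥ₜ     = s≤s z≤n
  retracking≤3 inPosition ⊤ₜ     = s≤s z≤n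
  retracking≤3 inPosition ¬ₜ     = s≤s z≤n
  retracking≤3 inPosition ∧ₜ     = s≤s z≤n
  retracking≤3 inPosition ∨ₜ     = s≤s z≤n

  module Run (H : Host) where
    open Host H
    open Asking H (UVAL (suc n))

    module _ (w : List Bool) (wl cl dl jl el ll : List (Symbol Extra)) (ts : Vec (Tape Extra) others) where
      private
        N = length w

      tally-tape : ℕ → List (Symbol Extra) → Tape Extra
      tally-tape k L = written L (replicate k true)

      state : Tape Extra → Tape Extra → ℕ → List Bool → List Bool → Tapes
      state o d k lits lts = o ∷ written wl w ∷ tally-tape N cl ∷ d ∷ tally-tape k jl ∷ written el lits ∷ written ll lts ∷ ts

      module _ {d : Tape Extra} {k : ℕ} (k≤N : k ≤ N) where
        private
          ν = tally N k

          bounded : ∀ κ → tally N k κ ≤ N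
          bounded total = ≤-refl
          bounded index = k≤N

          garbage : Counter → List (Symbol Extra)
          garbage total = cl
          garbage index = jl

        counters : ∀ {i o w′ e l} → (∀ κ → i ≢ counter κ) →
          Counters counter ν N i (o ∷ w′ ∷ tally-tape N cl ∷ d ∷ tally-tape k jl ∷ e ∷ l ∷ ts)
        counters apart = record { apart = apart ; garbage = garbage ; holds = holds ; bounded = bounded }
          where
          holds : ∀ κ → _ ≡ _
          holds total = refl
          holds index = refl

        O-apart : ∀ {k} κ → zero {6 + k} ≢ counter κ
        O-apart total ()
        O-apart index ()

        module _ {lits lts : List Bool} where
          private
            s : Tapes
            s = state (tape [] blank []) d k lits lts

          emits-pieces-O : ∀ ps → Emits O (emitPieces counter O ps) s tt (encodeTokens (expand ν ps)) (piecesTime N (length ps))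
          emits-pieces-O = emits-pieces counter ν N O (counters O-apart)

          emits-rewriting : ∀ {onHeader onFormula} → (∀ t → length (onHeader t) ≤ 3) → (∀ p t → length (onFormula p t) ≤ 3) →
            let T = rewriting onHeader onFormula (suc n) in
            Emits O (transduce counter O T W (startMode (suc n))) s _ (Transducer.transduction T ν (startMode (suc n)) w) (transduceTime N 3)
          emits-rewriting {onHeader} {onFormula} h f =
            emits-transduce counter ν N O (rewriting onHeader onFormula (suc n)) w (output≤3 h f) (λ ()) refl
              (λ t → counters O-apart) (startMode (suc n))

          emits-probe : Emits O (emitProbe n) s tt (probeWord n w k) (probeTime N)
          emits-probe = emits-rewriting widen≤3 (λ _ _ → z≤n) then emits-rewriting (λ _ → z≤n) shifting≤3 then
            emits-pieces-O probePieces

        module _ (o e l : Tape Extra) where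
          private
            s : Tapes
            s = o ∷ written wl w ∷ tally-tape N cl ∷ d ∷ tally-tape k jl ∷ e ∷ l ∷ ts

          emits-literal : ∀ y → Emits E (emitPieces counter E (literalPieces y)) s tt
            (encodeTokens (expand ν (literalPieces y))) (piecesTime N 6)
          emits-literal y = emits-weaken (+-monoˡ-≤ 1 (*-monoˡ-≤ (pieceTime N) (six y)))
            (emits-pieces counter ν N E (counters (λ { total () ; index () })) (literalPieces y))
            where
            six : ∀ y → length (literalPieces y) ≤ 6
            six true  = n≤1+n 5
            six false = ≤-refl

          emits-less : Emits Λ (emitPieces counter Λ (lessPieces n)) s tt
            (encodeTokens (expand ν (lessPieces n))) (piecesTime N (length (lessPieces n)))
          emits-less = emits-pieces counter ν N Λ (counters (λ { total () ; index () })) (lessPieces n)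

      -- Sizes belong to the invariant because the verdict copies both formula tapes, at a cost that
      -- grows with their contents. Tape `D` is a placeholder, to be overwritten by `forEach-exec`.
      record Round (v : List Bool) (_ : ⊤) (ts′ : Tapes) : Set where
        field
          replies  : List Bool
          replied  : Replies n w replies
          progress : length replies ≡ length v
          oracle   : List (Symbol Extra)
          tapes≡   : ts′ ≡ state (tape oracle blank []) (tape [] blank []) (length replies)
                             (literalsWord n N replies) (lessWord n N (length replies))
          literals≤ : length (literalsWord n N replies) ≤ 3 + length replies * piecesTime N 6
          less≤     : length (lessWord n N (length replies)) ≤ 3 + length replies * piecesTime N (length (lessPieces n))

      extend : ∀ (L : List (Symbol Extra)) u u′ → map bit u′ ʳ++ map bit u ʳ++ blank ∷ L ≡ map bit (u ++ u′) ʳ++ blank ∷ L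
      extend L u u′ = sym (trans (cong (_ʳ++ blank ∷ L) (map-++ {A = Bool} bit u u′)) (++-ʳ++ (map bit u)))

      tally-suc : ∀ k (L : List (Symbol Extra)) → bit true ∷ (map bit (replicate k true) ʳ++ L) ≡ map bit (replicate (suc k) true) ʳ++ L
      tally-suc zero    L = refl
      tally-suc (suc k) L = tally-suc k (bit true ∷ L)

      longer : ∀ (u u′ : List Bool) k {b} → length u ≤ 3 + k * b → length u′ ≤ b → length (u ++ u′) ≤ 3 + suc k * b
      longer u u′ k {b} u≤ u′≤ = ≤-trans (≤-reflexive (length-++ u)) (≤-trans (+-mono-≤ u≤ u′≤)
        (≤-reflexive (trans (+-assoc 3 (k * b) b) (cong (3 +_) (+-comm (k * b) b)))))

      round-exec : ∀ {v s ts′} b w′ t → v ++ b ∷ w′ ≡ w → Round v s ts′ →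
        Exec (ask-probe n) (ts′ [ D ]≔ t) (roundTime N)
          (λ s′ ts″ → ∃[ ts‴ ] Round (v ∷ʳ b) s′ ts‴ × ts″ ≡ ts‴ [ D ]≔ t)
      round-exec {v} b w′ t v≡ record { replies = cs ; replied = rs ; progress = p ; oracle = o ; tapes≡ = refl ; literals≤ = l₁ ; less≤ = l₂ } =
        bind-exec (emit-ask o (emits-probe {d = t} k≤N {literalsWord n N cs} {lessWord n N k})) λ { {y} (y∈ , refl) →
        then-exec (emits-literal {d = t} k≤N _ none _ y .runs _)
        (then-exec (emits-less {d = t} k≤N _ _ none .runs _)
        (exec-post (λ { (refl , refl) → _ , record
            { replies   = y ∷ cs
            ; replied   = y∈ ∷ rs
            ; progress  = trans (cong suc p) (sym (trans (length-++ v) (+-comm (length v) 1)))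
            ; oracle    = _
            ; tapes≡    = refl
            ; literals≤ = longer (literalsWord n N cs) (encodeTokens (expand (tally N k) (literalPieces y))) k l₁ (emits-literal {d = t} k≤N none none none y .size)
            ; less≤     = longer (lessWord n N k) (encodeTokens (expand (tally N k) (lessPieces n))) k l₂ (emits-less {d = t} k≤N none none none .size)
            } , next≡ y })
          op-exec′)) }
        where
        k = length cs
        none : Tape Extra
        none = tape [] blank []
        k≤N : k ≤ N
        k≤N = ≤-trans (≤-reflexive p) (≤-trans (m≤m+n (length v) _) (≤-reflexive (trans (sym (length-++ v)) (cong length v≡))))
        lists : List (Symbol Extra) → List (Symbol Extra) → List (Symbol Extra) → Tapes
        lists j e l = written o (probeWord n w k) ∷ written wl w ∷ tally-tape N cl ∷ t ∷
                      tape j blank [] ∷ tape e blank [] ∷ tape l blank [] ∷ ts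
        next≡ : ∀ y → let e = map bit (literalsWord n N cs) ʳ++ blank ∷ el
                          l = map bit (lessWord n N k) ʳ++ blank ∷ ll in
          lists (bit true ∷ (map bit (replicate k true) ʳ++ blank ∷ jl))
                (map bit (encodeTokens (expand (tally N k) (literalPieces y))) ʳ++ e)
                (map bit (encodeTokens (expand (tally N k) (lessPieces n))) ʳ++ l)
            ≡ state (written o (probeWord n w k)) t (suc k) (literalsWord n N (y ∷ cs)) (lessWord n N (suc k))
        next≡ y = trans (cong₂ (λ j e → lists j e (map bit (encodeTokens (expand (tally N k) (lessPieces n))) ʳ++ map bit (lessWord n N k) ʳ++ blank ∷ ll))
            (tally-suc k (blank ∷ jl)) (extend el (literalsWord n N cs) (encodeTokens (expand (tally N k) (literalPieces y)))))
          (cong (lists _ _) (extend ll (lessWord n N k) (encodeTokens (expand (tally N k) (lessPieces n)))))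

      emits-verdict : ∀ {d cs} → length cs ≤ N → length (literalsWord n N cs) ≤ literalsTime N →
        length (lessWord n N (length cs)) ≤ lessTime N →
        Emits O (emitVerdict n) (state (tape [] blank []) d (length cs) (literalsWord n N cs) (lessWord n N (length cs)))
          tt (verdictWord n w cs) (verdictTime N)
      emits-verdict {d} {cs} k≤N l₁ l₂ =
        pieces-O (headerPieces n) then emits-weaken (forEachTime-monoˡ 1 l₁) (emits-copy (literalsWord n N cs) (λ ()) refl) then
        comparison then pieces-O (tok ¬ₜ ∷ []) then shifted then
        pieces-O (tok ∨ₜ ∷ tok ∧ₜ ∷ tok comma ∷ tok # ∷ []) then comparison then
        pieces-O (tok ¬ₜ ∷ tok ∧ₜ ∷ []) then shifted then
        pieces-O (tok ∧ₜ ∷ tok comma ∷ tok # ∷ tok ¬ₜ ∷ []) then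
        emits-rewriting {d = d} k≤N {literalsWord n N cs} {lessWord n N (length cs)} (λ _ → z≤n) retracking≤3 then pieces-O (tok ¬ₜ ∷ tok ∧ₜ ∷ tok ∨ₜ ∷ tok ∧ₜ ∷ [])
        where
        s = state (tape [] blank []) d (length cs) (literalsWord n N cs) (lessWord n N (length cs))
        pieces-O = emits-pieces-O {d = d} k≤N {literalsWord n N cs} {lessWord n N (length cs)}
        shifted = emits-rewriting {d = d} k≤N {literalsWord n N cs} {lessWord n N (length cs)} (λ _ → z≤n) shifting≤3
        comparison : Emits O (copy O Λ) s tt (lessWord n N (length cs)) (forEachTime (lessTime N) 1)
        comparison = emits-weaken (forEachTime-monoˡ 1 l₂) (emits-copy (lessWord n N (length cs)) (λ ()) refl)

      prepare-exec : ∀ {o} → Exec (prepare n)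
        (work (o ∷ (map bit w ʳ++ blank ∷ wl) ∷ cl ∷ dl ∷ jl ∷ el ∷ ll ∷ []) ts) (prepareTime N)
        (Returns tt (state (tape o blank []) (written dl w) 0 (bits ⊤ₜ) (bits ⊥ₜ)))
      prepare-exec {o} =
        then-exec (op-exec′)
        (then-exec (marks .runs (blank ∷ cl))
        (then-exec (op-exec′)
        (then-exec (copied .runs (blank ∷ dl))
        (then-exec (op-exec′)
        (then-exec (op-exec′)
        (then-exec (emits-pushes {i = E} {_ ∷ _ ∷ _ ∷ _ ∷ _ ∷ at-rest [] ∷ _ ∷ ts} (bits ⊤ₜ) .runs (blank ∷ el))
        (then-exec (op-exec′)
        (emits-pushes {i = Λ} {_ ∷ _ ∷ _ ∷ _ ∷ _ ∷ _ ∷ at-rest [] ∷ ts} (bits ⊥ₜ) .runs (blank ∷ ll)))))))))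
        where
        at-rest : List (Symbol Extra) → Tape Extra
        at-rest l = tape l blank []
        trues : ∀ w → outputs (λ _ _ → tt) (λ _ _ → true ∷ []) tt w ≡ replicate (length w) true
        trues []      = refl
        trues (_ ∷ w) = cong (true ∷_) (trues w)
        marks : Emits C (forEach W (λ _ _ → push C true) tt)
          (at-rest o ∷ written wl w ∷ at-rest cl ∷ at-rest dl ∷ at-rest jl ∷ at-rest el ∷ at-rest ll ∷ ts)
          tt (replicate N true) (forEachTime N 1)
        marks = emits-out (trues w) (emits-forEach {next = λ _ _ → tt} {out = λ _ _ → true ∷ []} w (λ ()) refl
                  (λ _ _ _ → emits-push true) tt)
        copied : Emits D (copy D W)
          (at-rest o ∷ written wl w ∷ tally-tape N cl ∷ at-rest dl ∷ at-rest jl ∷ at-rest el ∷ at-rest ll ∷ ts)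
          tt w (forEachTime N 1)
        copied = emits-copy w (λ ()) refl

      decide-exec : ∀ {o} → Exec (decide n)
        (work (o ∷ (map bit w ʳ++ blank ∷ wl) ∷ cl ∷ dl ∷ jl ∷ el ∷ ll ∷ []) ts) (decideTime N)
        (λ y ts′ → y ∈₊ answers (USAT (suc n)) w × ∃[ ls ] ts′ ≡ work ls ts)
      decide-exec {o} =
        then-exec prepare-exec (bind-exec (forEach-exec {i = D} Round w round-exec {ts = state _ _ 0 (bits ⊤ₜ) (bits ⊥ₜ)} round₀)
          λ { (_ , record { replies = cs ; replied = rs ; progress = p ; oracle = o′ ; tapes≡ = refl ; literals≤ = l₁ ; less≤ = l₂ } , refl) →
            exec-post (λ { (y∈ , refl) → verdict-correct n w p rs y∈ , (_ ∷ _ ∷ _ ∷ _ ∷ _ ∷ _ ∷ _ ∷ []) , refl })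
              (emit-ask o′ (emits-verdict {written dl w} {cs} (≤-reflexive p)
                (subst (λ k → length (literalsWord n N cs) ≤ 3 + k * piecesTime N 6) p l₁)
                (subst (λ k → length (lessWord n N (length cs)) ≤ 3 + k * piecesTime N (length (lessPieces n))) p l₂))) })
        where
        round₀ : Round [] tt (state (tape o blank []) (tape [] blank []) 0 (bits ⊤ₜ) (bits ⊥ₜ))
        round₀ = record { replies = [] ; replied = [] ; progress = refl ; oracle = o ; tapes≡ = refl
                       ; literals≤ = ≤-refl ; less≤ = ≤-refl }

USAT-by-UVAL : ∀ n → Subroutine (USAT (suc n)) (UVAL (suc n))
USAT-by-UVAL n = record
  { command = decide n
  ; time    = proj₁ decideᴾ
  ; correct = λ H w → Exec.exec-weaken (hosted H) (UVAL (suc n)) (proj₂ decideᴾ (length w))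
                        (Run.decide-exec H w _ _ _ _ _ _ _)
  }
  where open Deciding n

theorem12 : ∀ (n : ℕ) .{{_ : NonZero n}} → P̂ (UVAL n) ≐ P̂ (USAT n)
theorem12 (suc n) = simulate (UVAL-by-USAT n) , simulate (USAT-by-UVAL n)
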